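{- Let $q=p^n$ with $p>2$ prime, let $g\ge 2$ be an integer with $\gcd(g,p)=1$, and let $c\in\mathbb{F}_q$ be such that $C': y^2=x^{2g+1}+c\,x^{g+1}+x$ is a (nonsingular) hyperelliptic curve of genus $g$ over $\mathbb{F}_q$. Let $s$ be the involution $s:(x,y)\mapsto\left(\frac1x,\frac{y}{x^{g+1}}\right)$ of $C'$ and $\omega:(x,y)\mapsto(x,-y)$ the hyperelliptic involution. Then: 1. The quotient curve $C'/\langle s\rangle$ is given (i.e. is birationally equivalent over $\mathbb{F}_q$ to the curve given) by $X_1': y^2=D_g(x)+c$ if $g$ is odd, and by $X_1': y^2=(x+2)(D_g(x)+c)$ if $g$ is even. 2. The quotient curve $C'/\langle s\omega\rangle$, where $s\omega:(x,y)\mapsto\left(\frac1x,-\frac{y}{x^{g+1}}\right)$, is given by $X_2': y^2=(x^2-4)(D_g(x)+c)$ if $g$ is odd, and by $X_2': y^2=(x-2)(D_g(x)+c)$ if $g$ is even.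
   Context: For $m\ge1$ and $\alpha$ in a field, the Dickson polynomial $D_m(x,\alpha)=\sum_{i=0}^{\lfloor m/2\rfloor}\frac{m}{m-i}\binom{m-i}{i}(-\alpha)^i x^{m-2i}$ is the unique polynomial satisfying $D_m\!\left(u+\frac{\alpha}{u},\alpha\right)=u^m+\left(\frac{\alpha}{u}\right)^m$; we write $D_m(x):=D_m(x,1)$. -}

module Defs where

open import Algebra.Bundles using (CommutativeRing)
open import Algebra.Morphism.Structures using (IsRingHomomorphism; IsRingIsomorphism)
open import Algebra.Structures using (IsCommutativeRing)
import Algebra.Properties.Group as GroupProperties
import Algebra.Properties.Ring as RingProperties
import Algebra.Properties.Semiring.Exp as Exp
import Algebra.Properties.Semiring.Mult as Multiples
import Algebra.Properties.Semiring.Sum as Sums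
import Algebra.Solver.Ring.NaturalCoefficients.Default as SemiringSolver
open import Data.Empty using (⊥-elim; ⊥-elim-irr)
open import Data.Fin.Base using (Fin; toℕ)
open import Data.List.Base using (List; []; _∷_; map; _ʳ++_; length)
open import Data.Nat.Base as ℕ using (ℕ; zero; suc; _∸_; ⌊_/2⌋)
open import Data.Nat.Combinatorics using (_C_)
open import Data.Nat.Solver using (module +-*-Solver)
open import Data.Nat.DivMod using (_/_)
open import Data.Product.Base using (Σ; ∃-syntax; _×_; _,_; proj₁; proj₂)
open import Data.Sum.Base using (_⊎_; inj₁; inj₂)
open import Function.Bundles using (Inverse)
open import Level using (Level; _⊔_)
open import Relation.Binary.Bundles using (Setoid)
open import Relation.Binary.Core using (Rel)
open import Relation.Binary.Definitions using (Decidable)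
open import Relation.Binary.Structures using (IsEquivalence)
open import Relation.Binary.PropositionalEquality.Core as ≡ using (_≡_)
import Relation.Binary.PropositionalEquality.Properties as ≡
import Relation.Binary.Reasoning.Setoid as SetoidReasoning
open import Relation.Nullary.Decidable using (Dec; yes; no; map′)
open import Relation.Nullary.Negation.Core using (¬_)

open CommutativeRing using (Carrier; rawRing)

private
  variable
    a b c ℓ ℓ₁ ℓ₂ ℓ₃ : Level

-- A discrete field; HeytingField carries an apartness relation, which is
-- superfluous when equality is decidable.

record Field a ℓ : Set (Level.suc (a ⊔ ℓ)) where
  field
    commutativeRing : CommutativeRing a ℓ
  open CommutativeRing commutativeRing public
  field
    _≟_     : Decidable _≈_
    1≉0     : ¬ 1# ≈ 0#
    inverse : ∀ x → ¬ x ≈ 0# → ∃[ y ] x * y ≈ 1#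

HasCardinality : Field a ℓ → ℕ → Set (a ⊔ ℓ)
HasCardinality k q = Inverse (≡.setoid (Fin q)) (Field.setoid k)

record Hom (A : CommutativeRing a ℓ₁) (B : CommutativeRing b ℓ₂) : Set (a ⊔ b ⊔ ℓ₁ ⊔ ℓ₂) where
  field
    ⟦_⟧                : Carrier A → Carrier B
    isRingHomomorphism : IsRingHomomorphism (rawRing A) (rawRing B) ⟦_⟧
  open IsRingHomomorphism isRingHomomorphism public

Invertible : (R : CommutativeRing a ℓ) → Carrier R → Set (a ⊔ ℓ)
Invertible R x = ∃[ y ] x * y ≈ 1#
  where
  open CommutativeRing R

module RingLemmas {a ℓ} (R : CommutativeRing a ℓ) where
  open CommutativeRing R
  open SetoidReasoning setoid
  open RingProperties ring public using (-‿distribˡ-*; -‿distribʳ-*)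
  open GroupProperties +-group public using (ε⁻¹≈ε; ⁻¹-involutive)
  open SemiringSolver commutativeSemiring public using (solve; _:=_; _:+_; _:*_; con)

  -x*-y≈x*y : ∀ x y → - x * - y ≈ x * y
  -x*-y≈x*y x y = begin
    - x * - y      ≈⟨ -‿distribˡ-* x (- y) ⟨
    - (x * - y)    ≈⟨ -‿cong (-‿distribʳ-* x y) ⟨
    - (- (x * y))  ≈⟨ ⁻¹-involutive (x * y) ⟩
    x * y          ∎

  x-y≈0⇒x≈y : ∀ x y → x + - y ≈ 0# → x ≈ y
  x-y≈0⇒x≈y x y e = begin
    x              ≈⟨ +-identityʳ x ⟨
    x + 0#         ≈⟨ +-congˡ (-‿inverseˡ y) ⟨
    x + (- y + y)  ≈⟨ +-assoc x (- y) y ⟨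
    x + - y + y    ≈⟨ +-congʳ e ⟩
    0# + y         ≈⟨ +-identityˡ y ⟩
    y              ∎

-- The ring axioms that do not follow from commutativity and the others.

module _ {A : Set a} (_≈_ : Rel A ℓ) (_+_ _*_ : A → A → A) (-_ : A → A) (0# 1# : A) where

  record CommutativeRingLaws : Set (a ⊔ ℓ) where
    field
      isEquivalence : IsEquivalence _≈_
      +-cong        : ∀ {x x′ y y′} → x ≈ x′ → y ≈ y′ → (x + y) ≈ (x′ + y′)
      *-cong        : ∀ {x x′ y y′} → x ≈ x′ → y ≈ y′ → (x * y) ≈ (x′ * y′)
      -‿cong        : ∀ {x x′} → x ≈ x′ → (- x) ≈ (- x′)
      +-assoc       : ∀ x y z → ((x + y) + z) ≈ (x + (y + z))
      +-comm        : ∀ x y → (x + y) ≈ (y + x)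
      +-identityˡ   : ∀ x → (0# + x) ≈ x
      -‿inverseˡ    : ∀ x → ((- x) + x) ≈ 0#
      *-assoc       : ∀ x y z → ((x * y) * z) ≈ (x * (y * z))
      *-comm        : ∀ x y → (x * y) ≈ (y * x)
      *-identityˡ   : ∀ x → (1# * x) ≈ x
      distribʳ      : ∀ x y z → ((y + z) * x) ≈ ((y * x) + (z * x))

  -- Proofs are abstract so that they are never unfolded when comparing rings.

  abstract
    isCommutativeRing-fromLaws : CommutativeRingLaws → IsCommutativeRing _≈_ _+_ _*_ -_ 0# 1#
    isCommutativeRing-fromLaws laws = record
      { isRing = record
        { +-isAbelianGroup = record
          { isGroup = record
            { isMonoid = record
              { isSemigroup = record
                { isMagma = record { isEquivalence = isEquivalence ; ∙-cong = +-cong }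
                ; assoc   = +-assoc
                }
              ; identity = +-identityˡ , λ x → trans (+-comm x 0#) (+-identityˡ x)
              }
            ; inverse = -‿inverseˡ , λ x → trans (+-comm x (- x)) (-‿inverseˡ x)
            ; ⁻¹-cong = -‿cong
            }
          ; comm = +-comm
          }
        ; *-cong     = *-cong
        ; *-assoc    = *-assoc
        ; *-identity = *-identityˡ , λ x → trans (*-comm x 1#) (*-identityˡ x)
        ; distrib    = (λ x y z → trans (*-comm x (y + z)) (trans (distribʳ x y z)
                         (+-cong (*-comm y x) (*-comm z x)))) , distribʳ
        }
      ; *-comm = *-comm
      }
      where
      open CommutativeRingLaws laws
      open IsEquivalence isEquivalence using (trans)

  makeCommutativeRing : CommutativeRingLaws → CommutativeRing a ℓ
  makeCommutativeRing laws = record { isCommutativeRing = isCommutativeRing-fromLaws laws }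

-- 0 and negation are preserved automatically.

module _ (A : CommutativeRing a ℓ₁) (B : CommutativeRing b ℓ₂) where
  private
    module A = CommutativeRing A
    module B = CommutativeRing B

  module _ (f : A.Carrier → B.Carrier)
           (cong : ∀ {x y} → x A.≈ y → f x B.≈ f y)
           (+-homo : ∀ x y → f (x A.+ y) B.≈ f x B.+ f y)
           (*-homo : ∀ x y → f (x A.* y) B.≈ f x B.* f y)
           (1#-homo : f A.1# B.≈ B.1#)
           where
    open GroupProperties B.+-group using (inverseʳ-unique; identityˡ-unique)

    abstract
      isRingHomomorphism-from : IsRingHomomorphism A.rawRing B.rawRing f
      isRingHomomorphism-from = record
        { isSemiringHomomorphism = record
          { isNearSemiringHomomorphism = record
            { +-isMonoidHomomorphism = record
              { isMagmaHomomorphism = record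
                { isRelHomomorphism = record { cong = cong }
                ; homo = +-homo
                }
              ; ε-homo = 0#-homo
              }
            ; *-homo = *-homo
            }
          ; 1#-homo = 1#-homo
          }
        ; -‿homo = λ x → inverseʳ-unique (f x) (f (A.- x))
            (B.trans (B.sym (+-homo x (A.- x))) (B.trans (cong (A.-‿inverseʳ x)) 0#-homo))
        }
        where
        0#-homo : f A.0# B.≈ B.0#
        0#-homo = identityˡ-unique (f A.0#) (f A.0#)
                    (B.trans (B.sym (+-homo A.0# A.0#)) (cong (A.+-identityˡ A.0#)))

    makeHom : Hom A B
    makeHom = record { ⟦_⟧ = f ; isRingHomomorphism = isRingHomomorphism-from }

infixr 9 _∘ʰ_

_∘ʰ_ : {A : CommutativeRing a ℓ₁} {B : CommutativeRing b ℓ₂} {D : CommutativeRing c ℓ₃} →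
       Hom B D → Hom A B → Hom A D
_∘ʰ_ {A = A} {B} {D} ψ φ = makeHom A D (λ x → ψ.⟦ φ.⟦ x ⟧ ⟧)
  (λ e → ψ.⟦⟧-cong (φ.⟦⟧-cong e))
  (λ x y → D.trans (ψ.⟦⟧-cong (φ.+-homo x y)) (ψ.+-homo φ.⟦ x ⟧ φ.⟦ y ⟧))
  (λ x y → D.trans (ψ.⟦⟧-cong (φ.*-homo x y)) (ψ.*-homo φ.⟦ x ⟧ φ.⟦ y ⟧))
  (D.trans (ψ.⟦⟧-cong φ.1#-homo) ψ.1#-homo)
  where
  module D = CommutativeRing D
  module φ = Hom φ
  module ψ = Hom ψ

module Polynomials {a ℓ} (R : CommutativeRing a ℓ) where
  open CommutativeRing R
  open RingLemmas R
  private
    module R = CommutativeRing R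

  -- a₀ ∷ a₁ ∷ … represents a₀ + a₁ x + …; trailing zeros are allowed.

  Poly : Set a
  Poly = List R.Carrier

  coeff : Poly → ℕ → R.Carrier
  coeff []      n       = 0#
  coeff (x ∷ p) zero    = x
  coeff (x ∷ p) (suc n) = coeff p n

  infix 4 _≈ₚ_

  record _≈ₚ_ (p q : Poly) : Set ℓ where
    constructor coeffs
    field coeff-≈ : ∀ n → coeff p n ≈ coeff q n
  open _≈ₚ_ public

  infixl 6 _+ₚ_ _-ₚ_
  infixl 7 _*ₚ_ _•_

  _+ₚ_ : Poly → Poly → Poly
  []      +ₚ q       = q
  (x ∷ p) +ₚ []      = x ∷ p
  (x ∷ p) +ₚ (y ∷ q) = (x + y) ∷ (p +ₚ q)

  -ₚ_ : Poly → Poly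
  -ₚ p = map -_ p

  _-ₚ_ : Poly → Poly → Poly
  p -ₚ q = p +ₚ (-ₚ q)

  _•_ : R.Carrier → Poly → Poly
  x • p = map (x *_) p

  _*ₚ_ : Poly → Poly → Poly
  []      *ₚ q = []
  (x ∷ p) *ₚ q = x • q +ₚ (0# ∷ p *ₚ q)

  const : R.Carrier → Poly
  const x = x ∷ []

  X : Poly
  X = 0# ∷ 1# ∷ []

  -- (x + X p)′ = p + X p′

  derivative : Poly → Poly
  derivative []      = []
  derivative (x ∷ p) = p +ₚ (0# ∷ derivative p)

  HasDegree : Poly → ℕ → Set ℓ
  HasDegree p d = ¬ coeff p d ≈ 0# × (∀ n → d ℕ.< n → coeff p n ≈ 0#)

  ≈ₚ-isEquivalence : IsEquivalence _≈ₚ_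
  ≈ₚ-isEquivalence = record
    { refl  = coeffs λ n → refl
    ; sym   = λ e → coeffs λ n → sym (coeff-≈ e n)
    ; trans = λ d e → coeffs λ n → trans (coeff-≈ d n) (coeff-≈ e n)
    }

  module ≈ₚ = IsEquivalence ≈ₚ-isEquivalence

  ≈ₚ-setoid : Setoid a ℓ
  ≈ₚ-setoid = record { isEquivalence = ≈ₚ-isEquivalence }

  coeff-+ : ∀ p q n → coeff (p +ₚ q) n ≈ coeff p n + coeff q n
  coeff-+ []      q       n       = sym (+-identityˡ _)
  coeff-+ (x ∷ p) []      n       = sym (+-identityʳ _)
  coeff-+ (x ∷ p) (y ∷ q) zero    = refl
  coeff-+ (x ∷ p) (y ∷ q) (suc n) = coeff-+ p q n

  coeff-• : ∀ x p n → coeff (x • p) n ≈ x * coeff p n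
  coeff-• x []      n       = sym (zeroʳ x)
  coeff-• x (y ∷ p) zero    = refl
  coeff-• x (y ∷ p) (suc n) = coeff-• x p n

  coeff-neg : ∀ p n → coeff (-ₚ p) n ≈ - coeff p n
  coeff-neg []      n       = sym ε⁻¹≈ε
  coeff-neg (x ∷ p) zero    = refl
  coeff-neg (x ∷ p) (suc n) = coeff-neg p n

  ∷-cong : ∀ {x y p q} → x ≈ y → p ≈ₚ q → (x ∷ p) ≈ₚ (y ∷ q)
  ∷-cong d e = coeffs λ { zero → d ; (suc n) → coeff-≈ e n }

  +ₚ-cong : ∀ {p p′ q q′} → p ≈ₚ p′ → q ≈ₚ q′ → (p +ₚ q) ≈ₚ (p′ +ₚ q′)
  +ₚ-cong {p} {p′} {q} {q′} d e = coeffs λ n →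
    trans (coeff-+ p q n) (trans (+-cong (coeff-≈ d n) (coeff-≈ e n)) (sym (coeff-+ p′ q′ n)))

  +ₚ-comm : ∀ p q → (p +ₚ q) ≈ₚ (q +ₚ p)
  +ₚ-comm p q = coeffs λ n → trans (coeff-+ p q n) (trans (+-comm _ _) (sym (coeff-+ q p n)))

  +ₚ-assoc : ∀ p q r → ((p +ₚ q) +ₚ r) ≈ₚ (p +ₚ (q +ₚ r))
  +ₚ-assoc p q r = coeffs λ n → begin
    coeff ((p +ₚ q) +ₚ r) n              ≈⟨ coeff-+ (p +ₚ q) r n ⟩
    coeff (p +ₚ q) n + coeff r n         ≈⟨ +-congʳ (coeff-+ p q n) ⟩
    coeff p n + coeff q n + coeff r n    ≈⟨ +-assoc _ _ _ ⟩
    coeff p n + (coeff q n + coeff r n)  ≈⟨ +-congˡ (coeff-+ q r n) ⟨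
    coeff p n + coeff (q +ₚ r) n         ≈⟨ coeff-+ p (q +ₚ r) n ⟨
    coeff (p +ₚ (q +ₚ r)) n              ∎
    where
    open SetoidReasoning setoid

  +ₚ-interchange : ∀ p q r s → ((p +ₚ q) +ₚ (r +ₚ s)) ≈ₚ ((p +ₚ r) +ₚ (q +ₚ s))
  +ₚ-interchange p q r s =
    ≈ₚ.trans (+ₚ-assoc p q (r +ₚ s)) (≈ₚ.trans (+ₚ-cong (≈ₚ.refl {p}) (begin
      q +ₚ (r +ₚ s)  ≈⟨ +ₚ-assoc q r s ⟨
      (q +ₚ r) +ₚ s  ≈⟨ +ₚ-cong (+ₚ-comm q r) (≈ₚ.refl {s}) ⟩
      (r +ₚ q) +ₚ s  ≈⟨ +ₚ-assoc r q s ⟩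
      r +ₚ (q +ₚ s)  ∎)) (≈ₚ.sym (+ₚ-assoc p r (q +ₚ s))))
    where
    open SetoidReasoning ≈ₚ-setoid

  •-cong : ∀ {x y p q} → x ≈ y → p ≈ₚ q → (x • p) ≈ₚ (y • q)
  •-cong {x} {y} {p} {q} d e = coeffs λ n →
    trans (coeff-• x p n) (trans (*-cong d (coeff-≈ e n)) (sym (coeff-• y q n)))

  •-distribʳ : ∀ x y p → ((x + y) • p) ≈ₚ (x • p +ₚ y • p)
  •-distribʳ x y p = coeffs λ n → begin
    coeff ((x + y) • p) n              ≈⟨ coeff-• (x + y) p n ⟩
    (x + y) * coeff p n                ≈⟨ distribʳ _ x y ⟩
    x * coeff p n + y * coeff p n      ≈⟨ +-cong (coeff-• x p n) (coeff-• y p n) ⟨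
    coeff (x • p) n + coeff (y • p) n  ≈⟨ coeff-+ (x • p) (y • p) n ⟨
    coeff (x • p +ₚ y • p) n           ∎
    where
    open SetoidReasoning setoid

  •-distribˡ : ∀ x p q → (x • (p +ₚ q)) ≈ₚ (x • p +ₚ x • q)
  •-distribˡ x p q = coeffs λ n → begin
    coeff (x • (p +ₚ q)) n             ≈⟨ coeff-• x (p +ₚ q) n ⟩
    x * coeff (p +ₚ q) n               ≈⟨ *-congˡ (coeff-+ p q n) ⟩
    x * (coeff p n + coeff q n)        ≈⟨ distribˡ x _ _ ⟩
    x * coeff p n + x * coeff q n      ≈⟨ +-cong (coeff-• x p n) (coeff-• x q n) ⟨
    coeff (x • p) n + coeff (x • q) n  ≈⟨ coeff-+ (x • p) (x • q) n ⟨
    coeff (x • p +ₚ x • q) n           ∎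
    where
    open SetoidReasoning setoid

  •-assoc : ∀ x y p → (x • (y • p)) ≈ₚ ((x * y) • p)
  •-assoc x y p = coeffs λ n → begin
    coeff (x • (y • p)) n  ≈⟨ coeff-• x (y • p) n ⟩
    x * coeff (y • p) n    ≈⟨ *-congˡ (coeff-• y p n) ⟩
    x * (y * coeff p n)    ≈⟨ *-assoc x y _ ⟨
    x * y * coeff p n      ≈⟨ coeff-• (x * y) p n ⟨
    coeff ((x * y) • p) n  ∎
    where
    open SetoidReasoning setoid

  0•p≈0 : ∀ p → (0# • p) ≈ₚ []
  0•p≈0 p = coeffs λ n → trans (coeff-• 0# p n) (zeroˡ _)

  0∷0≈0 : (0# ∷ []) ≈ₚ []
  0∷0≈0 = coeffs λ { zero → refl ; (suc n) → refl }

  +ₚ-identityʳ : ∀ p → (p +ₚ []) ≈ₚ p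
  +ₚ-identityʳ p = +ₚ-comm p []

  tail≈0 : ∀ {x p} → (x ∷ p) ≈ₚ [] → p ≈ₚ []
  tail≈0 e = coeffs λ n → coeff-≈ e (suc n)

  *ₚ-zeroˡ : ∀ p q → p ≈ₚ [] → (p *ₚ q) ≈ₚ []
  *ₚ-zeroˡ []      q e = ≈ₚ.refl
  *ₚ-zeroˡ (x ∷ p) q e = begin
    x • q +ₚ (0# ∷ p *ₚ q)  ≈⟨ +ₚ-cong (•-cong {q = q} (coeff-≈ e 0) ≈ₚ.refl)
                                       (∷-cong refl (*ₚ-zeroˡ p q (tail≈0 e))) ⟩
    0# • q +ₚ (0# ∷ [])     ≈⟨ +ₚ-cong (0•p≈0 q) 0∷0≈0 ⟩
    []                      ∎
    where
    open SetoidReasoning ≈ₚ-setoid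

  *ₚ-congʳ : ∀ p p′ q → p ≈ₚ p′ → (p *ₚ q) ≈ₚ (p′ *ₚ q)
  *ₚ-congʳ []      p′       q e = ≈ₚ.sym (*ₚ-zeroˡ p′ q (≈ₚ.sym e))
  *ₚ-congʳ (x ∷ p) []       q e = *ₚ-zeroˡ (x ∷ p) q e
  *ₚ-congʳ (x ∷ p) (y ∷ p′) q e =
    +ₚ-cong (•-cong {q = q} (coeff-≈ e 0) ≈ₚ.refl)
            (∷-cong refl (*ₚ-congʳ p p′ q (coeffs λ n → coeff-≈ e (suc n))))

  *ₚ-zeroʳ : ∀ p → (p *ₚ []) ≈ₚ []
  *ₚ-zeroʳ []      = ≈ₚ.refl
  *ₚ-zeroʳ (x ∷ p) = ≈ₚ.trans (∷-cong refl (*ₚ-zeroʳ p)) 0∷0≈0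

  *ₚ-∷ʳ : ∀ p y q → (p *ₚ (y ∷ q)) ≈ₚ (y • p +ₚ (0# ∷ p *ₚ q))
  *ₚ-∷ʳ []      y q = ≈ₚ.sym 0∷0≈0
  *ₚ-∷ʳ (x ∷ p) y q = ∷-cong (+-congʳ (*-comm x y)) (begin
    x • q +ₚ p *ₚ (y ∷ q)              ≈⟨ +ₚ-cong (≈ₚ.refl {x • q}) (*ₚ-∷ʳ p y q) ⟩
    x • q +ₚ (y • p +ₚ (0# ∷ p *ₚ q))  ≈⟨ +ₚ-assoc (x • q) (y • p) _ ⟨
    (x • q +ₚ y • p) +ₚ (0# ∷ p *ₚ q)  ≈⟨ +ₚ-cong (+ₚ-comm (x • q) (y • p)) (≈ₚ.refl {0# ∷ p *ₚ q}) ⟩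
    (y • p +ₚ x • q) +ₚ (0# ∷ p *ₚ q)  ≈⟨ +ₚ-assoc (y • p) (x • q) _ ⟩
    y • p +ₚ (x • q +ₚ (0# ∷ p *ₚ q))  ∎)
    where
    open SetoidReasoning ≈ₚ-setoid

  *ₚ-comm : ∀ p q → (p *ₚ q) ≈ₚ (q *ₚ p)
  *ₚ-comm []      q = ≈ₚ.sym (*ₚ-zeroʳ q)
  *ₚ-comm (x ∷ p) q = ≈ₚ.trans
    (+ₚ-cong (≈ₚ.refl {x • q}) (∷-cong refl (*ₚ-comm p q)))
    (≈ₚ.sym (*ₚ-∷ʳ q x p))

  *ₚ-distribʳ : ∀ r p q → ((p +ₚ q) *ₚ r) ≈ₚ (p *ₚ r +ₚ q *ₚ r)
  *ₚ-distribʳ r []      q       = ≈ₚ.refl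
  *ₚ-distribʳ r (x ∷ p) []      = ≈ₚ.sym (+ₚ-identityʳ _)
  *ₚ-distribʳ r (x ∷ p) (y ∷ q) = begin
    (x + y) • r +ₚ (0# ∷ (p +ₚ q) *ₚ r)
      ≈⟨ +ₚ-cong (•-distribʳ x y r) (∷-cong (sym (+-identityˡ 0#)) (*ₚ-distribʳ r p q)) ⟩
    (x • r +ₚ y • r) +ₚ ((0# ∷ p *ₚ r) +ₚ (0# ∷ q *ₚ r))
      ≈⟨ +ₚ-interchange (x • r) (y • r) (0# ∷ p *ₚ r) (0# ∷ q *ₚ r) ⟩
    (x • r +ₚ (0# ∷ p *ₚ r)) +ₚ (y • r +ₚ (0# ∷ q *ₚ r))
      ∎
    where
    open SetoidReasoning ≈ₚ-setoid

  •-*ₚ : ∀ x p q → ((x • p) *ₚ q) ≈ₚ (x • (p *ₚ q))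
  •-*ₚ x []      q = ≈ₚ.refl
  •-*ₚ x (y ∷ p) q = begin
    (x * y) • q +ₚ (0# ∷ (x • p) *ₚ q)      ≈⟨ +ₚ-cong (•-assoc x y q) (∷-cong (zeroʳ x) (≈ₚ.sym (•-*ₚ x p q))) ⟨
    x • (y • q) +ₚ x • (0# ∷ p *ₚ q)        ≈⟨ •-distribˡ x (y • q) (0# ∷ p *ₚ q) ⟨
    x • (y • q +ₚ (0# ∷ p *ₚ q))            ∎
    where
    open SetoidReasoning ≈ₚ-setoid

  *ₚ-assoc : ∀ p q r → ((p *ₚ q) *ₚ r) ≈ₚ (p *ₚ (q *ₚ r))
  *ₚ-assoc []      q r = ≈ₚ.refl
  *ₚ-assoc (x ∷ p) q r = begin
    (x • q +ₚ (0# ∷ p *ₚ q)) *ₚ r                  ≈⟨ *ₚ-distribʳ r (x • q) (0# ∷ p *ₚ q) ⟩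
    (x • q) *ₚ r +ₚ (0# • r +ₚ (0# ∷ p *ₚ q *ₚ r))
      ≈⟨ +ₚ-cong (•-*ₚ x q r) (+ₚ-cong (0•p≈0 r) (∷-cong refl (*ₚ-assoc p q r))) ⟩
    x • (q *ₚ r) +ₚ (0# ∷ p *ₚ (q *ₚ r))           ∎
    where
    open SetoidReasoning ≈ₚ-setoid

  abstract
    laws : CommutativeRingLaws _≈ₚ_ _+ₚ_ _*ₚ_ -ₚ_ [] (const 1#)
    laws = record
      { isEquivalence = ≈ₚ-isEquivalence
      ; +-cong        = +ₚ-cong
      ; *-cong        = λ {p} {p′} {q} {q′} d e → ≈ₚ.trans (*ₚ-congʳ p p′ q d)
                          (≈ₚ.trans (*ₚ-comm p′ q) (≈ₚ.trans (*ₚ-congʳ q q′ p′ e) (*ₚ-comm q′ p′)))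
      ; -‿cong        = λ {p} {p′} e → coeffs λ n →
                          trans (coeff-neg p n) (trans (-‿cong (coeff-≈ e n)) (sym (coeff-neg p′ n)))
      ; +-assoc       = +ₚ-assoc
      ; +-comm        = +ₚ-comm
      ; +-identityˡ   = λ p → ≈ₚ.refl
      ; -‿inverseˡ    = λ p → coeffs λ n → trans (coeff-+ (-ₚ p) p n)
                          (trans (+-congʳ (coeff-neg p n)) (-‿inverseˡ _))
      ; *-assoc       = *ₚ-assoc
      ; *-comm        = *ₚ-comm
      ; *-identityˡ   = λ p → ≈ₚ.trans (+ₚ-cong {q = 0# ∷ []} ≈ₚ.refl 0∷0≈0) (≈ₚ.trans (+ₚ-identityʳ _)
                          (coeffs λ n → trans (coeff-• 1# p n) (*-identityˡ _)))
      ; distribʳ      = *ₚ-distribʳ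
      }

  polyRing : CommutativeRing a ℓ
  polyRing = makeCommutativeRing _≈ₚ_ _+ₚ_ _*ₚ_ -ₚ_ [] (const 1#) laws

  constHom : Hom R polyRing
  constHom = makeHom R polyRing const
    (λ e → ∷-cong e ≈ₚ.refl)
    (λ x y → ≈ₚ.refl)
    (λ x y → ∷-cong (sym (+-identityʳ _)) ≈ₚ.refl)
    ≈ₚ.refl

  module _ {b ℓ₂} (S : CommutativeRing b ℓ₂) (ι : Hom R S) (t : Carrier S) where
    private
      module S = CommutativeRing S
      module ι = Hom ι
      module SL = RingLemmas S

    eval : Poly → S.Carrier
    eval []      = S.0#
    eval (x ∷ p) = ι.⟦ x ⟧ S.+ t S.* eval p

    open SetoidReasoning S.setoid

    eval-0 : ∀ p → p ≈ₚ [] → eval p S.≈ S.0#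
    eval-0 []      e = S.refl
    eval-0 (x ∷ p) e = begin
      ι.⟦ x ⟧ S.+ t S.* eval p    ≈⟨ S.+-cong (ι.⟦⟧-cong (coeff-≈ e 0)) (S.*-congˡ (eval-0 p (tail≈0 e))) ⟩
      ι.⟦ 0# ⟧ S.+ t S.* S.0#     ≈⟨ S.+-cong ι.0#-homo (S.zeroʳ t) ⟩
      S.0# S.+ S.0#               ≈⟨ S.+-identityˡ S.0# ⟩
      S.0#                        ∎

    eval-cong : ∀ p q → p ≈ₚ q → eval p S.≈ eval q
    eval-cong []      q       e = S.sym (eval-0 q (≈ₚ.sym e))
    eval-cong (x ∷ p) []      e = eval-0 (x ∷ p) e
    eval-cong (x ∷ p) (y ∷ q) e =
      S.+-cong (ι.⟦⟧-cong (coeff-≈ e 0)) (S.*-congˡ (eval-cong p q (coeffs λ n → coeff-≈ e (suc n))))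

    eval-+ : ∀ p q → eval (p +ₚ q) S.≈ eval p S.+ eval q
    eval-+ []      q       = S.sym (S.+-identityˡ _)
    eval-+ (x ∷ p) []      = S.sym (S.+-identityʳ _)
    eval-+ (x ∷ p) (y ∷ q) = begin
      ι.⟦ x + y ⟧ S.+ t S.* eval (p +ₚ q)                      ≈⟨ S.+-cong (ι.+-homo x y) (S.*-congˡ (eval-+ p q)) ⟩
      (ι.⟦ x ⟧ S.+ ι.⟦ y ⟧) S.+ t S.* (eval p S.+ eval q)
        ≈⟨ SL.solve 5 (λ x y t p q → (x SL.:+ y) SL.:+ t SL.:* (p SL.:+ q)
                        SL.:= (x SL.:+ t SL.:* p) SL.:+ (y SL.:+ t SL.:* q))
             S.refl ι.⟦ x ⟧ ι.⟦ y ⟧ t (eval p) (eval q) ⟩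
      (ι.⟦ x ⟧ S.+ t S.* eval p) S.+ (ι.⟦ y ⟧ S.+ t S.* eval q) ∎

    eval-• : ∀ x p → eval (x • p) S.≈ ι.⟦ x ⟧ S.* eval p
    eval-• x []      = S.sym (S.zeroʳ _)
    eval-• x (y ∷ p) = begin
      ι.⟦ x * y ⟧ S.+ t S.* eval (x • p)              ≈⟨ S.+-cong (ι.*-homo x y) (S.*-congˡ (eval-• x p)) ⟩
      ι.⟦ x ⟧ S.* ι.⟦ y ⟧ S.+ t S.* (ι.⟦ x ⟧ S.* eval p)
        ≈⟨ SL.solve 4 (λ x y t p → x SL.:* y SL.:+ t SL.:* (x SL.:* p) SL.:= x SL.:* (y SL.:+ t SL.:* p))
             S.refl ι.⟦ x ⟧ ι.⟦ y ⟧ t (eval p) ⟩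
      ι.⟦ x ⟧ S.* (ι.⟦ y ⟧ S.+ t S.* eval p)          ∎

    eval-* : ∀ p q → eval (p *ₚ q) S.≈ eval p S.* eval q
    eval-* []      q = S.sym (S.zeroˡ _)
    eval-* (x ∷ p) q = begin
      eval (x • q +ₚ (0# ∷ p *ₚ q))                          ≈⟨ eval-+ (x • q) (0# ∷ p *ₚ q) ⟩
      eval (x • q) S.+ (ι.⟦ 0# ⟧ S.+ t S.* eval (p *ₚ q))
        ≈⟨ S.+-cong (eval-• x q) (S.+-cong ι.0#-homo (S.*-congˡ (eval-* p q))) ⟩
      ι.⟦ x ⟧ S.* eval q S.+ (S.0# S.+ t S.* (eval p S.* eval q))
        ≈⟨ S.+-congˡ (S.+-identityˡ _) ⟩
      ι.⟦ x ⟧ S.* eval q S.+ t S.* (eval p S.* eval q)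
        ≈⟨ SL.solve 4 (λ x t p q → x SL.:* q SL.:+ t SL.:* (p SL.:* q) SL.:= (x SL.:+ t SL.:* p) SL.:* q)
             S.refl ι.⟦ x ⟧ t (eval p) (eval q) ⟩
      (ι.⟦ x ⟧ S.+ t S.* eval p) S.* eval q                  ∎

    evalHom : Hom polyRing S
    evalHom = makeHom polyRing S eval (λ {p} {q} → eval-cong p q) eval-+ eval-*
      (S.trans (S.+-cong ι.1#-homo (S.zeroʳ t)) (S.+-identityʳ _))

    eval-const : ∀ x → eval (const x) S.≈ ι.⟦ x ⟧
    eval-const x = S.trans (S.+-congˡ (S.zeroʳ t)) (S.+-identityʳ _)

    eval-X : eval X S.≈ t
    eval-X = begin
      ι.⟦ 0# ⟧ S.+ t S.* eval (const 1#)  ≈⟨ S.+-cong ι.0#-homo (S.*-congˡ (S.trans (eval-const 1#) ι.1#-homo)) ⟩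
      S.0# S.+ t S.* S.1#                 ≈⟨ S.+-identityˡ _ ⟩
      t S.* S.1#                          ≈⟨ S.*-identityʳ t ⟩
      t                                   ∎

  module _ {b c ℓ₂ ℓ₃} (S : CommutativeRing b ℓ₂) (T : CommutativeRing c ℓ₃)
           (ι : Hom R S) (κ : Hom R T) (θ : Hom S T) where
    private
      module S = CommutativeRing S
      module T = CommutativeRing T
      module ι = Hom ι
      module κ = Hom κ
      module θ = Hom θ

    eval-natural : (∀ x → θ.⟦ ι.⟦ x ⟧ ⟧ T.≈ κ.⟦ x ⟧) →
                   ∀ t p → θ.⟦ eval S ι t p ⟧ T.≈ eval T κ θ.⟦ t ⟧ p
    eval-natural θι≈κ t []      = θ.0#-homo
    eval-natural θι≈κ t (x ∷ p) =
      T.trans (θ.+-homo _ _) (T.+-cong (θι≈κ x)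
        (T.trans (θ.*-homo t _) (T.*-congˡ (eval-natural θι≈κ t p))))

  ∷-as-sum : ∀ x p → (x ∷ p) ≈ₚ const x +ₚ X *ₚ p
  ∷-as-sum x p = begin
    x ∷ p                                    ≈⟨ ∷-cong (+-identityʳ x) ≈ₚ.refl ⟨
    const x +ₚ (0# ∷ p)                      ≈⟨ +ₚ-cong {const x} ≈ₚ.refl (∷-cong refl (P.*-identityˡ p)) ⟨
    const x +ₚ (0# ∷ const 1# *ₚ p)          ≈⟨ +ₚ-cong {const x} ≈ₚ.refl (+ₚ-cong (0•p≈0 p) ≈ₚ.refl) ⟨
    const x +ₚ X *ₚ p                        ∎
    where
    module P = CommutativeRing polyRing
    open SetoidReasoning P.setoid

  module _ {b ℓ₂} (S : CommutativeRing b ℓ₂) (θ : Hom polyRing S) where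
    private
      module S = CommutativeRing S
      module θ = Hom θ

    hom-eval : ∀ p → θ.⟦ p ⟧ S.≈ eval S (θ ∘ʰ constHom) θ.⟦ X ⟧ p
    hom-eval []      = θ.0#-homo
    hom-eval (x ∷ p) = S.trans (θ.⟦⟧-cong (∷-as-sum x p))
      (S.trans (θ.+-homo (const x) _) (S.+-congˡ
        (S.trans (θ.*-homo X p) (S.*-congˡ (hom-eval p)))))

  eval-invertible : (F : Field b ℓ₂) (S : CommutativeRing c ℓ₃)
    (κ : Hom R (Field.commutativeRing F)) (ι : Hom R S) (θ : Hom (Field.commutativeRing F) S) →
    let module F = Field F
        module S = CommutativeRing S
    in
    (∀ x → Hom.⟦_⟧ θ (Hom.⟦_⟧ κ x) S.≈ Hom.⟦_⟧ ι x) → ∀ t →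
    (∀ p → eval F.commutativeRing κ t p F.≈ F.0# → p ≈ₚ []) →
    ∀ p → ¬ p ≈ₚ [] → Invertible S (eval S ι (Hom.⟦_⟧ θ t) p)
  eval-invertible F S κ ι θ θκ≈ι t t-trans p p≉0
    with Field.inverse F (eval (Field.commutativeRing F) κ t p) (λ e → p≉0 (t-trans p e))
  ... | z , p[t]z≈1 = θ.⟦ z ⟧ , S.trans
    (S.*-congʳ (S.sym (eval-natural (Field.commutativeRing F) S κ ι θ θκ≈ι t p)))
    (S.trans (S.sym (θ.*-homo _ z)) (S.trans (θ.⟦⟧-cong p[t]z≈1) θ.1#-homo))
    where
    module S = CommutativeRing S
    module θ = Hom θ

  -- With t u ≈ 1 and p = a₀ + … + aₙ xⁿ one has tⁿ p(u) ≈ a₀ tⁿ + … + aₙ; here acc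
  -- collects the coefficients already reversed.

  module _ {b ℓ₂} (S : CommutativeRing b ℓ₂) (ι : Hom R S) (t u : Carrier S)
           (tu≈1 : CommutativeRing._≈_ S (CommutativeRing._*_ S t u) (CommutativeRing.1# S)) where
    private
      module S = CommutativeRing S
      module ι = Hom ι
      module SL = RingLemmas S
      open Exp S.semiring using (_^_)
      open SetoidReasoning S.setoid

    eval-reverse : ∀ p acc →
      t ^ length p S.* (eval S ι t acc S.+ u S.* eval S ι u p) S.≈ eval S ι t (p ʳ++ acc)
    eval-reverse []      acc = begin
      S.1# S.* (eval S ι t acc S.+ u S.* S.0#)  ≈⟨ S.*-identityˡ _ ⟩
      eval S ι t acc S.+ u S.* S.0#             ≈⟨ S.+-congˡ (S.zeroʳ u) ⟩
      eval S ι t acc S.+ S.0#                   ≈⟨ S.+-identityʳ _ ⟩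
      eval S ι t acc                            ∎
    eval-reverse (x ∷ p) acc = begin
      t S.* t ^ length p S.* (eval S ι t acc S.+ u S.* (ι.⟦ x ⟧ S.+ u S.* eval S ι u p))
        ≈⟨ SL.solve 6 (λ t u tⁿ x r e → t SL.:* tⁿ SL.:* (r SL.:+ u SL.:* (x SL.:+ u SL.:* e))
             SL.:= tⁿ SL.:* (t SL.:* u SL.:* (x SL.:+ u SL.:* e) SL.:+ t SL.:* r))
             S.refl t u (t ^ length p) ι.⟦ x ⟧ (eval S ι t acc) (eval S ι u p) ⟩
      t ^ length p S.* (t S.* u S.* (ι.⟦ x ⟧ S.+ u S.* eval S ι u p) S.+ t S.* eval S ι t acc)
        ≈⟨ S.*-congˡ (S.+-congʳ (S.trans (S.*-congʳ tu≈1) (S.*-identityˡ _))) ⟩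
      t ^ length p S.* ((ι.⟦ x ⟧ S.+ u S.* eval S ι u p) S.+ t S.* eval S ι t acc)
        ≈⟨ S.*-congˡ (SL.solve 3 (λ x e r → (x SL.:+ e) SL.:+ r SL.:= (x SL.:+ r) SL.:+ e)
             S.refl ι.⟦ x ⟧ (u S.* eval S ι u p) (t S.* eval S ι t acc)) ⟩
      t ^ length p S.* (eval S ι t (x ∷ acc) S.+ u S.* eval S ι u p)
        ≈⟨ eval-reverse p (x ∷ acc) ⟩
      eval S ι t (p ʳ++ (x ∷ acc)) ∎

  ʳ++≈0 : ∀ p acc → (p ʳ++ acc) ≈ₚ [] → p ≈ₚ [] × acc ≈ₚ []
  ʳ++≈0 []      acc e = ≈ₚ.refl , e
  ʳ++≈0 (x ∷ p) acc e with ʳ++≈0 p (x ∷ acc) e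
  ... | p≈0 , x∷acc≈0 =
    coeffs (λ { zero → coeff-≈ x∷acc≈0 0 ; (suc n) → coeff-≈ p≈0 n }) , tail≈0 x∷acc≈0

  transcendental-inverse : (S : CommutativeRing b ℓ₂) (ι : Hom R S) →
    let module S = CommutativeRing S in
    ∀ t u → t S.* u S.≈ S.1# →
    (∀ p → eval S ι t p S.≈ S.0# → p ≈ₚ []) → (∀ p → eval S ι u p S.≈ S.0# → p ≈ₚ [])
  transcendental-inverse S ι t u tu≈1 t-trans p p[u]≈0 =
    proj₁ (ʳ++≈0 p [] (t-trans (p ʳ++ []) (begin
      eval S ι t (p ʳ++ [])                                      ≈⟨ eval-reverse S ι t u tu≈1 p [] ⟨
      t ^ length p S.* (S.0# S.+ u S.* eval S ι u p)  ≈⟨ S.*-congˡ (S.+-identityˡ _) ⟩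
      t ^ length p S.* (u S.* eval S ι u p)           ≈⟨ S.*-congˡ (S.*-congˡ p[u]≈0) ⟩
      t ^ length p S.* (u S.* S.0#)                   ≈⟨ S.*-congˡ (S.zeroʳ u) ⟩
      t ^ length p S.* S.0#                           ≈⟨ S.zeroʳ _ ⟩
      S.0#                                            ∎)))
    where
    module S = CommutativeRing S
    open Exp S.semiring using (_^_)
    open SetoidReasoning S.setoid

module _ (k : Field a ℓ) where
  private
    module k = Field k
  open Polynomials k.commutativeRing
  open RingLemmas k.commutativeRing

  zero? : ∀ p → Dec (p ≈ₚ [])
  zero? [] = yes ≈ₚ.refl
  zero? (x ∷ p) with x k.≟ k.0# | zero? p
  ... | yes x≈0 | yes p≈0 = yes (≈ₚ.trans (∷-cong x≈0 p≈0) 0∷0≈0)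
  ... | no  x≉0 | _       = no λ e → x≉0 (coeff-≈ e 0)
  ... | yes _   | no  p≉0 = no λ e → p≉0 (tail≈0 e)

  noZeroDivisors-field : ∀ x y → x k.* y k.≈ k.0# → x k.≈ k.0# ⊎ y k.≈ k.0#
  noZeroDivisors-field x y xy≈0 with x k.≟ k.0#
  ... | yes x≈0 = inj₁ x≈0
  ... | no  x≉0 with k.inverse x x≉0
  ...   | z , xz≈1 = inj₂ (begin
    y                ≈⟨ k.*-identityˡ y ⟨
    k.1# k.* y       ≈⟨ k.*-congʳ xz≈1 ⟨
    x k.* z k.* y    ≈⟨ solve 3 (λ x y z → x :* z :* y := z :* (x :* y)) k.refl x y z ⟩
    z k.* (x k.* y)  ≈⟨ k.*-congˡ xy≈0 ⟩
    z k.* k.0#       ≈⟨ k.zeroʳ z ⟩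
    k.0#             ∎)
    where
    open SetoidReasoning k.setoid

  private
    module P = CommutativeRing polyRing

    *ₚ-leading : ∀ {x p y q} → ¬ x k.≈ k.0# → (x ∷ p) *ₚ (y ∷ q) ≈ₚ [] → y k.≈ k.0#
    *ₚ-leading {x} {p} {y} x≉0 e with noZeroDivisors-field x y
      (k.trans (k.sym (k.+-identityʳ _)) (coeff-≈ e 0))
    ... | inj₁ x≈0 = ⊥-elim (x≉0 x≈0)
    ... | inj₂ y≈0 = y≈0

    shift : ∀ {x} p q → x k.≈ k.0# → (x ∷ p) *ₚ q ≈ₚ (k.0# ∷ p *ₚ q)
    shift p q x≈0 = +ₚ-cong (≈ₚ.trans (•-cong {q = q} x≈0 ≈ₚ.refl) (0•p≈0 q)) (≈ₚ.refl {k.0# ∷ p *ₚ q})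

  leading≉0⇒≈0 : ∀ {x p} → ¬ x k.≈ k.0# → ∀ q → (x ∷ p) *ₚ q ≈ₚ [] → q ≈ₚ []
  leading≉0⇒≈0         x≉0 []      e = ≈ₚ.refl
  leading≉0⇒≈0 {x} {p} x≉0 (y ∷ q) e = ≈ₚ.trans (∷-cong y≈0 (leading≉0⇒≈0 {p = p} x≉0 q
      (tail≈0 (begin
        k.0# ∷ (x ∷ p) *ₚ q  ≈⟨ ∷-cong k.refl (P.*-comm (x ∷ p) q) ⟩
        k.0# ∷ q *ₚ (x ∷ p)  ≈⟨ shift q (x ∷ p) y≈0 ⟨
        (y ∷ q) *ₚ (x ∷ p)   ≈⟨ P.*-comm (y ∷ q) (x ∷ p) ⟩
        (x ∷ p) *ₚ (y ∷ q)   ≈⟨ e ⟩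
        []                   ∎)))) 0∷0≈0
    where
    open SetoidReasoning P.setoid
    y≈0 = *ₚ-leading {p = p} {q = q} x≉0 e

  noZeroDivisors-poly : ∀ p q → p *ₚ q ≈ₚ [] → p ≈ₚ [] ⊎ q ≈ₚ []
  noZeroDivisors-poly []      q e = inj₁ ≈ₚ.refl
  noZeroDivisors-poly (x ∷ p) q e with x k.≟ k.0#
  ... | no  x≉0 = inj₂ (leading≉0⇒≈0 {p = p} x≉0 q e)
  ... | yes x≈0 with noZeroDivisors-poly p q (tail≈0 (≈ₚ.trans (≈ₚ.sym (shift p q x≈0)) e))
  ...   | inj₁ p≈0 = inj₁ (≈ₚ.trans (∷-cong x≈0 p≈0) 0∷0≈0)
  ...   | inj₂ q≈0 = inj₂ q≈0

record IntegralDomain a ℓ : Set (Level.suc (a ⊔ ℓ)) where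
  field
    commutativeRing : CommutativeRing a ℓ
  open CommutativeRing commutativeRing public
  field
    _≟_            : Decidable _≈_
    1≉0            : ¬ 1# ≈ 0#
    noZeroDivisors : ∀ x y → x * y ≈ 0# → x ≈ 0# ⊎ y ≈ 0#

polyDomain : Field a ℓ → IntegralDomain a ℓ
polyDomain k = record
  { commutativeRing = polyRing
  ; _≟_             = λ p q → map′ (x-y≈0⇒x≈y p q)
                        (λ e → P.trans (P.+-congʳ e) (P.-‿inverseʳ q)) (zero? k (p P.- q))
  ; 1≉0             = λ e → Field.1≉0 k (coeff-≈ e 0)
  ; noZeroDivisors  = noZeroDivisors-poly k
  }
  where
  open Polynomials (Field.commutativeRing k)
  module P = CommutativeRing polyRing
  open RingLemmas polyRing

module Fractions {a ℓ} (D : IntegralDomain a ℓ) where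
  open IntegralDomain D
  open RingLemmas commutativeRing
  open SetoidReasoning setoid
  private
    module D = IntegralDomain D

  record Fraction : Set (a ⊔ ℓ) where
    constructor fraction
    field
      num   : D.Carrier
      den   : D.Carrier
      .den≉0 : ¬ den ≈ 0#
  open Fraction public using (num; den)

  den≉0 : ∀ z → ¬ den z ≈ 0#
  den≉0 (fraction _ _ d≉0) d≈0 = ⊥-elim-irr (d≉0 d≈0)

  infix 4 _≈ᶠ_

  record _≈ᶠ_ (z w : Fraction) : Set ℓ where
    constructor cross
    field cross-≈ : num z * den w ≈ num w * den z
  open _≈ᶠ_ public

  *-≉0 : ∀ {x y} → ¬ x ≈ 0# → ¬ y ≈ 0# → ¬ x * y ≈ 0#
  *-≉0 {x} {y} x≉0 y≉0 e with noZeroDivisors x y e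
  ... | inj₁ x≈0 = x≉0 x≈0
  ... | inj₂ y≈0 = y≉0 y≈0

  *-cancelˡ-≉0 : ∀ {d} → ¬ d ≈ 0# → ∀ x y → d * x ≈ d * y → x ≈ y
  *-cancelˡ-≉0 {d} d≉0 x y e with noZeroDivisors d (x + - y) (begin
    d * (x + - y)      ≈⟨ distribˡ d x (- y) ⟩
    d * x + d * - y    ≈⟨ +-cong e (sym (-‿distribʳ-* d y)) ⟩
    d * y + - (d * y)  ≈⟨ -‿inverseʳ _ ⟩
    0#                 ∎)
  ... | inj₁ d≈0   = ⊥-elim (d≉0 d≈0)
  ... | inj₂ x-y≈0 = x-y≈0⇒x≈y x y x-y≈0

  _+ᶠ_ _*ᶠ_ : Fraction → Fraction → Fraction
  z +ᶠ w = fraction (num z * den w + num w * den z) (den z * den w) (*-≉0 (den≉0 z) (den≉0 w))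
  z *ᶠ w = fraction (num z * num w) (den z * den w) (*-≉0 (den≉0 z) (den≉0 w))

  -ᶠ_ : Fraction → Fraction
  -ᶠ z = fraction (- num z) (den z) (den≉0 z)

  embed : D.Carrier → Fraction
  embed x = fraction x 1# 1≉0

  ≈ᶠ-trans : ∀ {z w v} → z ≈ᶠ w → w ≈ᶠ v → z ≈ᶠ v
  ≈ᶠ-trans {fraction a b _} {w@(fraction c d _)} {fraction e f _} (cross ad≈cb) (cross cf≈ed) =
    cross (*-cancelˡ-≉0 (den≉0 w) (a * f) (e * b) (begin
      d * (a * f)  ≈⟨ solve 3 (λ d a f → d :* (a :* f) := (a :* d) :* f) refl d a f ⟩
      (a * d) * f  ≈⟨ *-congʳ ad≈cb ⟩
      (c * b) * f  ≈⟨ solve 3 (λ c b f → (c :* b) :* f := (c :* f) :* b) refl c b f ⟩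
      (c * f) * b  ≈⟨ *-congʳ cf≈ed ⟩
      (e * d) * b  ≈⟨ solve 3 (λ e d b → (e :* d) :* b := d :* (e :* b)) refl e d b ⟩
      d * (e * b)  ∎))

  abstract
    laws : CommutativeRingLaws _≈ᶠ_ _+ᶠ_ _*ᶠ_ -ᶠ_ (embed 0#) (embed 1#)
    laws = record
      { isEquivalence = record
        { refl = cross refl ; sym = λ e → cross (sym (cross-≈ e)) ; trans = ≈ᶠ-trans }
      ; +-cong = λ { {fraction a b _} {fraction a′ b′ _} {fraction c d _} {fraction c′ d′ _} (cross e) (cross e′) → cross (begin
          (a * d + c * b) * (b′ * d′)
            ≈⟨ solve 6 (λ a b c d b′ d′ → (a :* d :+ c :* b) :* (b′ :* d′) := (a :* b′) :* (d :* d′) :+ (c :* d′) :* (b :* b′))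
                 refl a b c d b′ d′ ⟩
          (a * b′) * (d * d′) + (c * d′) * (b * b′)
            ≈⟨ +-cong (*-congʳ e) (*-congʳ e′) ⟩
          (a′ * b) * (d * d′) + (c′ * d) * (b * b′)
            ≈⟨ solve 6 (λ a b c d b′ d′ → (a :* b) :* (d :* d′) :+ (c :* d) :* (b :* b′) := (a :* d′ :+ c :* b′) :* (b :* d))
                 refl a′ b c′ d b′ d′ ⟩
          (a′ * d′ + c′ * b′) * (b * d) ∎) }
      ; *-cong = λ { {fraction a b _} {fraction a′ b′ _} {fraction c d _} {fraction c′ d′ _} (cross e) (cross e′) → cross (begin
          (a * c) * (b′ * d′)  ≈⟨ solve 4 (λ a c b d → (a :* c) :* (b :* d) := (a :* b) :* (c :* d)) refl a c b′ d′ ⟩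
          (a * b′) * (c * d′)  ≈⟨ *-cong e e′ ⟩
          (a′ * b) * (c′ * d)  ≈⟨ solve 4 (λ a c b d → (a :* b) :* (c :* d) := (a :* c) :* (b :* d)) refl a′ c′ b d ⟩
          (a′ * c′) * (b * d)  ∎) }
      ; -‿cong = λ { {fraction a b _} {fraction a′ b′ _} (cross e) → cross (begin
          - a * b′    ≈⟨ -‿distribˡ-* a b′ ⟨
          - (a * b′)  ≈⟨ -‿cong e ⟩
          - (a′ * b)  ≈⟨ -‿distribˡ-* a′ b ⟩
          - a′ * b    ∎) }
      ; +-assoc = λ { (fraction a b _) (fraction c d _) (fraction e f _) → cross
          (solve 6 (λ a b c d e f →
             ((a :* d :+ c :* b) :* f :+ e :* (b :* d)) :* (b :* (d :* f)) :=
             (a :* (d :* f) :+ (c :* f :+ e :* d) :* b) :* ((b :* d) :* f)) refl a b c d e f) }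
      ; +-comm = λ { (fraction a b _) (fraction c d _) → cross
          (solve 4 (λ a b c d → (a :* d :+ c :* b) :* (d :* b) := (c :* b :+ a :* d) :* (b :* d)) refl a b c d) }
      ; +-identityˡ = λ { (fraction a b _) → cross
          (solve 2 (λ a b → (con 0 :* b :+ a :* con 1) :* b := a :* (con 1 :* b)) refl a b) }
      ; -‿inverseˡ = λ { (fraction a b _) → cross (begin
          (- a * b + a * b) * 1#  ≈⟨ *-identityʳ _ ⟩
          - a * b + a * b         ≈⟨ distribʳ b (- a) a ⟨
          (- a + a) * b           ≈⟨ *-congʳ (-‿inverseˡ a) ⟩
          0# * b                  ≈⟨ zeroˡ b ⟩
          0#                      ≈⟨ zeroˡ (b * b) ⟨
          0# * (b * b)            ∎) }
      ; *-assoc = λ { (fraction a b _) (fraction c d _) (fraction e f _) → cross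
          (solve 6 (λ a b c d e f → ((a :* c) :* e) :* (b :* (d :* f)) := (a :* (c :* e)) :* ((b :* d) :* f))
             refl a b c d e f) }
      ; *-comm = λ { (fraction a b _) (fraction c d _) → cross
          (solve 4 (λ a b c d → (a :* c) :* (d :* b) := (c :* a) :* (b :* d)) refl a b c d) }
      ; *-identityˡ = λ { (fraction a b _) → cross
          (solve 2 (λ a b → (con 1 :* a) :* b := a :* (con 1 :* b)) refl a b) }
      ; distribʳ = λ { (fraction a b _) (fraction c d _) (fraction e f _) → cross
          (solve 6 (λ a b c d e f →
             ((c :* f :+ e :* d) :* a) :* ((d :* b) :* (f :* b)) :=
             ((c :* a) :* (f :* b) :+ (e :* a) :* (d :* b)) :* ((d :* f) :* b)) refl a b c d e f) }
      }

  fractionRing : CommutativeRing (a ⊔ ℓ) ℓ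
  fractionRing = makeCommutativeRing _≈ᶠ_ _+ᶠ_ _*ᶠ_ -ᶠ_ (embed 0#) (embed 1#) laws

  num≈0⇒≈0 : ∀ z → num z ≈ 0# → z ≈ᶠ embed 0#
  num≈0⇒≈0 z e = cross (trans (*-identityʳ _) (trans e (sym (zeroˡ _))))

  ≈0⇒num≈0 : ∀ z → z ≈ᶠ embed 0# → num z ≈ 0#
  ≈0⇒num≈0 z e = trans (sym (*-identityʳ _)) (trans (cross-≈ e) (zeroˡ _))

  fractionField : Field (a ⊔ ℓ) ℓ
  fractionField = record
    { commutativeRing = fractionRing
    ; _≟_             = λ z w → map′ cross cross-≈ ((num z * den w) ≟ (num w * den z))
    ; 1≉0             = λ e → 1≉0 (≈0⇒num≈0 (embed 1#) e)
    ; inverse         = λ { z@(fraction a b b≉0) z≉0 →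
        fraction b a (λ a≈0 → z≉0 (num≈0⇒≈0 z a≈0)) ,
        cross (solve 2 (λ a b → (a :* b) :* con 1 := con 1 :* (b :* a)) refl a b) }
    }

  embedHom : Hom commutativeRing fractionRing
  embedHom = makeHom commutativeRing fractionRing embed
    (λ e → cross (*-congʳ e))
    (λ x y → cross (solve 2 (λ x y → (x :+ y) :* (con 1 :* con 1) := (x :* con 1 :+ y :* con 1) :* con 1) refl x y))
    (λ x y → cross (solve 2 (λ x y → (x :* y) :* (con 1 :* con 1) := (x :* y) :* con 1) refl x y))
    (cross refl)

  embed-injective : ∀ x → embed x ≈ᶠ embed 0# → x ≈ 0#
  embed-injective x = ≈0⇒num≈0 (embed x)

-- The universal property: a homomorphism inverting all nonzero elements
-- extends to fractions by n / d ↦ φ(n) φ(d)⁻¹.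

module Extend {a b ℓ ℓ₂} (D : IntegralDomain a ℓ) (S : CommutativeRing b ℓ₂)
              (φ : Hom (IntegralDomain.commutativeRing D) S)
              (inv : ∀ d → ¬ IntegralDomain._≈_ D d (IntegralDomain.0# D) → Invertible S (Hom.⟦_⟧ φ d)) where
  open Fractions D
  open RingLemmas S
  private
    module S = CommutativeRing S
    module φ = Hom φ
  open SetoidReasoning S.setoid

  extend : Fraction → S.Carrier
  extend z = φ.⟦ num z ⟧ S.* proj₁ (inv (den z) (den≉0 z))

  extend-char : ∀ z → extend z S.* φ.⟦ den z ⟧ S.≈ φ.⟦ num z ⟧
  extend-char z@(fraction n d _) with inv d (den≉0 z)
  ... | u , du≈1 = begin
    φ.⟦ n ⟧ S.* u S.* φ.⟦ d ⟧    ≈⟨ S.*-assoc _ _ _ ⟩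
    φ.⟦ n ⟧ S.* (u S.* φ.⟦ d ⟧)  ≈⟨ S.*-congˡ (S.trans (S.*-comm u _) du≈1) ⟩
    φ.⟦ n ⟧ S.* S.1#             ≈⟨ S.*-identityʳ _ ⟩
    φ.⟦ n ⟧                      ∎

  extend-unique : ∀ z s → s S.* φ.⟦ den z ⟧ S.≈ φ.⟦ num z ⟧ → s S.≈ extend z
  extend-unique z@(fraction n d _) s e with inv d (den≉0 z)
  ... | u , du≈1 = begin
    s                      ≈⟨ S.*-identityʳ s ⟨
    s S.* S.1#             ≈⟨ S.*-congˡ du≈1 ⟨
    s S.* (φ.⟦ d ⟧ S.* u)  ≈⟨ S.*-assoc _ _ _ ⟨
    s S.* φ.⟦ d ⟧ S.* u    ≈⟨ S.*-congʳ e ⟩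
    φ.⟦ n ⟧ S.* u          ∎

  den-cancel : ∀ z {s t} → s S.* φ.⟦ den z ⟧ S.≈ t S.* φ.⟦ den z ⟧ → s S.≈ t
  den-cancel z@(fraction n d _) {s} {t} e with inv d (den≉0 z)
  ... | u , du≈1 = begin
    s                      ≈⟨ S.*-identityʳ s ⟨
    s S.* S.1#             ≈⟨ S.*-congˡ du≈1 ⟨
    s S.* (φ.⟦ d ⟧ S.* u)  ≈⟨ S.*-assoc _ _ _ ⟨
    s S.* φ.⟦ d ⟧ S.* u    ≈⟨ S.*-congʳ e ⟩
    t S.* φ.⟦ d ⟧ S.* u    ≈⟨ S.*-assoc _ _ _ ⟩
    t S.* (φ.⟦ d ⟧ S.* u)  ≈⟨ S.*-congˡ du≈1 ⟩
    t S.* S.1#             ≈⟨ S.*-identityʳ t ⟩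
    t                      ∎

  extendHom : Hom fractionRing S
  extendHom = makeHom fractionRing S extend
    (λ {z} {w} e → extend-unique w (extend z) (den-cancel z (begin
      extend z S.* φ.⟦ den w ⟧ S.* φ.⟦ den z ⟧
        ≈⟨ solve 3 (λ z d e → z :* d :* e := (z :* e) :* d) S.refl (extend z) φ.⟦ den w ⟧ φ.⟦ den z ⟧ ⟩
      extend z S.* φ.⟦ den z ⟧ S.* φ.⟦ den w ⟧  ≈⟨ S.*-congʳ (extend-char z) ⟩
      φ.⟦ num z ⟧ S.* φ.⟦ den w ⟧               ≈⟨ φ.*-homo _ _ ⟨
      φ.⟦ num z D.* den w ⟧                     ≈⟨ φ.⟦⟧-cong (cross-≈ e) ⟩
      φ.⟦ num w D.* den z ⟧                     ≈⟨ φ.*-homo _ _ ⟩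
      φ.⟦ num w ⟧ S.* φ.⟦ den z ⟧               ∎)))
    (λ z w → S.sym (extend-unique (z +ᶠ w) (extend z S.+ extend w) (begin
      (extend z S.+ extend w) S.* φ.⟦ den z D.* den w ⟧
        ≈⟨ S.*-congˡ (φ.*-homo _ _) ⟩
      (extend z S.+ extend w) S.* (φ.⟦ den z ⟧ S.* φ.⟦ den w ⟧)
        ≈⟨ solve 4 (λ z w d e → (z :+ w) :* (d :* e) := (z :* d) :* e :+ (w :* e) :* d)
             S.refl (extend z) (extend w) φ.⟦ den z ⟧ φ.⟦ den w ⟧ ⟩
      extend z S.* φ.⟦ den z ⟧ S.* φ.⟦ den w ⟧ S.+ extend w S.* φ.⟦ den w ⟧ S.* φ.⟦ den z ⟧
        ≈⟨ S.+-cong (S.*-congʳ (extend-char z)) (S.*-congʳ (extend-char w)) ⟩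
      φ.⟦ num z ⟧ S.* φ.⟦ den w ⟧ S.+ φ.⟦ num w ⟧ S.* φ.⟦ den z ⟧
        ≈⟨ S.+-cong (φ.*-homo _ _) (φ.*-homo _ _) ⟨
      φ.⟦ num z D.* den w ⟧ S.+ φ.⟦ num w D.* den z ⟧
        ≈⟨ φ.+-homo _ _ ⟨
      φ.⟦ num z D.* den w D.+ num w D.* den z ⟧ ∎)))
    (λ z w → S.sym (extend-unique (z *ᶠ w) (extend z S.* extend w) (begin
      extend z S.* extend w S.* φ.⟦ den z D.* den w ⟧
        ≈⟨ S.*-congˡ (φ.*-homo _ _) ⟩
      extend z S.* extend w S.* (φ.⟦ den z ⟧ S.* φ.⟦ den w ⟧)
        ≈⟨ solve 4 (λ z w d e → (z :* w) :* (d :* e) := (z :* d) :* (w :* e))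
             S.refl (extend z) (extend w) φ.⟦ den z ⟧ φ.⟦ den w ⟧ ⟩
      extend z S.* φ.⟦ den z ⟧ S.* (extend w S.* φ.⟦ den w ⟧)
        ≈⟨ S.*-cong (extend-char z) (extend-char w) ⟩
      φ.⟦ num z ⟧ S.* φ.⟦ num w ⟧
        ≈⟨ φ.*-homo _ _ ⟨
      φ.⟦ num z D.* num w ⟧ ∎)))
    (S.sym (extend-unique (embed D.1#) S.1# (S.*-identityˡ _)))
    where
    module D = IntegralDomain D

  extend-embed : ∀ x → extend (embed x) S.≈ φ.⟦ x ⟧
  extend-embed x = S.sym (extend-unique (embed x) φ.⟦ x ⟧
    (S.trans (S.*-congˡ φ.1#-homo) (S.*-identityʳ _)))

module Quadratic {a ℓ} (R : CommutativeRing a ℓ) (f : Carrier R) where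
  open CommutativeRing R hiding (Carrier)
  open RingLemmas R
  private
    module R = CommutativeRing R

  -- (u , v) represents u + v y in R[y] / (y² - f).

  Quad : Set a
  Quad = R.Carrier × R.Carrier

  infix 4 _≈₂_

  record _≈₂_ (z w : Quad) : Set ℓ where
    constructor _,_
    field
      re-≈ : proj₁ z ≈ proj₁ w
      im-≈ : proj₂ z ≈ proj₂ w
  open _≈₂_ public

  _+₂_ _*₂_ : Quad → Quad → Quad
  (u , v) +₂ (u′ , v′) = u + u′ , v + v′
  (u , v) *₂ (u′ , v′) = u * u′ + f * (v * v′) , u * v′ + v * u′

  -₂_ : Quad → Quad
  -₂ (u , v) = - u , - v

  base : R.Carrier → Quad
  base u = u , 0#

  abstract
    laws : CommutativeRingLaws _≈₂_ _+₂_ _*₂_ -₂_ (base 0#) (base 1#)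
    laws = record
      { isEquivalence = record
        { refl  = refl , refl
        ; sym   = λ (d , e) → sym d , sym e
        ; trans = λ (d , e) (d′ , e′) → trans d d′ , trans e e′
        }
      ; +-cong = λ (d , e) (d′ , e′) → +-cong d d′ , +-cong e e′
      ; *-cong = λ (d , e) (d′ , e′) →
          +-cong (*-cong d d′) (*-congˡ (*-cong e e′)) , +-cong (*-cong d e′) (*-cong e d′)
      ; -‿cong = λ (d , e) → -‿cong d , -‿cong e
      ; +-assoc = λ _ _ _ → +-assoc _ _ _ , +-assoc _ _ _
      ; +-comm = λ _ _ → +-comm _ _ , +-comm _ _
      ; +-identityˡ = λ _ → +-identityˡ _ , +-identityˡ _
      ; -‿inverseˡ = λ _ → -‿inverseˡ _ , -‿inverseˡ _
      ; *-assoc = λ (a , b) (c , d) (u , v) →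
          solve 7 (λ a b c d u v f →
            (a :* c :+ f :* (b :* d)) :* u :+ f :* ((a :* d :+ b :* c) :* v) :=
            a :* (c :* u :+ f :* (d :* v)) :+ f :* (b :* (c :* v :+ d :* u))) refl a b c d u v f ,
          solve 7 (λ a b c d u v f →
            (a :* c :+ f :* (b :* d)) :* v :+ (a :* d :+ b :* c) :* u :=
            a :* (c :* v :+ d :* u) :+ b :* (c :* u :+ f :* (d :* v))) refl a b c d u v f
      ; *-comm = λ (a , b) (c , d) →
          solve 5 (λ a b c d f → a :* c :+ f :* (b :* d) := c :* a :+ f :* (d :* b)) refl a b c d f ,
          solve 4 (λ a b c d → a :* d :+ b :* c := c :* b :+ d :* a) refl a b c d
      ; *-identityˡ = λ (a , b) →
          solve 3 (λ a b f → con 1 :* a :+ f :* (con 0 :* b) := a) refl a b f ,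
          solve 2 (λ a b → con 1 :* b :+ con 0 :* a := b) refl a b
      ; distribʳ = λ (a , b) (c , d) (u , v) →
          solve 7 (λ a b c d u v f →
            (c :+ u) :* a :+ f :* ((d :+ v) :* b) :=
            (c :* a :+ f :* (d :* b)) :+ (u :* a :+ f :* (v :* b))) refl a b c d u v f ,
          solve 6 (λ a b c d u v →
            (c :+ u) :* b :+ (d :+ v) :* a := (c :* b :+ d :* a) :+ (u :* b :+ v :* a)) refl a b c d u v
      }

  ring₂ : CommutativeRing a ℓ
  ring₂ = makeCommutativeRing _≈₂_ _+₂_ _*₂_ -₂_ (base 0#) (base 1#) laws

  -- Opaque, so that comparing two elements does not compute with polynomials.

  opaque

    quadraticRing : CommutativeRing a ℓ
    quadraticRing = ring₂

    baseHom : Hom R quadraticRing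
    baseHom = makeHom R ring₂ base
      (λ e → e , refl)
      (λ x y → refl , sym (+-identityˡ 0#))
      (λ x y → solve 3 (λ x y f → x :* y := x :* y :+ f :* (con 0 :* con 0)) refl x y f ,
               solve 2 (λ x y → con 0 := x :* con 0 :+ con 0 :* y) refl x y)
      (refl , refl)

    root : Carrier quadraticRing
    root = 0# , 1#

  private
    module K = CommutativeRing quadraticRing
    module ι = Hom baseHom

  opaque
    unfolding quadraticRing

    root² : root K.* root K.≈ ι.⟦ f ⟧
    root² = solve 1 (λ f → con 0 :* con 0 :+ f :* (con 1 :* con 1) := f) refl f ,
            solve 0 (con 0 :* con 1 :+ con 1 :* con 0 := con 0) refl

    decompose : ∀ z → ∃[ u ] ∃[ v ] z K.≈ ι.⟦ u ⟧ K.+ ι.⟦ v ⟧ K.* root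
    decompose (u , v) = u , v ,
      solve 3 (λ u v f → u := u :+ (v :* con 0 :+ f :* (con 0 :* con 1))) refl u v f ,
      solve 1 (λ v → v := con 0 :+ (v :* con 1 :+ con 0 :* con 0)) refl v

    independent : ∀ u v u′ v′ → ι.⟦ u ⟧ K.+ ι.⟦ v ⟧ K.* root K.≈ ι.⟦ u′ ⟧ K.+ ι.⟦ v′ ⟧ K.* root →
                  u ≈ u′ × v ≈ v′
    independent u v u′ v′ (d , e) =
      trans (re u v) (trans d (sym (re u′ v′))) , trans (im v) (trans e (sym (im v′)))
      where
      re : ∀ u v → u ≈ u + (v * 0# + f * (0# * 1#))
      re u v = solve 3 (λ u v f → u := u :+ (v :* con 0 :+ f :* (con 0 :* con 1))) refl u v f
      im : ∀ v → v ≈ 0# + (v * 1# + 0# * 0#)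
      im v = solve 1 (λ v → v := con 0 :+ (v :* con 1 :+ con 0 :* con 0)) refl v

  -- The universal property: y may be sent to any square root of the image of f.

  module _ {b ℓ₂} (S : CommutativeRing b ℓ₂) (φ : Hom R S) (Y : Carrier S)
           (Y² : CommutativeRing._≈_ S (CommutativeRing._*_ S Y Y) (Hom.⟦_⟧ φ f)) where
    private
      module S = CommutativeRing S
      module φ = Hom φ
      module SL = RingLemmas S
      open SetoidReasoning S.setoid

    adjoin : Quad → S.Carrier
    adjoin (u , v) = φ.⟦ u ⟧ S.+ φ.⟦ v ⟧ S.* Y

    opaque
      unfolding quadraticRing

      adjoinHom : Hom quadraticRing S
      adjoinHom = makeHom ring₂ S adjoin
        (λ (d , e) → S.+-cong (φ.⟦⟧-cong d) (S.*-congʳ (φ.⟦⟧-cong e)))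
        (λ (u , v) (u′ , v′) → begin
          φ.⟦ u + u′ ⟧ S.+ φ.⟦ v + v′ ⟧ S.* Y
            ≈⟨ S.+-cong (φ.+-homo u u′) (S.*-congʳ (φ.+-homo v v′)) ⟩
          (φ.⟦ u ⟧ S.+ φ.⟦ u′ ⟧) S.+ (φ.⟦ v ⟧ S.+ φ.⟦ v′ ⟧) S.* Y
            ≈⟨ SL.solve 5 (λ u v u′ v′ y → (u SL.:+ u′) SL.:+ (v SL.:+ v′) SL.:* y SL.:=
                 (u SL.:+ v SL.:* y) SL.:+ (u′ SL.:+ v′ SL.:* y))
                 S.refl φ.⟦ u ⟧ φ.⟦ v ⟧ φ.⟦ u′ ⟧ φ.⟦ v′ ⟧ Y ⟩
          (φ.⟦ u ⟧ S.+ φ.⟦ v ⟧ S.* Y) S.+ (φ.⟦ u′ ⟧ S.+ φ.⟦ v′ ⟧ S.* Y) ∎)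
        (λ (u , v) (u′ , v′) → begin
          φ.⟦ u * u′ + f * (v * v′) ⟧ S.+ φ.⟦ u * v′ + v * u′ ⟧ S.* Y
            ≈⟨ S.+-cong
                 (S.trans (φ.+-homo _ _) (S.+-cong (φ.*-homo u u′)
                   (S.trans (φ.*-homo f _) (S.*-cong (S.sym Y²) (φ.*-homo v v′)))))
                 (S.*-congʳ (S.trans (φ.+-homo _ _) (S.+-cong (φ.*-homo u v′) (φ.*-homo v u′)))) ⟩
          (φ.⟦ u ⟧ S.* φ.⟦ u′ ⟧ S.+ Y S.* Y S.* (φ.⟦ v ⟧ S.* φ.⟦ v′ ⟧)) S.+
          (φ.⟦ u ⟧ S.* φ.⟦ v′ ⟧ S.+ φ.⟦ v ⟧ S.* φ.⟦ u′ ⟧) S.* Y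
            ≈⟨ SL.solve 5 (λ u v u′ v′ y →
                 (u SL.:* u′ SL.:+ y SL.:* y SL.:* (v SL.:* v′)) SL.:+ (u SL.:* v′ SL.:+ v SL.:* u′) SL.:* y SL.:=
                 (u SL.:+ v SL.:* y) SL.:* (u′ SL.:+ v′ SL.:* y))
                 S.refl φ.⟦ u ⟧ φ.⟦ v ⟧ φ.⟦ u′ ⟧ φ.⟦ v′ ⟧ Y ⟩
          (φ.⟦ u ⟧ S.+ φ.⟦ v ⟧ S.* Y) S.* (φ.⟦ u′ ⟧ S.+ φ.⟦ v′ ⟧ S.* Y) ∎)
        (S.trans (S.+-cong φ.1#-homo (S.trans (S.*-congʳ φ.0#-homo) (S.zeroˡ Y))) (S.+-identityʳ _))

      adjoin-base : ∀ u → Hom.⟦_⟧ adjoinHom ι.⟦ u ⟧ S.≈ φ.⟦ u ⟧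
      adjoin-base u = S.trans (S.+-congˡ (S.trans (S.*-congʳ φ.0#-homo) (S.zeroˡ Y))) (S.+-identityʳ _)

      adjoin-root : Hom.⟦_⟧ adjoinHom root S.≈ Y
      adjoin-root = S.trans (S.+-cong φ.0#-homo (S.trans (S.*-congʳ φ.1#-homo) (S.*-identityˡ Y))) (S.+-identityˡ Y)

hom-^ : {A : CommutativeRing a ℓ₁} {B : CommutativeRing b ℓ₂} (θ : Hom A B) →
        let module A = CommutativeRing A
            module B = CommutativeRing B
            open Exp A.semiring using () renaming (_^_ to _^₁_)
            open Exp B.semiring using () renaming (_^_ to _^₂_) in
        ∀ x n → Hom.⟦_⟧ θ (x ^₁ n) B.≈ Hom.⟦_⟧ θ x ^₂ n
hom-^         θ x zero    = Hom.1#-homo θ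
hom-^ {B = B} θ x (suc n) = B.trans (Hom.*-homo θ x _) (B.*-congˡ (hom-^ θ x n))
  where
  module B = CommutativeRing B

hom-inverse : {A : CommutativeRing a ℓ₁} {B : CommutativeRing b ℓ₂} (θ : Hom A B) →
              let module A = CommutativeRing A
                  module B = CommutativeRing B
              in
              ∀ {x y} → x A.* y A.≈ A.1# → Hom.⟦_⟧ θ x B.* Hom.⟦_⟧ θ y B.≈ B.1#
hom-inverse {B = B} θ {x} {y} xy≈1 =
  B.trans (B.sym (Hom.*-homo θ x y)) (B.trans (Hom.⟦⟧-cong θ xy≈1) (Hom.1#-homo θ))
  where
  module B = CommutativeRing B

module _ (R : CommutativeRing a ℓ) where
  open CommutativeRing R hiding (Carrier)
  open RingLemmas R
  open Exp semiring
  open SetoidReasoning setoid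

  inverse-^ : ∀ {x t} → x * t ≈ 1# → ∀ n → x ^ n * t ^ n ≈ 1#
  inverse-^         xt≈1 zero    = *-identityˡ 1#
  inverse-^ {x} {t} xt≈1 (suc n) = begin
    (x * x ^ n) * (t * t ^ n)
      ≈⟨ solve 4 (λ a b c d → (a :* b) :* (c :* d) := (a :* c) :* (b :* d)) refl x (x ^ n) t (t ^ n) ⟩
    (x * t) * (x ^ n * t ^ n)  ≈⟨ *-cong xt≈1 (inverse-^ xt≈1 n) ⟩
    1# * 1#                    ≈⟨ *-identityˡ 1# ⟩
    1#                         ∎

  -- If (x , y) lies on y² = x²ᵍ⁺¹ + c xᵍ⁺¹ + x, then so does (1/x , y/xᵍ⁺¹).

  reciprocal : ∀ x t t′ c c′ y → x * t ≈ 1# → t′ ≈ t → c′ ≈ c → ∀ g →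
    let M = 2 ℕ.* g ℕ.+ 1; N = g ℕ.+ 1 in
    y * y ≈ x ^ M + c * x ^ N + x →
    (y * t ^ N) * (y * t ^ N) ≈ t′ ^ M + c′ * t′ ^ N + t′
  reciprocal x t t′ c c′ y xt≈1 t′≈t c′≈c g y² = begin
    (y * t ^ N) * (y * t ^ N)
      ≈⟨ solve 2 (λ y u → (y :* u) :* (y :* u) := (y :* y) :* (u :* u)) refl y (t ^ N) ⟩
    (y * y) * (t ^ N * t ^ N)
      ≈⟨ *-congʳ y² ⟩
    (x ^ M + c * x ^ N + x) * (t ^ N * t ^ N)
      ≈⟨ solve 5 (λ x xᴹ xᴺ c u → (xᴹ :+ c :* xᴺ :+ x) :* (u :* u) :=
           xᴹ :* (u :* u) :+ c :* ((xᴺ :* u) :* u) :+ x :* (u :* u)) refl x (x ^ M) (x ^ N) c (t ^ N) ⟩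
    x ^ M * (t ^ N * t ^ N) + c * ((x ^ N * t ^ N) * t ^ N) + x * (t ^ N * t ^ N)
      ≈⟨ +-cong (+-cong (*-congˡ t²ᴺ) (*-congˡ (*-congʳ (inverse-^ xt≈1 N)))) (*-congˡ t²ᴺ) ⟩
    x ^ M * (t * t ^ M) + c * (1# * t ^ N) + x * (t * t ^ M)
      ≈⟨ solve 6 (λ x xᴹ c t tᴹ tᴺ → xᴹ :* (t :* tᴹ) :+ c :* (con 1 :* tᴺ) :+ x :* (t :* tᴹ) :=
           (xᴹ :* tᴹ) :* t :+ c :* tᴺ :+ (x :* t) :* tᴹ) refl x (x ^ M) c t (t ^ M) (t ^ N) ⟩
    (x ^ M * t ^ M) * t + c * t ^ N + (x * t) * t ^ M
      ≈⟨ +-cong (+-congʳ (*-congʳ (inverse-^ xt≈1 M))) (*-congʳ xt≈1) ⟩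
    1# * t + c * t ^ N + 1# * t ^ M
      ≈⟨ solve 4 (λ c t tᴹ tᴺ → con 1 :* t :+ c :* tᴺ :+ con 1 :* tᴹ := tᴹ :+ c :* tᴺ :+ t)
           refl c t (t ^ M) (t ^ N) ⟩
    t ^ M + c * t ^ N + t
      ≈⟨ +-cong (+-cong (^-congˡ M t′≈t) (*-cong c′≈c (^-congˡ N t′≈t))) t′≈t ⟨
    t′ ^ M + c′ * t′ ^ N + t′ ∎
    where
    M = 2 ℕ.* g ℕ.+ 1
    N = g ℕ.+ 1
    N+N≡1+M : N ℕ.+ N ≡ 1 ℕ.+ M
    N+N≡1+M = S.solve 1 (λ g → (g S.:+ S.con 1) S.:+ (g S.:+ S.con 1) S.:=
                S.con 1 S.:+ (S.con 2 S.:* g S.:+ S.con 1)) ≡.refl g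
      where
      module S = +-*-Solver
    t²ᴺ : t ^ N * t ^ N ≈ t * t ^ M
    t²ᴺ = trans (sym (^-homo-* t N N)) (^-congʳ t N+N≡1+M)

record Algebra (R : CommutativeRing a ℓ) b ℓ₂ : Set (a ⊔ ℓ ⊔ Level.suc (b ⊔ ℓ₂)) where
  field
    ring      : CommutativeRing b ℓ₂
    structure : Hom R ring

module _ {R : CommutativeRing a ℓ} where

  record AlgebraHom (A : Algebra R b ℓ₁) (B : Algebra R c ℓ₂) : Set (a ⊔ b ⊔ c ⊔ ℓ₁ ⊔ ℓ₂) where
    private
      module A = Algebra A
      module B = Algebra B
    field
      hom : Hom A.ring B.ring
    open Hom hom public
    field
      commutes : ∀ r → CommutativeRing._≈_ B.ring ⟦ Hom.⟦_⟧ A.structure r ⟧ (Hom.⟦_⟧ B.structure r)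

  infix 4 _≅_

  record _≅_ (A : Algebra R b ℓ₁) (B : Algebra R c ℓ₂) : Set (a ⊔ b ⊔ c ⊔ ℓ₁ ⊔ ℓ₂) where
    field
      algebraHom : AlgebraHom A B
    open AlgebraHom algebraHom public
    field
      isRingIsomorphism : IsRingIsomorphism (rawRing (Algebra.ring A)) (rawRing (Algebra.ring B)) ⟦_⟧

  module _ {A : Algebra R b ℓ₁} (σ : AlgebraHom A A) where
    private
      module A = CommutativeRing (Algebra.ring A)
      module ι = Hom (Algebra.structure A)
      module σ = AlgebraHom σ

    FixedElement : Set (b ⊔ ℓ₁)
    FixedElement = Σ A.Carrier (λ z → σ.⟦ z ⟧ A.≈ z)

    fixedRing : CommutativeRing (b ⊔ ℓ₁) ℓ₁
    fixedRing = makeCommutativeRing {A = FixedElement}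
      (λ z w → proj₁ z A.≈ proj₁ w)
      (λ (z , e) (w , d) → z A.+ w , A.trans (σ.+-homo z w) (A.+-cong e d))
      (λ (z , e) (w , d) → z A.* w , A.trans (σ.*-homo z w) (A.*-cong e d))
      (λ (z , e) → A.- z , A.trans (σ.-‿homo z) (A.-‿cong e))
      (A.0# , σ.0#-homo)
      (A.1# , σ.1#-homo)
      record
        { isEquivalence = record { refl = A.refl ; sym = A.sym ; trans = A.trans }
        ; +-cong        = A.+-cong
        ; *-cong        = A.*-cong
        ; -‿cong        = A.-‿cong
        ; +-assoc       = λ _ _ _ → A.+-assoc _ _ _
        ; +-comm        = λ _ _ → A.+-comm _ _
        ; +-identityˡ   = λ _ → A.+-identityˡ _
        ; -‿inverseˡ    = λ _ → A.-‿inverseˡ _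
        ; *-assoc       = λ _ _ _ → A.*-assoc _ _ _
        ; *-comm        = λ _ _ → A.*-comm _ _
        ; *-identityˡ   = λ _ → A.*-identityˡ _
        ; distribʳ      = λ _ _ _ → A.distribʳ _ _ _
        }

    fixedAlgebra : Algebra R (b ⊔ ℓ₁) ℓ₁
    fixedAlgebra = record
      { ring      = fixedRing
      ; structure = makeHom R fixedRing (λ r → ι.⟦ r ⟧ , σ.commutes r)
                      ι.⟦⟧-cong ι.+-homo ι.*-homo ι.1#-homo
      }

module Curves {a ℓ} (k : Field a ℓ) where
  private
    module k = Field k

  open Polynomials k.commutativeRing public
  module k[x] = CommutativeRing polyRing
  module F = Fractions (polyDomain k)

  k⟨x⟩ : Field (a ⊔ ℓ) ℓ
  k⟨x⟩ = F.fractionField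
  module k⟨x⟩ = Field k⟨x⟩

  X-invertible : ∃[ z ] F.embed X k⟨x⟩.* z k⟨x⟩.≈ k⟨x⟩.1#
  X-invertible = k⟨x⟩.inverse (F.embed X) λ X≈0 → k.1≉0 (coeff-≈ (F.embed-injective X X≈0) 1)

  1/X : k⟨x⟩.Carrier
  1/X = proj₁ X-invertible

  -- Every geometric point has coordinates in some extension L of k; the
  -- partial derivatives of y² - f(x) are 2 y and - f′(x).

  IsNonsingular : Poly → Set (Level.suc (a ⊔ ℓ))
  IsNonsingular f =
    ∀ (L : Field a ℓ) (ι : Hom k.commutativeRing (Field.commutativeRing L)) →
    let open Field L in
    ∀ x y → y * y ≈ eval commutativeRing ι x f →
    ¬ (y + y ≈ 0# × eval commutativeRing ι x (derivative f) ≈ 0#)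

  -- In odd characteristic these are the affine models of hyperelliptic
  -- curves of genus g (g ≥ 2).

  IsHyperelliptic : ℕ → Poly → Set (Level.suc (a ⊔ ℓ))
  IsHyperelliptic g f =
    (HasDegree f (2 ℕ.* g ℕ.+ 1) ⊎ HasDegree f (2 ℕ.* g ℕ.+ 2)) × IsNonsingular f

  -- k(x)[y] / (y² - f), a field unless f is a square in k(x).

  module FunctionField (f : Poly) where
    private
      module Q = Quadratic F.fractionRing (F.embed f)

    ring : CommutativeRing (a ⊔ ℓ) ℓ
    ring = Q.quadraticRing

    open CommutativeRing ring public hiding (ring) renaming (Carrier to Function)
    open Exp semiring public using (_^_)
    open Q public using (root²; decompose; independent)

    rational : Hom F.fractionRing ring
    rational = Q.baseHom

    polynomial : Hom polyRing ring
    polynomial = rational ∘ʰ F.embedHom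

    constant : Hom k.commutativeRing ring
    constant = polynomial ∘ʰ constHom

    x̂ x̂⁻¹ ŷ : Function
    x̂   = Hom.⟦_⟧ polynomial X
    x̂⁻¹ = Hom.⟦_⟧ rational 1/X
    ŷ   = Q.root

    algebra : Algebra k.commutativeRing (a ⊔ ℓ) ℓ
    algebra = record { ring = ring ; structure = constant }

  -- A point of y² = h(x) over a k-algebra K at which the denominator of a
  -- rational function never vanishes.

  record GenericPoint {b ℓ₂} (K : CommutativeRing b ℓ₂) (ι : Hom k.commutativeRing K) (h : Poly) :
                      Set (a ⊔ ℓ ⊔ b ⊔ ℓ₂) where
    open CommutativeRing K hiding (Carrier)
    field
      x-coord  : Carrier K
      y-coord  : Carrier K
      on-curve : y-coord * y-coord ≈ eval K ι x-coord h
      dominant : ∀ p → ¬ p ≈ₚ [] → Invertible K (eval K ι x-coord p)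

  -- A dominant rational map from y² = f(x) to y² = h(x) is a generic point of
  -- the latter over the function field of the former.

  RationalMap : Poly → Poly → Set (a ⊔ ℓ)
  RationalMap f h = GenericPoint (FunctionField.ring f) (FunctionField.constant f) h

  -- φ ↦ φ(x-coord, y-coord)

  module _ {b ℓ₂} (K : Algebra k.commutativeRing b ℓ₂) {h}
           (s : GenericPoint (Algebra.ring K) (Algebra.structure K) h) where
    private
      open Algebra K renaming (structure to ι)
      module K = CommutativeRing ring
      module s = GenericPoint s
      module E = Extend (polyDomain k) ring (evalHom ring ι s.x-coord) s.dominant
      module Q = Quadratic F.fractionRing (F.embed h)

      y² : s.y-coord K.* s.y-coord K.≈ E.extend (F.embed h)
      y² = K.trans s.on-curve (K.sym (E.extend-embed h))

    opaque

      substitute : AlgebraHom (FunctionField.algebra h) K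
      substitute = record
        { hom      = Q.adjoinHom ring E.extendHom s.y-coord y²
        ; commutes = λ r → K.trans (Q.adjoin-base ring E.extendHom s.y-coord y² (F.embed (const r)))
                       (K.trans (E.extend-embed (const r)) (eval-const ring ι s.x-coord r))
        }

      substitute-x̂ : AlgebraHom.⟦_⟧ substitute (FunctionField.x̂ h) K.≈ s.x-coord
      substitute-x̂ = K.trans (Q.adjoin-base ring E.extendHom s.y-coord y² (F.embed X))
        (K.trans (E.extend-embed X) (eval-X ring ι s.x-coord))

      substitute-ŷ : AlgebraHom.⟦_⟧ substitute (FunctionField.ŷ h) K.≈ s.y-coord
      substitute-ŷ = Q.adjoin-root ring E.extendHom s.y-coord y²

  pullback : ∀ {f h} → RationalMap f h →
             AlgebraHom (FunctionField.algebra h) (FunctionField.algebra f)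
  pullback {f} s = substitute (FunctionField.algebra f) s

  -- Functions on the quotient of y² = f(x) by the group generated by an
  -- automorphism σ are the σ-invariant functions on y² = f(x).

  QuotientFunctionField : ∀ {f} → RationalMap f f → Algebra k.commutativeRing (a ⊔ ℓ) ℓ
  QuotientFunctionField σ = fixedAlgebra (pullback σ)

  -- The quotient by σ is birationally equivalent over k to y² = h(x).

  QuotientGivenBy : ∀ {f} → RationalMap f f → Poly → Set (a ⊔ ℓ)
  QuotientGivenBy σ h = FunctionField.algebra h ≅ QuotientFunctionField σ

  module _ where
    open Exp k[x].semiring using (_^_)
    open Multiples k[x].semiring using () renaming (_×_ to _·_)
    open Sums k[x].semiring using (sum)

    -- The quotient m C(m-i, i) / (m - i) is exact for i ≤ m / 2.

    dicksonCoeff : ℕ → ℕ → ℕ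
    dicksonCoeff m i with m ∸ i
    ... | zero      = 0
    ... | j@(suc _) = m ℕ.* (j C i) / j

    dickson : ℕ → k.Carrier → Poly
    dickson m α = sum {suc ⌊ m /2⌋} λ i →
      dicksonCoeff m (toℕ i) · (const (k.- α) ^ toℕ i *ₚ X ^ (m ∸ 2 ℕ.* toℕ i))

    D : ℕ → Poly
    D m = dickson m k.1#

    numeral : ℕ → Poly
    numeral n = n · const k.1#

    C′ : ℕ → k.Carrier → Poly
    C′ g c = X ^ (2 ℕ.* g ℕ.+ 1) +ₚ const c *ₚ X ^ (g ℕ.+ 1) +ₚ X

  hom-C′ : ∀ {b ℓ₂} (S : CommutativeRing b ℓ₂) (θ : Hom polyRing S) →
           let module θ = Hom θ
               module S = CommutativeRing S
               open Exp S.semiring using (_^_)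
           in
           ∀ g c → θ.⟦ C′ g c ⟧ S.≈
             θ.⟦ X ⟧ ^ (2 ℕ.* g ℕ.+ 1) S.+ θ.⟦ const c ⟧ S.* θ.⟦ X ⟧ ^ (g ℕ.+ 1) S.+ θ.⟦ X ⟧
  hom-C′ S θ g c = S.trans (θ.+-homo (X ^ₚ M +ₚ const c *ₚ X ^ₚ N) X) (S.+-congʳ
    (S.trans (θ.+-homo (X ^ₚ M) (const c *ₚ X ^ₚ N))
      (S.+-cong (hom-^ θ X M) (S.trans (θ.*-homo (const c) (X ^ₚ N)) (S.*-congˡ (hom-^ θ X N))))))
    where
    module θ = Hom θ
    module S = CommutativeRing S
    open Exp k[x].semiring using () renaming (_^_ to _^ₚ_)
    M = 2 ℕ.* g ℕ.+ 1
    N = g ℕ.+ 1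

  1/X-transcendental : ∀ p → eval F.fractionRing (F.embedHom ∘ʰ constHom) 1/X p F.≈ᶠ F.embed [] → p ≈ₚ []
  1/X-transcendental = transcendental-inverse F.fractionRing (F.embedHom ∘ʰ constHom)
    (F.embed X) 1/X (proj₂ X-invertible)
    λ p e → F.embed-injective p (k⟨x⟩.trans (hom-eval F.fractionRing F.embedHom p) e)

  module Involutions (g : ℕ) (c : k.Carrier) where
    open FunctionField (C′ g c)

    x̂x̂⁻¹≈1 : x̂ * x̂⁻¹ ≈ 1#
    x̂x̂⁻¹≈1 = hom-inverse rational {F.embed X} {1/X} (proj₂ X-invertible)

    s-on-curve : (ŷ * x̂⁻¹ ^ (g ℕ.+ 1)) * (ŷ * x̂⁻¹ ^ (g ℕ.+ 1)) ≈ eval ring constant x̂⁻¹ (C′ g c)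
    s-on-curve = trans
      (reciprocal ring x̂ x̂⁻¹ (eval ring constant x̂⁻¹ X) (Hom.⟦_⟧ constant c) (eval ring constant x̂⁻¹ (const c)) ŷ
        x̂x̂⁻¹≈1 (eval-X ring constant x̂⁻¹) (eval-const ring constant x̂⁻¹ c) g
        (trans root² (hom-C′ ring polynomial g c)))
      (sym (hom-C′ ring (evalHom ring constant x̂⁻¹) g c))

    s-dominant : ∀ p → ¬ p ≈ₚ [] → Invertible ring (eval ring constant x̂⁻¹ p)
    s-dominant = eval-invertible k⟨x⟩ ring (F.embedHom ∘ʰ constHom) constant rational (λ _ → refl)
      1/X 1/X-transcendental

    -- (x, y) ↦ (1/x, y/xᵍ⁺¹)

    s : RationalMap (C′ g c) (C′ g c)
    s = record
      { x-coord  = x̂⁻¹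
      ; y-coord  = ŷ * x̂⁻¹ ^ (g ℕ.+ 1)
      ; on-curve = s-on-curve
      ; dominant = s-dominant
      }

    -- (x, y) ↦ (1/x, - y/xᵍ⁺¹)

    sω : RationalMap (C′ g c) (C′ g c)
    sω = record
      { x-coord  = x̂⁻¹
      ; y-coord  = - (ŷ * x̂⁻¹ ^ (g ℕ.+ 1))
      ; on-curve = trans {k = eval ring constant x̂⁻¹ (C′ g c)}
          (RingLemmas.-x*-y≈x*y ring (ŷ * x̂⁻¹ ^ (g ℕ.+ 1)) (ŷ * x̂⁻¹ ^ (g ℕ.+ 1))) s-on-curve
      ; dominant = s-dominant
      }

{-# OPTIONS --safe #-}
-- Put w = x + 1/x.  Since D_g(w) = xᵍ + x⁻ᵍ, the curve is y² = xᵍ⁺¹ (D_g(w) + c), so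
-- multiplying y by a suitable r ∈ k(x), one of x⁻ⁿ, x⁻ⁿ(x ± 1), x⁻ⁿ(x - 1/x), gives an
-- invariant V = r y satisfying the equation of the quotient over k(w).  These are all
-- the invariants: every function is uniquely U + x U′ with U, U′ ∈ k(w) + k(w) V,
-- and the involution sends it to U + x⁻¹ U′, so that invariance forces U′ = 0.

module Submission where

open import Defs
open import Data.Nat.Divisibility using (_∣_)
open import Data.Nat.GCD using (gcd)
open import Data.Nat.Primality using (Prime)
open import Data.Product using (_×_)
open import Relation.Binary.PropositionalEquality using (_≡_)
open import Relation.Nullary using (¬_)
open import Algebra.Bundles using (CommutativeRing)
import Algebra.Properties.Group as GroupProperties
import Algebra.Properties.Semiring.Exp as Exp
import Algebra.Properties.Semiring.Mult as Multiples
import Algebra.Properties.Semiring.Sum as Sums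
open import Data.Empty using (⊥-elim)
open import Data.Fin.Base using (toℕ)
open import Data.Fin.Properties using (toℕ<n)
open import Data.List.Base using ([]; _∷_; length)
open import Data.Nat.Base as ℕ using (ℕ; zero; suc; _∸_; ⌊_/2⌋; ⌈_/2⌉; s≤s)
open import Data.Nat.Combinatorics using (_C_; nC1≡n; nCk+nC[k+1]≡[n+1]C[k+1])
open import Data.Nat.Combinatorics.Specification using (k>n⇒nCk≡0)
open import Data.Nat.DivMod using (_/_; m*n/n≡m)
open import Data.Nat.Divisibility using (divides; ∣⇒≤; ∣-refl; ∣m∣n⇒∣m+n; ∣m+n∣m⇒∣n)
import Data.Nat.Properties as ℕ
open import Data.Nat.Solver using (module +-*-Solver)
open import Data.Product using (∃-syntax; _,_; proj₁; proj₂)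
open import Data.Sum using (_⊎_; inj₁; inj₂)
open import Function using (id)
open import Level using (Level)
open import Relation.Binary.PropositionalEquality as ≡ using ()
import Relation.Binary.Reasoning.Setoid as SetoidReasoning
open import Relation.Nullary using (yes; no)

-- Two demands dictate r. Under s or sω, x⁻ⁿ y becomes ± xⁿ⁻ᵍ⁻¹ y. So 2 n is taken to be g + 1 when
-- g is odd, which leaves at most a sign, and g + 2 when g is even, which leaves a further factor x.
-- A second factor q of r compensates: q(1/x) = ± q(x) for odd g, x q(1/x) = ± q(x) for even g. Then
-- q², divided by x when g is even, is a polynomial in w: 1 or w² - 4, respectively w + 2 or w - 2.
-- This is where the extra factors of the four equations come from.
--
-- Three obstacles shape the rest. The ring k(x)[y] / (y² - f) is treated only as a ring, so
-- bijectivity is read off coordinates with respect to 1 and y over k(x). Substituting w into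
-- fractions requires w to be transcendental over k; evaluation at x = 0 shows this for 1/w. And
-- k(x) = k(w) + k(w) x must hold for fractions too, which needs a nonzero norm of the denominator.

private
  variable
    a b c ℓ ℓ₁ ℓ₂ ℓ₃ : Level

-- Binomial identities behind the Dickson coefficients.

k*nCk≡n*[n-1]C[k-1] : ∀ n k → suc k ℕ.* (suc n C suc k) ≡ suc n ℕ.* (n C k)
k*nCk≡n*[n-1]C[k-1] n       zero    = ≡.trans (ℕ.*-identityˡ _) (≡.trans (nC1≡n (suc n)) (≡.sym (ℕ.*-identityʳ _)))
k*nCk≡n*[n-1]C[k-1] zero    (suc k) = ℕ.*-zeroʳ (suc (suc k))
k*nCk≡n*[n-1]C[k-1] (suc n) (suc k) = begin
  suc (suc k) ℕ.* (suc (suc n) C suc (suc k))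
    ≡⟨ ≡.cong (suc (suc k) ℕ.*_) (nCk+nC[k+1]≡[n+1]C[k+1] (suc n) (suc k)) ⟨
  suc (suc k) ℕ.* ((suc n C suc k) ℕ.+ (suc n C suc (suc k)))
    ≡⟨ solve 3 (λ k a b → (con 2 :+ k) :* (a :+ b) := a :+ (con 1 :+ k) :* a :+ (con 2 :+ k) :* b)
         ≡.refl k (suc n C suc k) (suc n C suc (suc k)) ⟩
  (suc n C suc k) ℕ.+ suc k ℕ.* (suc n C suc k) ℕ.+ suc (suc k) ℕ.* (suc n C suc (suc k))
    ≡⟨ ≡.cong₂ (λ u v → (suc n C suc k) ℕ.+ u ℕ.+ v)
         (k*nCk≡n*[n-1]C[k-1] n k) (k*nCk≡n*[n-1]C[k-1] n (suc k)) ⟩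
  (suc n C suc k) ℕ.+ suc n ℕ.* (n C k) ℕ.+ suc n ℕ.* (n C suc k)
    ≡⟨ solve 4 (λ n a b c → a :+ (con 1 :+ n) :* b :+ (con 1 :+ n) :* c := a :+ (con 1 :+ n) :* (b :+ c))
         ≡.refl n (suc n C suc k) (n C k) (n C suc k) ⟩
  (suc n C suc k) ℕ.+ suc n ℕ.* ((n C k) ℕ.+ (n C suc k))
    ≡⟨ ≡.cong (λ u → (suc n C suc k) ℕ.+ suc n ℕ.* u) (nCk+nC[k+1]≡[n+1]C[k+1] n k) ⟩
  suc (suc n) ℕ.* (suc n C suc k) ∎
  where
  open ≡.≡-Reasoning
  open +-*-Solver

-- The integer m C(m - i, i) / (m - i) for m = i + (j + 1).

binomialPair : ℕ → ℕ → ℕ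
binomialPair j zero    = 1
binomialPair j (suc i) = (suc j C suc i) ℕ.+ (j C i)

-- Absorption turns the part `suc i * (suc j C suc i)` of the numerator into a multiple of `suc j`,
-- so the truncating division is exact.
binomialPair-quotient : ∀ j i → (i ℕ.+ suc j) ℕ.* (suc j C i) / suc j ≡ binomialPair j i
binomialPair-quotient j zero    = ≡.trans (≡.cong (_/ suc j) (ℕ.*-comm (suc j) 1)) (m*n/n≡m 1 (suc j))
binomialPair-quotient j (suc i) = ≡.trans (≡.cong (_/ suc j) (begin
  (suc i ℕ.+ suc j) ℕ.* (suc j C suc i)                        ≡⟨ ℕ.*-distribʳ-+ (suc j C suc i) (suc i) (suc j) ⟩
  suc i ℕ.* (suc j C suc i) ℕ.+ suc j ℕ.* (suc j C suc i)      ≡⟨ ≡.cong (ℕ._+ suc j ℕ.* (suc j C suc i)) (k*nCk≡n*[n-1]C[k-1] j i) ⟩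
  suc j ℕ.* (j C i) ℕ.+ suc j ℕ.* (suc j C suc i)              ≡⟨ solve 3 (λ n u v → n :* u :+ n :* v := (v :+ u) :* n)
                                                                    ≡.refl (suc j) (j C i) (suc j C suc i) ⟩
  binomialPair j (suc i) ℕ.* suc j                             ∎)) (m*n/n≡m (binomialPair j (suc i)) (suc j))
  where
  open ≡.≡-Reasoning
  open +-*-Solver

-- Pascal's rule in both summands. This is the coefficient form of D_{m+2} = x D_{m+1} - α D_m.
binomialPair-recurrence : ∀ j i →
  binomialPair (suc j) (suc i) ≡ binomialPair j (suc i) ℕ.+ binomialPair j i
binomialPair-recurrence j zero    = ≡.cong (ℕ._+ 1) (≡.trans (≡.sym (nCk+nC[k+1]≡[n+1]C[k+1] (suc j) 0)) (ℕ.+-comm 1 _))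
binomialPair-recurrence j (suc i) = begin
  (suc (suc j) C suc (suc i)) ℕ.+ (suc j C suc i)
    ≡⟨ ≡.cong₂ ℕ._+_ (nCk+nC[k+1]≡[n+1]C[k+1] (suc j) (suc i)) (nCk+nC[k+1]≡[n+1]C[k+1] j i) ⟨
  ((suc j C suc i) ℕ.+ (suc j C suc (suc i))) ℕ.+ ((j C i) ℕ.+ (j C suc i))
    ≡⟨ solve 4 (λ u v p q → (u :+ v) :+ (p :+ q) := (v :+ q) :+ (u :+ p))
         ≡.refl (suc j C suc i) (suc j C suc (suc i)) (j C i) (j C suc i) ⟩
  binomialPair j (suc (suc i)) ℕ.+ binomialPair j (suc i) ∎
  where
  open ≡.≡-Reasoning
  open +-*-Solver

-- The index j + 2 is the first one past ⌊m / 2⌋ for m = 2 j + 3. This zero absorbs the irregular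
-- growth in the length of the Dickson sums.
binomialPair-vanishes : ∀ j → binomialPair j (suc (suc j)) ≡ 0
binomialPair-vanishes j = ≡.cong₂ ℕ._+_ (k>n⇒nCk≡0 (ℕ.n<1+n (suc j))) (k>n⇒nCk≡0 (ℕ.n<1+n j))

-- The three-term recurrence of the Dickson sums.

-- The coefficients are known in degrees i + (j + 1), so each index in the range of the sum is
-- brought to that form. The bound i ≤ j + 1 keeps the exponent j + 1 - i from being truncated.
⌊n/2⌋-complement : ∀ m i → i ℕ.≤ ⌊ suc m /2⌋ → ∃[ j ] suc m ≡ i ℕ.+ suc j × i ℕ.≤ suc j
⌊n/2⌋-complement m i i≤ = j , m≡ , ℕ.≤-trans i≤ (ℕ.≤-trans (ℕ.⌊n/2⌋≤⌈n/2⌉ (suc m)) half≤)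
  where
  k = ⌊ suc m /2⌋
  j = (k ∸ i) ℕ.+ ⌊ m /2⌋
  m≡ : suc m ≡ i ℕ.+ suc j
  m≡ = begin
    suc m                                 ≡⟨ ℕ.⌊n/2⌋+⌈n/2⌉≡n (suc m) ⟨
    k ℕ.+ suc ⌊ m /2⌋                     ≡⟨ ≡.cong (ℕ._+ suc ⌊ m /2⌋) (ℕ.m+[n∸m]≡n i≤) ⟨
    i ℕ.+ (k ∸ i) ℕ.+ suc ⌊ m /2⌋         ≡⟨ ℕ.+-assoc i _ _ ⟩
    i ℕ.+ ((k ∸ i) ℕ.+ suc ⌊ m /2⌋)       ≡⟨ ≡.cong (i ℕ.+_) (ℕ.+-suc (k ∸ i) _) ⟩
    i ℕ.+ suc j                           ∎
    where
    open ≡.≡-Reasoning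
  half≤ : ⌈ suc m /2⌉ ℕ.≤ suc j
  half≤ = s≤s (ℕ.m≤n+m ⌊ m /2⌋ (k ∸ i))

⌊1+n/2⌋ : ∀ n → ⌊ suc n /2⌋ ≡ suc ⌊ n /2⌋ ⊎ ⌊ suc n /2⌋ ≡ ⌊ n /2⌋ × n ≡ ⌊ n /2⌋ ℕ.+ ⌊ n /2⌋
⌊1+n/2⌋ zero          = inj₂ (≡.refl , ≡.refl)
⌊1+n/2⌋ (suc zero)    = inj₁ ≡.refl
⌊1+n/2⌋ (suc (suc n)) with ⌊1+n/2⌋ n
... | inj₁ e       = inj₁ (≡.cong suc e)
... | inj₂ (e , d) = inj₂ (≡.cong suc e , ≡.cong suc (≡.trans (≡.cong suc d) (≡.sym (ℕ.+-suc _ _))))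

-- e stands for - α.

module DicksonTerms (R : CommutativeRing a ℓ) (coefficient : ℕ → ℕ → ℕ)
                    (coefficient≡ : ∀ j i → coefficient (i ℕ.+ suc j) i ≡ binomialPair j i) where
  open CommutativeRing R
  open RingLemmas R
  open Exp semiring
  open Multiples semiring using (×-comm-*; ×-congʳ; ×-congˡ; ×-homo-+) renaming (_×_ to _·_)
  open Sums semiring using (sum; sum-cong-≋; ∑-distrib-+; *-distribˡ-sum)
  open SetoidReasoning setoid

  sum-last-zero : ∀ n (f : ℕ → Carrier) → f n ≈ 0# →
                  sum {suc n} (λ i → f (toℕ i)) ≈ sum {n} (λ i → f (toℕ i))
  sum-last-zero zero    f e = trans (+-identityʳ _) e
  sum-last-zero (suc n) f e = +-congˡ (sum-last-zero n (λ i → f (suc i)) e)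

  module _ (e x : Carrier) where

    term : ℕ → ℕ → Carrier
    term m i = coefficient m i · (e ^ i * x ^ (m ∸ 2 ℕ.* i))

    term≈ : ∀ j i → term (i ℕ.+ suc j) i ≈ binomialPair j i · (e ^ i * x ^ (suc j ∸ i))
    term≈ j i = trans (×-congˡ (coefficient≡ j i)) (×-congʳ (binomialPair j i) (*-congˡ (^-congʳ x
      (≡.trans (ℕ.[m+n]∸[m+o]≡n∸o i (suc j) (i ℕ.+ 0)) (≡.cong (suc j ∸_) (ℕ.+-identityʳ i))))))

    term-vanishes : ∀ j → term (suc (suc j) ℕ.+ suc j) (suc (suc j)) ≈ 0#
    term-vanishes j = trans (term≈ j (suc (suc j))) (×-congˡ (binomialPair-vanishes j))

    term-zero : ∀ j → term (suc j) 0 ≈ x ^ suc j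
    term-zero j = trans (term≈ j 0) (trans (+-identityʳ _) (*-identityˡ _))

    private
      term-recurrence′ : ∀ j i → i ℕ.≤ suc j →
        term (suc i ℕ.+ suc (suc j)) (suc i) ≈ x * term (suc i ℕ.+ suc j) (suc i) + e * term (i ℕ.+ suc j) i
      term-recurrence′ j i i≤1+j = begin
        term (suc i ℕ.+ suc (suc j)) (suc i)
          ≈⟨ term≈ (suc j) (suc i) ⟩
        binomialPair (suc j) (suc i) · z
          ≈⟨ ×-congˡ (binomialPair-recurrence j i) ⟩
        (binomialPair j (suc i) ℕ.+ binomialPair j i) · z
          ≈⟨ ×-homo-+ z (binomialPair j (suc i)) (binomialPair j i) ⟩
        binomialPair j (suc i) · z + binomialPair j i · z
          ≈⟨ +-cong (first (ℕ.m≤n⇒m<n∨m≡n i≤1+j)) second ⟩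
        x * term (suc i ℕ.+ suc j) (suc i) + e * term (i ℕ.+ suc j) i
          ∎
        where
        z = e ^ suc i * x ^ (suc j ∸ i)
        first : i ℕ.< suc j ⊎ i ≡ suc j → binomialPair j (suc i) · z ≈ x * term (suc i ℕ.+ suc j) (suc i)
        -- For i = j + 1 the exponent j - i is truncated and no factor x can be split off; both
        -- sides vanish through their coefficients.
        first (inj₂ ≡.refl) = begin
          binomialPair j (suc i) · z                ≈⟨ ×-congˡ (binomialPair-vanishes j) ⟩
          0#                                        ≈⟨ zeroʳ x ⟨
          x * 0#                                    ≈⟨ *-congˡ (term-vanishes j) ⟨
          x * term (suc i ℕ.+ suc j) (suc i)        ∎
        first (inj₁ (s≤s i≤j)) = begin
          binomialPair j (suc i) · z                                    ≈⟨ ×-congʳ (binomialPair j (suc i)) (begin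
            e ^ suc i * x ^ (suc j ∸ i)      ≈⟨ *-congˡ (^-congʳ x (ℕ.+-∸-assoc 1 i≤j)) ⟩
            e ^ suc i * (x * x ^ (j ∸ i))    ≈⟨ solve 3 (λ u v w → u :* (v :* w) := v :* (u :* w)) refl (e ^ suc i) x (x ^ (j ∸ i)) ⟩
            x * (e ^ suc i * x ^ (j ∸ i))    ∎) ⟩
          binomialPair j (suc i) · (x * (e ^ suc i * x ^ (j ∸ i)))      ≈⟨ ×-comm-* (binomialPair j (suc i)) x _ ⟨
          x * (binomialPair j (suc i) · (e ^ suc i * x ^ (j ∸ i)))      ≈⟨ *-congˡ (term≈ j (suc i)) ⟨
          x * term (suc i ℕ.+ suc j) (suc i)                            ∎
        second : binomialPair j i · z ≈ e * term (i ℕ.+ suc j) i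
        second = begin
          binomialPair j i · z                                  ≈⟨ ×-congʳ (binomialPair j i) (*-assoc e _ _) ⟩
          binomialPair j i · (e * (e ^ i * x ^ (suc j ∸ i)))    ≈⟨ ×-comm-* (binomialPair j i) e _ ⟨
          e * (binomialPair j i · (e ^ i * x ^ (suc j ∸ i)))    ≈⟨ *-congˡ (term≈ j i) ⟨
          e * term (i ℕ.+ suc j) i                              ∎

    term-recurrence : ∀ m i → i ℕ.≤ ⌊ suc m /2⌋ →
      term (3 ℕ.+ m) (suc i) ≈ x * term (2 ℕ.+ m) (suc i) + e * term (suc m) i
    term-recurrence m i i≤ with ⌊n/2⌋-complement m i i≤
    ... | j , m≡ , i≤1+j = begin
      term (3 ℕ.+ m) (suc i)
        ≡⟨ ≡.cong (λ n → term n (suc i)) (≡.trans (≡.cong (2 ℕ.+_) m≡) (≡.cong suc (≡.sym (ℕ.+-suc i (suc j))))) ⟩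
      term (suc i ℕ.+ suc (suc j)) (suc i)
        ≈⟨ term-recurrence′ j i i≤1+j ⟩
      x * term (suc i ℕ.+ suc j) (suc i) + e * term (i ℕ.+ suc j) i
        ≡⟨ ≡.cong (λ n → x * term (suc n) (suc i) + e * term n i) m≡ ⟨
      x * term (2 ℕ.+ m) (suc i) + e * term (suc m) i ∎

    -- Over the polynomial ring, with e = const (- α) and x = X, this unfolds to `dickson m α`.
    dicksonSum : ℕ → Carrier
    dicksonSum m = sum {suc ⌊ m /2⌋} λ i → term m (toℕ i)

    dicksonSum-1 : dicksonSum 1 ≈ x
    dicksonSum-1 = trans (+-identityʳ _) (trans (term-zero 0) (*-identityʳ x))

    dicksonSum-2 : dicksonSum 2 ≈ x * x + (e + e)
    dicksonSum-2 = begin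
      term 2 0 + (term 2 1 + 0#)
        ≈⟨ +-cong (term-zero 1) (trans (+-identityʳ _) (term≈ 0 1)) ⟩
      x * (x * 1#) + (e * 1# * 1# + (e * 1# * 1# + 0#))
        ≈⟨ solve 2 (λ x e → x :* (x :* con 1) :+ (e :* con 1 :* con 1 :+ (e :* con 1 :* con 1 :+ con 0)) :=
             x :* x :+ (e :+ e)) refl x e ⟩
      x * x + (e + e) ∎

    -- Term i + 1 on the left combines term i + 1 of the first sum with term i of the second, and
    -- term 0 comes from the first sum alone. The delicate point is the number of terms, which
    -- depends on the parity of m.
    dicksonSum-recurrence : ∀ m → dicksonSum (3 ℕ.+ m) ≈ x * dicksonSum (2 ℕ.+ m) + e * dicksonSum (suc m)
    dicksonSum-recurrence m = begin
      term (3 ℕ.+ m) 0 + sum {suc k} (λ i → term (3 ℕ.+ m) (suc (toℕ i)))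
        ≈⟨ +-cong (trans (term-zero (2 ℕ.+ m)) (*-congˡ (sym (term-zero (suc m)))))
             (sum-cong-≋ (λ i → term-recurrence m (toℕ i) (ℕ.≤-pred (toℕ<n i)))) ⟩
      x * term (2 ℕ.+ m) 0 + sum {suc k} (λ i → x * term (2 ℕ.+ m) (suc (toℕ i)) + e * term (suc m) (toℕ i))
        ≈⟨ +-congˡ (trans (∑-distrib-+ {suc k} (λ i → x * term (2 ℕ.+ m) (suc (toℕ i))) (λ i → e * term (suc m) (toℕ i)))
             (+-cong (sym (*-distribˡ-sum {suc k} x (λ i → term (2 ℕ.+ m) (suc (toℕ i)))))
                     (sym (*-distribˡ-sum {suc k} e (λ i → term (suc m) (toℕ i)))))) ⟩
      x * term (2 ℕ.+ m) 0 + (x * sum {suc k} (λ i → term (2 ℕ.+ m) (suc (toℕ i))) + e * dicksonSum (suc m))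
        ≈⟨ +-congˡ (+-congʳ (*-congˡ (range (⌊1+n/2⌋ (suc m))))) ⟩
      x * term (2 ℕ.+ m) 0 + (x * sum {suc ⌊ m /2⌋} (λ i → term (2 ℕ.+ m) (suc (toℕ i))) + e * dicksonSum (suc m))
        ≈⟨ solve 4 (λ x t s r → x :* t :+ (x :* s :+ r) := x :* (t :+ s) :+ r) refl x (term (2 ℕ.+ m) 0)
             (sum {suc ⌊ m /2⌋} (λ i → term (2 ℕ.+ m) (suc (toℕ i)))) (e * dicksonSum (suc m)) ⟩
      x * dicksonSum (2 ℕ.+ m) + e * dicksonSum (suc m) ∎
      where
      k = ⌊ suc m /2⌋
      f : ℕ → Carrier
      f i = term (2 ℕ.+ m) (suc i)
      range : suc ⌊ m /2⌋ ≡ suc k ⊎ suc ⌊ m /2⌋ ≡ k × suc m ≡ k ℕ.+ k →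
              sum {suc k} (λ i → f (toℕ i)) ≈ sum {suc ⌊ m /2⌋} (λ i → f (toℕ i))
      range (inj₁ e)       = reflexive (≡.cong (λ n → sum {n} (λ i → f (toℕ i))) (≡.sym e))
      -- Here m + 1 = 2 k, and the sum for degree 2 k + 1 stops one term early; the surplus term,
      -- with index k + 1, is zero.
      range (inj₂ (e , d)) = trans (sum-last-zero k f (f-vanishes k (≡.sym e) d))
        (reflexive (≡.cong (λ n → sum {n} (λ i → f (toℕ i))) (≡.sym e)))
        where
        -- The variable n stands for k, so that the first equation can be matched with `refl`.
        f-vanishes : ∀ n → n ≡ suc ⌊ m /2⌋ → suc m ≡ n ℕ.+ n → f n ≈ 0#
        f-vanishes n ≡.refl d = trans (reflexive (≡.cong (λ l → term (suc l) (suc n)) d)) (term-vanishes ⌊ m /2⌋)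

-- The functional equation as a consequence of the recurrence.

module _ (R : CommutativeRing a ℓ) where
  open CommutativeRing R
  open RingLemmas R
  open Exp semiring
  open SetoidReasoning setoid

  -- The cross terms of (x + t)(xᵐ⁺¹ + tᵐ⁺¹) are x t (xᵐ + tᵐ), which e = - 1 cancels. The
  -- recurrence has order two, so two consecutive values are carried along. Giving e by an equation
  -- keeps it an atom for the semiring solver.
  dickson-sequence : ∀ {x t e} → x * t ≈ 1# → 1# + e ≈ 0# → (d : ℕ → Carrier) →
    d 1 ≈ x + t → d 2 ≈ (x + t) * (x + t) + (e + e) →
    (∀ m → d (3 ℕ.+ m) ≈ (x + t) * d (2 ℕ.+ m) + e * d (1 ℕ.+ m)) →
    ∀ m → d (suc m) ≈ x ^ suc m + t ^ suc m
  dickson-sequence {x} {t} {e} xt≈1 1+e≈0 d d₁ d₂ d₃ m = proj₁ (pair m)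
    where
    pair : ∀ m → (d (1 ℕ.+ m) ≈ x ^ (1 ℕ.+ m) + t ^ (1 ℕ.+ m)) × (d (2 ℕ.+ m) ≈ x ^ (2 ℕ.+ m) + t ^ (2 ℕ.+ m))
    pair zero = trans d₁ (sym (+-cong (*-identityʳ x) (*-identityʳ t))) , (begin
      d 2                              ≈⟨ d₂ ⟩
      (x + t) * (x + t) + (e + e)      ≈⟨ solve 3 (λ x t e → (x :+ t) :* (x :+ t) :+ (e :+ e) :=
                                            (x :* (x :* con 1) :+ t :* (t :* con 1)) :+ ((x :* t :+ e) :+ (x :* t :+ e)))
                                            refl x t e ⟩
      (x ^ 2 + t ^ 2) + ((x * t + e) + (x * t + e))
        ≈⟨ +-congˡ (trans (+-cong xt+e≈0 xt+e≈0) (+-identityˡ 0#)) ⟩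
      x ^ 2 + t ^ 2 + 0#               ≈⟨ +-identityʳ _ ⟩
      x ^ 2 + t ^ 2                    ∎)
      where
      xt+e≈0 = trans (+-congʳ xt≈1) 1+e≈0
    pair (suc m) with pair m
    ... | dₘ , dₘ₊₁ = dₘ₊₁ , (begin
      d (3 ℕ.+ m)                                      ≈⟨ d₃ m ⟩
      (x + t) * d (2 ℕ.+ m) + e * d (1 ℕ.+ m)          ≈⟨ +-cong (*-congˡ dₘ₊₁) (*-congˡ dₘ) ⟩
      (x + t) * (x * p + t * q) + e * (p + q)
        ≈⟨ solve 5 (λ x t e p q → (x :+ t) :* (x :* p :+ t :* q) :+ e :* (p :+ q) :=
             (x :* (x :* p) :+ t :* (t :* q)) :+ (x :* t :+ e) :* (p :+ q)) refl x t e p q ⟩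
      (x * (x * p) + t * (t * q)) + (x * t + e) * (p + q)
        ≈⟨ +-congˡ (trans (*-congʳ (trans (+-congʳ xt≈1) 1+e≈0)) (zeroˡ _)) ⟩
      (x * (x * p) + t * (t * q)) + 0#                 ≈⟨ +-identityʳ _ ⟩
      x * (x * p) + t * (t * q)                        ∎)
      where
      p = x ^ suc m
      q = t ^ suc m

-- Transcendence of x + 1/x.

-- If B v ≈ x for a uniformiser x of A with residue ring k and a unit B at its
-- place, then Bⁿ p(v), where n is the length of p, has the constant coefficient
-- of p as its residue.

module Transcendence {k : CommutativeRing a ℓ} {A : CommutativeRing b ℓ₁} {S : CommutativeRing c ℓ₂}
                     (ι : Hom k A) (residue : Hom A k) (θ : Hom A S) where
  open Polynomials k
  private
    module k = CommutativeRing k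
    module A = CommutativeRing A
    module S = CommutativeRing S
    module ι = Hom ι
    module ρ = Hom residue
    module θ = Hom θ
  open Exp A.semiring using (_^_)

  module _ (residue-ι : ∀ r → ρ.⟦ ι.⟦ r ⟧ ⟧ k.≈ r)
           (θ-injective : ∀ z → θ.⟦ z ⟧ S.≈ S.0# → z A.≈ A.0#)
           {x B : A.Carrier} (residue-x : ρ.⟦ x ⟧ k.≈ k.0#) (residue-B : ρ.⟦ B ⟧ k.≈ k.1#)
           (x-cancel : ∀ z → x A.* z A.≈ A.0# → z A.≈ A.0#)
           {v : S.Carrier} (Bv≈x : θ.⟦ B ⟧ S.* v S.≈ θ.⟦ x ⟧) where

    -- Horner's scheme for Bⁿ p(v) with each B v replaced by x. The value thus stays in A, where the
    -- residue is defined, although v lies only in S.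
    homogenise : Poly → A.Carrier
    homogenise []      = A.0#
    homogenise (r ∷ p) = ι.⟦ r ⟧ A.* B ^ suc (length p) A.+ x A.* homogenise p

    homogenise-char : ∀ p → θ.⟦ homogenise p ⟧ S.≈ θ.⟦ B ^ length p ⟧ S.* eval S (θ ∘ʰ ι) v p
    homogenise-char []      = S.trans θ.0#-homo (S.sym (S.zeroʳ _))
    homogenise-char (r ∷ p) = begin
      θ.⟦ ι.⟦ r ⟧ A.* B ^ suc (length p) A.+ x A.* homogenise p ⟧
        ≈⟨ θ.+-homo _ _ ⟩
      θ.⟦ ι.⟦ r ⟧ A.* B ^ suc (length p) ⟧ S.+ θ.⟦ x A.* homogenise p ⟧
        ≈⟨ S.+-cong (S.trans (θ.*-homo _ _) (S.*-congˡ (θ.*-homo _ _))) (S.trans (θ.*-homo _ _)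
             (S.*-cong (S.sym Bv≈x) (homogenise-char p))) ⟩
      r′ S.* (B′ S.* Bⁿ) S.+ B′ S.* v S.* (Bⁿ S.* e)
        ≈⟨ solve 5 (λ r b c v e → r :* (b :* c) :+ b :* v :* (c :* e) := b :* c :* (r :+ v :* e)) S.refl r′ B′ Bⁿ v e ⟩
      B′ S.* Bⁿ S.* (r′ S.+ v S.* e)
        ≈⟨ S.*-congʳ (θ.*-homo _ _) ⟨
      θ.⟦ B ^ suc (length p) ⟧ S.* (r′ S.+ v S.* e) ∎
      where
      open SetoidReasoning S.setoid
      open RingLemmas S
      r′ = θ.⟦ ι.⟦ r ⟧ ⟧
      B′ = θ.⟦ B ⟧
      Bⁿ = θ.⟦ B ^ length p ⟧
      e  = eval S (θ ∘ʰ ι) v p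

    residue-B^ : ∀ n → ρ.⟦ B ^ n ⟧ k.≈ k.1#
    residue-B^ zero    = ρ.1#-homo
    residue-B^ (suc n) = k.trans (ρ.*-homo B _) (k.trans (k.*-cong residue-B (residue-B^ n)) (k.*-identityˡ _))

    -- The residue kills the multiple of x and sends the powers of B to 1, so the constant
    -- coefficient is zero; cancelling x leaves the same situation for the tail.
    homogenise≈0 : ∀ p → homogenise p A.≈ A.0# → p ≈ₚ []
    homogenise≈0 []      e = ≈ₚ.refl
    homogenise≈0 (r ∷ p) e = ≈ₚ.trans (∷-cong r≈0 (homogenise≈0 p (x-cancel _ xq≈0))) 0∷0≈0
      where
      Bⁿ = B ^ suc (length p)
      r≈0 : r k.≈ k.0#
      r≈0 = begin
        r                                                        ≈⟨ k.*-identityʳ r ⟨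
        r k.* k.1#                                               ≈⟨ k.+-identityʳ _ ⟨
        r k.* k.1# k.+ k.0#                                      ≈⟨ k.+-cong (k.*-cong (residue-ι r) (residue-B^ (suc (length p)))) (k.zeroˡ _) ⟨
        ρ.⟦ ι.⟦ r ⟧ ⟧ k.* ρ.⟦ Bⁿ ⟧ k.+ k.0# k.* ρ.⟦ homogenise p ⟧ ≈⟨ k.+-cong (ρ.*-homo _ _) (k.*-congʳ residue-x) ⟨
        ρ.⟦ ι.⟦ r ⟧ A.* Bⁿ ⟧ k.+ ρ.⟦ x ⟧ k.* ρ.⟦ homogenise p ⟧   ≈⟨ k.+-congˡ (ρ.*-homo _ _) ⟨
        ρ.⟦ ι.⟦ r ⟧ A.* Bⁿ ⟧ k.+ ρ.⟦ x A.* homogenise p ⟧         ≈⟨ ρ.+-homo _ _ ⟨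
        ρ.⟦ homogenise (r ∷ p) ⟧                                 ≈⟨ ρ.⟦⟧-cong e ⟩
        ρ.⟦ A.0# ⟧                                               ≈⟨ ρ.0#-homo ⟩
        k.0#                                                     ∎
        where
        open SetoidReasoning k.setoid
      xq≈0 : x A.* homogenise p A.≈ A.0#
      xq≈0 = begin
        x A.* homogenise p                      ≈⟨ A.+-identityˡ _ ⟨
        A.0# A.+ x A.* homogenise p             ≈⟨ A.+-congʳ (A.zeroˡ Bⁿ) ⟨
        A.0# A.* Bⁿ A.+ x A.* homogenise p      ≈⟨ A.+-congʳ (A.*-congʳ (A.trans (ι.⟦⟧-cong r≈0) ι.0#-homo)) ⟨
        homogenise (r ∷ p)                      ≈⟨ e ⟩
        A.0#                                    ∎
        where
        open SetoidReasoning A.setoid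

    transcendental : ∀ p → eval S (θ ∘ʰ ι) v p S.≈ S.0# → p ≈ₚ []
    transcendental p e = homogenise≈0 p (θ-injective _
      (S.trans (homogenise-char p) (S.trans (S.*-congˡ e) (S.zeroʳ _))))

  module _ (residue-ι : ∀ r → ρ.⟦ ι.⟦ r ⟧ ⟧ k.≈ r)
           (θ-injective : ∀ z → θ.⟦ z ⟧ S.≈ S.0# → z A.≈ A.0#)
           {x : A.Carrier} (residue-x : ρ.⟦ x ⟧ k.≈ k.0#) (x-cancel : ∀ z → x A.* z A.≈ A.0# → z A.≈ A.0#)
           {u : S.Carrier} (xu≈1 : θ.⟦ x ⟧ S.* u S.≈ S.1#) where
    private
      w = θ.⟦ x ⟧ S.+ u
      -- Since x w = 1 + x², this B gives B v = x for v = 1/w, and its residue at x = 0 is 1.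
      B = A.1# A.+ x A.* x

      residue-B : ρ.⟦ B ⟧ k.≈ k.1#
      residue-B = k.trans (ρ.+-homo A.1# _) (k.trans (k.+-cong ρ.1#-homo
        (k.trans (ρ.*-homo x x) (k.trans (k.*-congʳ residue-x) (k.zeroˡ _)))) (k.+-identityʳ _))

      B≈xw : θ.⟦ B ⟧ S.≈ θ.⟦ x ⟧ S.* w
      B≈xw = begin
        θ.⟦ B ⟧                                   ≈⟨ θ.+-homo A.1# _ ⟩
        θ.⟦ A.1# ⟧ S.+ θ.⟦ x A.* x ⟧              ≈⟨ S.+-cong θ.1#-homo (θ.*-homo x x) ⟩
        S.1# S.+ θ.⟦ x ⟧ S.* θ.⟦ x ⟧              ≈⟨ S.+-congʳ xu≈1 ⟨
        θ.⟦ x ⟧ S.* u S.+ θ.⟦ x ⟧ S.* θ.⟦ x ⟧     ≈⟨ S.+-comm _ _ ⟩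
        θ.⟦ x ⟧ S.* θ.⟦ x ⟧ S.+ θ.⟦ x ⟧ S.* u     ≈⟨ S.distribˡ _ _ _ ⟨
        θ.⟦ x ⟧ S.* w                             ∎
        where
        open SetoidReasoning S.setoid

    x+1/x≉0 : ¬ k.1# k.≈ k.0# → ¬ w S.≈ S.0#
    x+1/x≉0 1≉0 w≈0 = 1≉0 (k.trans (k.sym residue-B) (k.trans (ρ.⟦⟧-cong B≈0) ρ.0#-homo))
      where
      B≈0 : B A.≈ A.0#
      B≈0 = θ-injective B (S.trans B≈xw (S.trans (S.*-congˡ w≈0) (S.zeroʳ _)))

    -- As w has a pole at x = 0, the residue argument is run for v = 1/w, which vanishes there, and
    -- then carried over to the inverse.
    x+1/x-transcendental : ∀ {v} → w S.* v S.≈ S.1# → ∀ p → eval S (θ ∘ʰ ι) w p S.≈ S.0# → p ≈ₚ []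
    x+1/x-transcendental {v} wv≈1 = transcendental-inverse S (θ ∘ʰ ι) v w (S.trans (S.*-comm v w) wv≈1)
      (transcendental residue-ι θ-injective residue-x residue-B x-cancel
        (S.trans (S.*-congʳ B≈xw) (S.trans (S.*-assoc _ _ _) (S.trans (S.*-congˡ wv≈1) (S.*-identityʳ _)))))

-- Dickson polynomials and the element w over the field k.

module _ (k : Field a ℓ) where
  open Curves k
  private
    module k = Field k

  dicksonCoeff≡ : ∀ j i → dicksonCoeff (i ℕ.+ suc j) i ≡ binomialPair j i
  -- Abstracting the difference lets the `with` inside `dicksonCoeff` reduce to its successor
  -- branch.
  dicksonCoeff≡ j i with i ℕ.+ suc j ∸ i | ℕ.m+n∸m≡n i (suc j)
  ... | _ | ≡.refl = binomialPair-quotient j i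

  private
    module DT = DicksonTerms polyRing dicksonCoeff dicksonCoeff≡

  module _ (S : CommutativeRing b ℓ₁) (θ : Hom polyRing S) where
    private
      module S = CommutativeRing S
      module θ = Hom θ
    open Exp S.semiring using (_^_)
    open Multiples S.semiring using () renaming (_×_ to _·_)

    -- Positivity of m matters: `dicksonCoeff 0 0` is 0, whereas x⁰ + t⁰ = 2.
    dickson-functional : ∀ {x t} → x S.* t S.≈ S.1# → θ.⟦ X ⟧ S.≈ x S.+ t →
                         ∀ {m} → 0 ℕ.< m → θ.⟦ D m ⟧ S.≈ x ^ m S.+ t ^ m
    dickson-functional {x} {t} xt≈1 θX≈w {suc m} _ = dickson-sequence S xt≈1 1+e≈0 (λ m → θ.⟦ D m ⟧)
      (S.trans (θ.⟦⟧-cong (DT.dicksonSum-1 ε X)) θX≈w)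
      (S.trans (θ.⟦⟧-cong (DT.dicksonSum-2 ε X)) (S.trans (θ.+-homo (X *ₚ X) (ε +ₚ ε))
        (S.+-cong (S.trans (θ.*-homo X X) (S.*-cong θX≈w θX≈w)) (θ.+-homo ε ε))))
      (λ m → S.trans (θ.⟦⟧-cong (DT.dicksonSum-recurrence ε X m))
        (S.trans (θ.+-homo (X *ₚ D (2 ℕ.+ m)) (ε *ₚ D (1 ℕ.+ m)))
          (S.+-cong (S.trans (θ.*-homo X (D (2 ℕ.+ m))) (S.*-congʳ θX≈w)) (θ.*-homo ε (D (1 ℕ.+ m))))))
      m
      where
      ε = const (k.- k.1#)
      1+e≈0 : S.1# S.+ θ.⟦ ε ⟧ S.≈ S.0#
      1+e≈0 = S.trans (S.+-congʳ (S.sym θ.1#-homo)) (S.trans (S.sym (θ.+-homo (const k.1#) ε))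
        (S.trans (θ.⟦⟧-cong (k[x].-‿inverseʳ (const k.1#))) θ.0#-homo))

    hom-numeral : ∀ n → θ.⟦ numeral n ⟧ S.≈ n · S.1#
    hom-numeral zero    = θ.0#-homo
    hom-numeral (suc n) = S.trans (θ.+-homo (const k.1#) (numeral n)) (S.+-cong θ.1#-homo (hom-numeral n))

  private
    module K = k⟨x⟩

  κ : Hom k.commutativeRing F.fractionRing
  κ = F.embedHom ∘ʰ constHom

  x̃ w : K.Carrier
  x̃ = F.embed X
  w = x̃ K.+ 1/X

  -- The residue map at the place x = 0.
  evalAtZero : Hom polyRing k.commutativeRing
  evalAtZero = evalHom k.commutativeRing (makeHom k.commutativeRing k.commutativeRing id id (λ _ _ → k.refl) (λ _ _ → k.refl) k.refl) k.0#

  private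
    module ev₀ = Hom evalAtZero

    ev₀-X : ev₀.⟦ X ⟧ k.≈ k.0#
    ev₀-X = k.trans (k.+-identityˡ _) (k.zeroˡ _)

    ev₀-const : ∀ r → ev₀.⟦ const r ⟧ k.≈ r
    ev₀-const r = k.trans (k.+-congˡ (k.zeroˡ _)) (k.+-identityʳ r)

    X-cancel : ∀ p → X *ₚ p ≈ₚ [] → p ≈ₚ []
    X-cancel p e with noZeroDivisors-poly k X p e
    ... | inj₁ X≈0 = ⊥-elim (k.1≉0 (coeff-≈ X≈0 1))
    ... | inj₂ p≈0 = p≈0

  w-transcendental : ∀ p → eval F.fractionRing κ w p K.≈ K.0# → p ≈ₚ []
  w-transcendental = x+1/x-transcendental ev₀-const F.embed-injective {X} ev₀-X X-cancel {1/X} (proj₂ X-invertible)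
    {proj₁ w-invertible} (proj₂ w-invertible)
    where
    open Transcendence constHom evalAtZero F.embedHom
    w-invertible = K.inverse w (x+1/x≉0 ev₀-const F.embed-injective {X} ev₀-X X-cancel {1/X} (proj₂ X-invertible) k.1≉0)

-- Cancellation of units and injectivity of homomorphisms from fields.

module _ (R : CommutativeRing a ℓ) where
  open CommutativeRing R
  open RingLemmas R
  open SetoidReasoning setoid

  unit-cancel : ∀ {s} → Invertible R s → ∀ x y → x * s ≈ y * s → x ≈ y
  unit-cancel {s} (s⁻¹ , ss⁻¹≈1) x y e = begin
    x              ≈⟨ *-identityʳ x ⟨
    x * 1#         ≈⟨ *-congˡ ss⁻¹≈1 ⟨
    x * (s * s⁻¹)  ≈⟨ *-assoc x s s⁻¹ ⟨
    x * s * s⁻¹    ≈⟨ *-congʳ e ⟩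
    y * s * s⁻¹    ≈⟨ *-assoc y s s⁻¹ ⟩
    y * (s * s⁻¹)  ≈⟨ *-congˡ ss⁻¹≈1 ⟩
    y * 1#         ≈⟨ *-identityʳ y ⟩
    y              ∎

  inverse-unique : ∀ {s t t′} → s * t ≈ 1# → s * t′ ≈ 1# → t ≈ t′
  inverse-unique {s} {t} {t′} st≈1 st′≈1 = unit-cancel (t , st≈1) t t′
    (trans (*-comm t s) (trans st≈1 (trans (sym st′≈1) (*-comm s t′))))

module _ (K : Field a ℓ) where
  open Field K

  field-cancel : ∀ {s} → ¬ s ≈ 0# → ∀ x y → x * s ≈ y * s → x ≈ y
  field-cancel {s} s≉0 = unit-cancel commutativeRing (inverse s s≉0)

  equal-multiples : ∀ {x y} → ¬ x ≈ y → ∀ s → x * s ≈ y * s → s ≈ 0#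
  equal-multiples {x} {y} x≉y s e with s ≟ 0#
  ... | yes s≈0 = s≈0
  ... | no  s≉0 = ⊥-elim (x≉y (field-cancel s≉0 x y e))

  field-hom-injective : (S : CommutativeRing b ℓ₁) → ¬ CommutativeRing._≈_ S (CommutativeRing.1# S) (CommutativeRing.0# S) →
    (φ : Hom commutativeRing S) → ∀ x y → CommutativeRing._≈_ S (Hom.⟦_⟧ φ x) (Hom.⟦_⟧ φ y) → x ≈ y
  field-hom-injective S 1≉0′ φ x y e with (x + - y) ≟ 0#
  ... | yes d≈0 = RingLemmas.x-y≈0⇒x≈y commutativeRing x y d≈0
  ... | no  d≉0 with inverse (x + - y) d≉0
  ...   | z , dz≈1 = ⊥-elim (1≉0′ (S.trans (S.sym φ.1#-homo) (S.trans (φ.⟦⟧-cong (sym dz≈1))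
    (S.trans (φ.*-homo _ _) (S.trans (S.*-congʳ φd≈0) (S.zeroˡ _))))))
    where
    module S = CommutativeRing S
    module φ = Hom φ
    φd≈0 : φ.⟦ x + - y ⟧ S.≈ S.0#
    φd≈0 = S.trans (φ.+-homo x (- y)) (S.trans (S.+-cong e (φ.-‿homo y)) (S.-‿inverseʳ _))

-- Descent along the degree-two extension generated by x.

-- Galois descent for K(y) over ψ(K₁)(V), where K = K₁(x) with x a root of
-- T² - (x + u) T + 1, σ is the automorphism x ↦ u = 1/x, and V = r y is σ-invariant.

module Descent
  {K₁ : Field a ℓ} {K : Field b ℓ₁} {M : CommutativeRing a ℓ₂} {L : CommutativeRing c ℓ₃}
  (ρ : Hom (Field.commutativeRing K₁) (Field.commutativeRing K))
  (j : Hom (Field.commutativeRing K₁) M)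
  (i : Hom (Field.commutativeRing K) L)
  (ψ : Hom M L) (σ : Hom L L)
  (η : CommutativeRing.Carrier M) (y : CommutativeRing.Carrier L)
  (W : Field.Carrier K₁) (x u r : Field.Carrier K)
  where
  private
    module K₁ = Field K₁
    module K = Field K
    module M = CommutativeRing M
    module L = CommutativeRing L
    module ρ = Hom ρ
    module j = Hom j
    module i = Hom i
    module ψ = Hom ψ
    module σ = Hom σ

  -- That all of K has this form says that K has degree at most 2 over ρ(K₁). Closure under products
  -- and quotients reduces this to constants and x.
  IsLinear : K.Carrier → Set _
  IsLinear z = ∃[ a ] ∃[ b ] z K.≈ ρ.⟦ a ⟧ K.+ ρ.⟦ b ⟧ K.* x

  IsLinear-resp : ∀ {z w} → z K.≈ w → IsLinear z → IsLinear w
  IsLinear-resp z≈w (a , b , e) = a , b , K.trans (K.sym z≈w) e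

  IsLinear-base : ∀ a → IsLinear ρ.⟦ a ⟧
  IsLinear-base a = a , K₁.0# , K.sym (K.trans (K.+-congˡ (K.trans (K.*-congʳ ρ.0#-homo) (K.zeroˡ x))) (K.+-identityʳ _))

  IsLinear-x : IsLinear x
  IsLinear-x = K₁.0# , K₁.1# , K.sym (K.trans (K.+-cong ρ.0#-homo (K.trans (K.*-congʳ ρ.1#-homo) (K.*-identityˡ x))) (K.+-identityˡ x))

  IsLinear-+ : ∀ {z w} → IsLinear z → IsLinear w → IsLinear (z K.+ w)
  IsLinear-+ (a , b , e) (a′ , b′ , e′) = a K₁.+ a′ , b K₁.+ b′ , K.trans (K.+-cong e e′)
    (K.trans (solve 5 (λ a b a′ b′ x → (a :+ b :* x) :+ (a′ :+ b′ :* x) := (a :+ a′) :+ (b :+ b′) :* x)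
      K.refl ρ.⟦ a ⟧ ρ.⟦ b ⟧ ρ.⟦ a′ ⟧ ρ.⟦ b′ ⟧ x) (K.sym (K.+-cong (ρ.+-homo _ _) (K.*-congʳ (ρ.+-homo _ _)))))
    where
    open RingLemmas K.commutativeRing

  module _ (xu≈1 : x K.* u K.≈ K.1#) (ρW≈x+u : ρ.⟦ W ⟧ K.≈ x K.+ u) where

    -- The relation x² = W x - 1 removes the square.
    IsLinear-* : ∀ {z w} → IsLinear z → IsLinear w → IsLinear (z K.* w)
    IsLinear-* {z} {w} (a , b , e) (a′ , b′ , e′) = re , im , (begin
      z K.* w
        ≈⟨ K.*-cong e e′ ⟩
      (A K.+ B K.* x) K.* (A′ K.+ B′ K.* x)
        ≈⟨ K.+-identityʳ _ ⟨
      (A K.+ B K.* x) K.* (A′ K.+ B′ K.* x) K.+ K.0#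
        -- Zero is added as B B′ x u - B B′: the first part completes B B′ x² to B B′ (x + u) x, the
        -- second is an atom for the semiring solver.
        ≈⟨ K.+-congˡ (K.trans (K.sym (K.-‿inverseʳ _)) (K.+-congʳ (K.trans (K.sym (K.*-identityʳ _)) (K.*-congˡ (K.sym xu≈1))))) ⟩
      (A K.+ B K.* x) K.* (A′ K.+ B′ K.* x) K.+ ((B K.* B′) K.* (x K.* u) K.+ K.- (B K.* B′))
        ≈⟨ solve 7 (λ A B A′ B′ x u n → (A :+ B :* x) :* (A′ :+ B′ :* x) :+ ((B :* B′) :* (x :* u) :+ n) :=
             (A :* A′ :+ n) :+ (A :* B′ :+ B :* A′ :+ B :* B′ :* (x :+ u)) :* x)
             K.refl A B A′ B′ x u (K.- (B K.* B′)) ⟩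
      (A K.* A′ K.+ K.- (B K.* B′)) K.+ (A K.* B′ K.+ B K.* A′ K.+ B K.* B′ K.* (x K.+ u)) K.* x
        ≈⟨ K.+-cong ρ-re (K.*-congʳ ρ-im) ⟨
      ρ.⟦ re ⟧ K.+ ρ.⟦ im ⟧ K.* x ∎)
      where
      open RingLemmas K.commutativeRing
      open SetoidReasoning K.setoid
      A = ρ.⟦ a ⟧
      B = ρ.⟦ b ⟧
      A′ = ρ.⟦ a′ ⟧
      B′ = ρ.⟦ b′ ⟧
      re = a K₁.* a′ K₁.+ K₁.- (b K₁.* b′)
      im = a K₁.* b′ K₁.+ b K₁.* a′ K₁.+ b K₁.* b′ K₁.* W
      ρ-re : ρ.⟦ re ⟧ K.≈ A K.* A′ K.+ K.- (B K.* B′)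
      ρ-re = K.trans (ρ.+-homo _ _) (K.+-cong (ρ.*-homo a a′) (K.trans (ρ.-‿homo _) (K.-‿cong (ρ.*-homo b b′))))
      ρ-im : ρ.⟦ im ⟧ K.≈ A K.* B′ K.+ B K.* A′ K.+ B K.* B′ K.* (x K.+ u)
      ρ-im = K.trans (ρ.+-homo _ _) (K.+-cong
        (K.trans (ρ.+-homo _ _) (K.+-cong (ρ.*-homo a b′) (ρ.*-homo b a′)))
        (K.trans (ρ.*-homo _ _) (K.*-cong (ρ.*-homo b b′) ρW≈x+u)))

    module _ (ψj≈iρ : ∀ a → ψ.⟦ j.⟦ a ⟧ ⟧ L.≈ i.⟦ ρ.⟦ a ⟧ ⟧)
             (ψη≈ry : ψ.⟦ η ⟧ L.≈ i.⟦ r ⟧ L.* y) (r≉0 : ¬ r K.≈ K.0#)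
             (L-independent : ∀ s t s′ t′ → i.⟦ s ⟧ L.+ i.⟦ t ⟧ L.* y L.≈ i.⟦ s′ ⟧ L.+ i.⟦ t′ ⟧ L.* y → s K.≈ s′ × t K.≈ t′)
             (M-decompose : ∀ m → ∃[ a ] ∃[ b ] m M.≈ j.⟦ a ⟧ M.+ j.⟦ b ⟧ M.* η)
             where

      ψ-linear : ∀ a b → ψ.⟦ j.⟦ a ⟧ M.+ j.⟦ b ⟧ M.* η ⟧ L.≈ i.⟦ ρ.⟦ a ⟧ ⟧ L.+ i.⟦ ρ.⟦ b ⟧ K.* r ⟧ L.* y
      ψ-linear a b = begin
        ψ.⟦ j.⟦ a ⟧ M.+ j.⟦ b ⟧ M.* η ⟧                     ≈⟨ ψ.+-homo _ _ ⟩
        ψ.⟦ j.⟦ a ⟧ ⟧ L.+ ψ.⟦ j.⟦ b ⟧ M.* η ⟧               ≈⟨ L.+-cong (ψj≈iρ a) (L.trans (ψ.*-homo _ _) (L.*-cong (ψj≈iρ b) ψη≈ry)) ⟩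
        i.⟦ ρ.⟦ a ⟧ ⟧ L.+ i.⟦ ρ.⟦ b ⟧ ⟧ L.* (i.⟦ r ⟧ L.* y) ≈⟨ L.+-congˡ (L.*-assoc _ _ _) ⟨
        i.⟦ ρ.⟦ a ⟧ ⟧ L.+ i.⟦ ρ.⟦ b ⟧ ⟧ L.* i.⟦ r ⟧ L.* y   ≈⟨ L.+-congˡ (L.*-congʳ (i.*-homo _ _)) ⟨
        i.⟦ ρ.⟦ a ⟧ ⟧ L.+ i.⟦ ρ.⟦ b ⟧ K.* r ⟧ L.* y         ∎
        where
        open SetoidReasoning L.setoid

      ρ-injective : ∀ a b → ρ.⟦ a ⟧ K.≈ ρ.⟦ b ⟧ → a K₁.≈ b
      ρ-injective = field-hom-injective K₁ K.commutativeRing K.1≉0 ρ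

      -- In coordinates with respect to 1 and y, ψ is (a , b) ↦ (ρ a , ρ b · r); each entry is
      -- injective because ρ is and r ≠ 0.
      ψ-injective : ∀ {m m′} → ψ.⟦ m ⟧ L.≈ ψ.⟦ m′ ⟧ → m M.≈ m′
      ψ-injective {m} {m′} e with M-decompose m | M-decompose m′
      ... | a , b , m≈ | a′ , b′ , m′≈ with L-independent ρ.⟦ a ⟧ (ρ.⟦ b ⟧ K.* r) ρ.⟦ a′ ⟧ (ρ.⟦ b′ ⟧ K.* r)
        (L.trans (L.sym (ψ-linear a b)) (L.trans (ψ.⟦⟧-cong (M.sym m≈)) (L.trans e (L.trans (ψ.⟦⟧-cong m′≈) (ψ-linear a′ b′)))))
      ...   | ρa≈ρa′ , ρbr≈ρb′r = M.trans m≈ (M.trans (M.+-cong (j.⟦⟧-cong (ρ-injective a a′ ρa≈ρa′))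
                (M.*-congʳ (j.⟦⟧-cong (ρ-injective b b′ (field-cancel K r≉0 _ _ ρbr≈ρb′r))))) (M.sym m′≈))

      module _ (σψ≈ψ : ∀ m → σ.⟦ ψ.⟦ m ⟧ ⟧ L.≈ ψ.⟦ m ⟧) (σx≈u : σ.⟦ i.⟦ x ⟧ ⟧ L.≈ i.⟦ u ⟧) where

        σρ≈ρ : ∀ a → σ.⟦ i.⟦ ρ.⟦ a ⟧ ⟧ ⟧ L.≈ i.⟦ ρ.⟦ a ⟧ ⟧
        σρ≈ρ a = L.trans (σ.⟦⟧-cong (L.sym (ψj≈iρ a))) (L.trans (σψ≈ψ _) (ψj≈iρ a))

        i-injective : ∀ s t → i.⟦ s ⟧ L.≈ i.⟦ t ⟧ → s K.≈ t
        i-injective s t e = proj₁ (L-independent s K.0# t K.0# (L.+-congʳ e))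

        -- σ is given on L only, but on linear elements its effect can be written inside K, as the
        -- exchange of x for u.
        conjugate : ∀ a b → σ.⟦ i.⟦ ρ.⟦ a ⟧ K.+ ρ.⟦ b ⟧ K.* x ⟧ ⟧ L.≈ i.⟦ ρ.⟦ a ⟧ K.+ ρ.⟦ b ⟧ K.* u ⟧
        conjugate a b = begin
          σ.⟦ i.⟦ ρ.⟦ a ⟧ K.+ ρ.⟦ b ⟧ K.* x ⟧ ⟧                    ≈⟨ σ.⟦⟧-cong (L.trans (i.+-homo _ _) (L.+-congˡ (i.*-homo _ _))) ⟩
          σ.⟦ i.⟦ ρ.⟦ a ⟧ ⟧ L.+ i.⟦ ρ.⟦ b ⟧ ⟧ L.* i.⟦ x ⟧ ⟧        ≈⟨ L.trans (σ.+-homo _ _) (L.+-congˡ (σ.*-homo _ _)) ⟩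
          σ.⟦ i.⟦ ρ.⟦ a ⟧ ⟧ ⟧ L.+ σ.⟦ i.⟦ ρ.⟦ b ⟧ ⟧ ⟧ L.* σ.⟦ i.⟦ x ⟧ ⟧ ≈⟨ L.+-cong (σρ≈ρ a) (L.*-cong (σρ≈ρ b) σx≈u) ⟩
          i.⟦ ρ.⟦ a ⟧ ⟧ L.+ i.⟦ ρ.⟦ b ⟧ ⟧ L.* i.⟦ u ⟧              ≈⟨ L.trans (i.+-homo _ _) (L.+-congˡ (i.*-homo _ _)) ⟨
          i.⟦ ρ.⟦ a ⟧ K.+ ρ.⟦ b ⟧ K.* u ⟧                          ∎
          where
          open SetoidReasoning L.setoid

        -- n / d = n d̄ / N(d), where d̄ = σ(d) and N(d) = d d̄.

        IsLinear-/ : ∀ {z n d} → ¬ d K.≈ K.0# → z K.* d K.≈ n → IsLinear n → IsLinear d → IsLinear z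
        IsLinear-/ {z} {n} {d} d≉0 zd≈n n-linear (a , b , d≈) =
          IsLinear-resp z≈ (IsLinear-* (IsLinear-* n-linear d̄-linear) (IsLinear-base N⁻¹))
          where
          open RingLemmas K.commutativeRing
          open SetoidReasoning K.setoid
          A = ρ.⟦ a ⟧
          B = ρ.⟦ b ⟧
          d̄ = A K.+ B K.* u
          N = a K₁.* a K₁.+ a K₁.* b K₁.* W K₁.+ b K₁.* b
          ρN≈dd̄ : ρ.⟦ N ⟧ K.≈ d K.* d̄
          ρN≈dd̄ = begin
            ρ.⟦ N ⟧
              ≈⟨ K.trans (ρ.+-homo _ _) (K.+-cong (K.trans (ρ.+-homo _ _) (K.+-cong (ρ.*-homo a a)
                   (K.trans (ρ.*-homo _ _) (K.*-cong (ρ.*-homo a b) ρW≈x+u)))) (ρ.*-homo b b)) ⟩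
            A K.* A K.+ A K.* B K.* (x K.+ u) K.+ B K.* B
              ≈⟨ K.+-congˡ (K.trans (K.sym (K.*-identityʳ _)) (K.*-congˡ (K.sym xu≈1))) ⟩
            A K.* A K.+ A K.* B K.* (x K.+ u) K.+ B K.* B K.* (x K.* u)
              ≈⟨ solve 4 (λ A B x u → A :* A :+ A :* B :* (x :+ u) :+ B :* B :* (x :* u) :=
                   (A :+ B :* x) :* (A :+ B :* u)) K.refl A B x u ⟩
            (A K.+ B K.* x) K.* d̄
              ≈⟨ K.*-congʳ d≈ ⟨
            d K.* d̄ ∎
          d̄-linear : IsLinear d̄
          -- From u = W - x.
          d̄-linear = a K₁.+ b K₁.* W , K₁.- b , (begin
            A K.+ B K.* u                                    ≈⟨ K.+-identityʳ _ ⟨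
            A K.+ B K.* u K.+ K.0#                           ≈⟨ K.+-congˡ (K.trans (K.*-congʳ (K.-‿inverseʳ B)) (K.zeroˡ x)) ⟨
            A K.+ B K.* u K.+ (B K.+ K.- B) K.* x            ≈⟨ solve 5 (λ A B n x u → A :+ B :* u :+ (B :+ n) :* x :=
                                                                  (A :+ B :* (x :+ u)) :+ n :* x) K.refl A B (K.- B) x u ⟩
            (A K.+ B K.* (x K.+ u)) K.+ K.- B K.* x          ≈⟨ K.+-cong (K.trans (ρ.+-homo _ _) (K.+-congˡ (K.trans (ρ.*-homo _ _) (K.*-congˡ ρW≈x+u))))
                                                                         (K.*-congʳ (ρ.-‿homo b)) ⟨
            ρ.⟦ a K₁.+ b K₁.* W ⟧ K.+ ρ.⟦ K₁.- b ⟧ K.* x     ∎)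
          d-inverse = K.inverse d d≉0
          e = proj₁ d-inverse
          N≉0 : ¬ N K₁.≈ K₁.0#
          -- If d d̄ = 0 then d̄ = 0, as d ≠ 0. But d̄ is σ(d) in L, and σ sends the inverse of d to
          -- an inverse of σ(d).
          N≉0 N≈0 = K.1≉0 (i-injective K.1# K.0# (L.trans (L.sym σde≈1) (L.trans (L.*-congʳ σd≈0) (L.trans (L.zeroˡ _) (L.sym i.0#-homo)))))
            where
            dd̄≈0 : d K.* d̄ K.≈ K.0#
            dd̄≈0 = K.trans (K.sym ρN≈dd̄) (K.trans (ρ.⟦⟧-cong N≈0) ρ.0#-homo)
            d̄≈0 : d̄ K.≈ K.0#
            d̄≈0 = field-cancel K d≉0 d̄ K.0# (K.trans (K.*-comm d̄ d) (K.trans dd̄≈0 (K.sym (K.zeroˡ d))))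
            σd≈0 : σ.⟦ i.⟦ d ⟧ ⟧ L.≈ L.0#
            σd≈0 = L.trans (σ.⟦⟧-cong (i.⟦⟧-cong d≈)) (L.trans (conjugate a b) (L.trans (i.⟦⟧-cong d̄≈0) i.0#-homo))
            σde≈1 : σ.⟦ i.⟦ d ⟧ ⟧ L.* σ.⟦ i.⟦ e ⟧ ⟧ L.≈ i.⟦ K.1# ⟧
            σde≈1 = L.trans (L.sym (σ.*-homo _ _)) (L.trans (σ.⟦⟧-cong (L.trans (L.sym (i.*-homo d e))
              (L.trans (i.⟦⟧-cong (proj₂ d-inverse)) i.1#-homo))) (L.trans σ.1#-homo (L.sym i.1#-homo)))
          N-inverse = K₁.inverse N N≉0
          N⁻¹ = proj₁ N-inverse
          z≈ : n K.* d̄ K.* ρ.⟦ N⁻¹ ⟧ K.≈ z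
          z≈ = begin
            n K.* d̄ K.* ρ.⟦ N⁻¹ ⟧              ≈⟨ K.*-congʳ (K.*-congʳ zd≈n) ⟨
            z K.* d K.* d̄ K.* ρ.⟦ N⁻¹ ⟧        ≈⟨ solve 4 (λ z d d̄ n → z :* d :* d̄ :* n := z :* (d :* d̄ :* n)) K.refl z d d̄ ρ.⟦ N⁻¹ ⟧ ⟩
            z K.* (d K.* d̄ K.* ρ.⟦ N⁻¹ ⟧)      ≈⟨ K.*-congˡ (K.trans (K.*-congʳ (K.sym ρN≈dd̄)) (hom-inverse ρ (proj₂ N-inverse))) ⟩
            z K.* K.1#                         ≈⟨ K.*-identityʳ z ⟩
            z                                  ∎

        module _ (x≉u : ¬ x K.≈ u)
                 (L-decompose : ∀ z → ∃[ s ] ∃[ t ] z L.≈ i.⟦ s ⟧ L.+ i.⟦ t ⟧ L.* y)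
                 (linear : ∀ z → IsLinear z) where

          -- Dividing the y-coordinate t by r expresses z through V = r y. Splitting s and t / r
          -- along 1 and x then gives z = m + x m′, and comparison with σ(z) = m + u m′ gives x m′ =
          -- u m′.
          ψ-surjective : ∀ z → σ.⟦ z ⟧ L.≈ z → ∃[ m ] ψ.⟦ m ⟧ L.≈ z
          ψ-surjective z σz≈z with L-decompose z | K.inverse r r≉0
          ... | s , t , z≈ | r′ , rr′≈1 with linear s | linear (t K.* r′)
          ...   | a , b , s≈ | a′ , b′ , tr′≈ = m , L.sym (L.trans z≈m+xm′
                    (L.trans (L.+-congˡ (L.trans (L.*-congˡ ψm′≈0) (L.zeroʳ _))) (L.+-identityʳ _)))
            where
            open SetoidReasoning L.setoid
            V = i.⟦ r ⟧ L.* y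
            m  = j.⟦ a ⟧ M.+ j.⟦ a′ ⟧ M.* η
            m′ = j.⟦ b ⟧ M.+ j.⟦ b′ ⟧ M.* η
            ψ≈ : ∀ c c′ → ψ.⟦ j.⟦ c ⟧ M.+ j.⟦ c′ ⟧ M.* η ⟧ L.≈ i.⟦ ρ.⟦ c ⟧ ⟧ L.+ i.⟦ ρ.⟦ c′ ⟧ ⟧ L.* V
            ψ≈ c c′ = L.trans (ψ.+-homo _ _) (L.+-cong (ψj≈iρ c) (L.trans (ψ.*-homo _ _) (L.*-cong (ψj≈iρ c′) ψη≈ry)))
            t≈ : t K.≈ (ρ.⟦ a′ ⟧ K.+ ρ.⟦ b′ ⟧ K.* x) K.* r
            t≈ = K.sym (K.trans (K.*-congʳ (K.sym tr′≈)) (K.trans (K.*-assoc t r′ r)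
              (K.trans (K.*-congˡ (K.trans (K.*-comm r′ r) rr′≈1)) (K.*-identityʳ t))))
            i-linear : ∀ c d → i.⟦ ρ.⟦ c ⟧ K.+ ρ.⟦ d ⟧ K.* x ⟧ L.≈ i.⟦ ρ.⟦ c ⟧ ⟧ L.+ i.⟦ ρ.⟦ d ⟧ ⟧ L.* i.⟦ x ⟧
            i-linear c d = L.trans (i.+-homo _ _) (L.+-congˡ (i.*-homo _ _))
            z≈m+xm′ : z L.≈ ψ.⟦ m ⟧ L.+ i.⟦ x ⟧ L.* ψ.⟦ m′ ⟧
            z≈m+xm′ = begin
              z
                ≈⟨ z≈ ⟩
              i.⟦ s ⟧ L.+ i.⟦ t ⟧ L.* y
                ≈⟨ L.+-cong (L.trans (i.⟦⟧-cong s≈) (i-linear a b))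
                     (L.*-congʳ (L.trans (i.⟦⟧-cong t≈) (L.trans (i.*-homo _ _) (L.*-congʳ (i-linear a′ b′))))) ⟩
              (i.⟦ ρ.⟦ a ⟧ ⟧ L.+ i.⟦ ρ.⟦ b ⟧ ⟧ L.* i.⟦ x ⟧) L.+ (i.⟦ ρ.⟦ a′ ⟧ ⟧ L.+ i.⟦ ρ.⟦ b′ ⟧ ⟧ L.* i.⟦ x ⟧) L.* i.⟦ r ⟧ L.* y
                ≈⟨ solve 7 (λ a b a′ b′ x r y → (a :+ b :* x) :+ (a′ :+ b′ :* x) :* r :* y :=
                     (a :+ a′ :* (r :* y)) :+ x :* (b :+ b′ :* (r :* y)))
                     L.refl i.⟦ ρ.⟦ a ⟧ ⟧ i.⟦ ρ.⟦ b ⟧ ⟧ i.⟦ ρ.⟦ a′ ⟧ ⟧ i.⟦ ρ.⟦ b′ ⟧ ⟧ i.⟦ x ⟧ i.⟦ r ⟧ y ⟩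
              (i.⟦ ρ.⟦ a ⟧ ⟧ L.+ i.⟦ ρ.⟦ a′ ⟧ ⟧ L.* V) L.+ i.⟦ x ⟧ L.* (i.⟦ ρ.⟦ b ⟧ ⟧ L.+ i.⟦ ρ.⟦ b′ ⟧ ⟧ L.* V)
                ≈⟨ L.+-cong (ψ≈ a a′) (L.*-congˡ (ψ≈ b b′)) ⟨
              ψ.⟦ m ⟧ L.+ i.⟦ x ⟧ L.* ψ.⟦ m′ ⟧ ∎
              where
              open RingLemmas L
            xm′≈um′ : i.⟦ x ⟧ L.* ψ.⟦ m′ ⟧ L.≈ i.⟦ u ⟧ L.* ψ.⟦ m′ ⟧
            xm′≈um′ = ∙-cancelˡ ψ.⟦ m ⟧ _ _ (begin
              ψ.⟦ m ⟧ L.+ i.⟦ x ⟧ L.* ψ.⟦ m′ ⟧                  ≈⟨ z≈m+xm′ ⟨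
              z                                                 ≈⟨ σz≈z ⟨
              σ.⟦ z ⟧                                           ≈⟨ σ.⟦⟧-cong z≈m+xm′ ⟩
              σ.⟦ ψ.⟦ m ⟧ L.+ i.⟦ x ⟧ L.* ψ.⟦ m′ ⟧ ⟧            ≈⟨ L.trans (σ.+-homo _ _) (L.+-cong (σψ≈ψ m) (L.trans (σ.*-homo _ _) (L.*-cong σx≈u (σψ≈ψ m′)))) ⟩
              ψ.⟦ m ⟧ L.+ i.⟦ u ⟧ L.* ψ.⟦ m′ ⟧                  ∎)
              where
              open GroupProperties L.+-group using (∙-cancelˡ)
            multiple : ∀ v → i.⟦ v ⟧ L.* ψ.⟦ m′ ⟧ L.≈ i.⟦ v K.* ρ.⟦ b ⟧ ⟧ L.+ i.⟦ v K.* (ρ.⟦ b′ ⟧ K.* r) ⟧ L.* y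
            multiple v = L.trans (L.*-congˡ (ψ-linear b b′)) (L.trans (L.distribˡ _ _ _)
              (L.+-cong (L.sym (i.*-homo _ _)) (L.trans (L.sym (L.*-assoc _ _ _)) (L.*-congʳ (L.sym (i.*-homo _ _))))))
            -- L is only a ring, so x ≠ u is cancelled in each coordinate over the field K.
            coordinates : x K.* ρ.⟦ b ⟧ K.≈ u K.* ρ.⟦ b ⟧ × x K.* (ρ.⟦ b′ ⟧ K.* r) K.≈ u K.* (ρ.⟦ b′ ⟧ K.* r)
            coordinates = L-independent _ _ _ _ (L.trans (L.sym (multiple x)) (L.trans xm′≈um′ (multiple u)))
            ψm′≈0 : ψ.⟦ m′ ⟧ L.≈ L.0#
            ψm′≈0 = begin
              ψ.⟦ m′ ⟧                                             ≈⟨ ψ-linear b b′ ⟩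
              i.⟦ ρ.⟦ b ⟧ ⟧ L.+ i.⟦ ρ.⟦ b′ ⟧ K.* r ⟧ L.* y         ≈⟨ L.+-cong (vanishes _ (proj₁ coordinates)) (L.trans (L.*-congʳ (vanishes _ (proj₂ coordinates))) (L.zeroˡ y)) ⟩
              L.0# L.+ L.0#                                        ≈⟨ L.+-identityˡ L.0# ⟩
              L.0#                                                 ∎
              where
              vanishes : ∀ s → x K.* s K.≈ u K.* s → i.⟦ s ⟧ L.≈ L.0#
              vanishes s e = L.trans (i.⟦⟧-cong (equal-multiples K x≉u s e)) i.0#-homo

-- The invariant subring, and uniqueness of homomorphisms from k[x] and fraction fields.

module _ {R : CommutativeRing a ℓ} {A : Algebra R b ℓ₁} (σ : AlgebraHom A A) where
  private
    module A = CommutativeRing (Algebra.ring A)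
    module σ = AlgebraHom σ

  fixedInclusion : Hom (fixedRing σ) (Algebra.ring A)
  fixedInclusion = makeHom (fixedRing σ) (Algebra.ring A) proj₁ (λ e → e) (λ _ _ → A.refl) (λ _ _ → A.refl) A.refl

  -- σ(t) is also an inverse of z, and inverses are unique. Dominance of a point thereby passes to
  -- the invariant subring.
  fixed-inverse : (z : FixedElement σ) → Invertible (Algebra.ring A) (proj₁ z) → Invertible (fixedRing σ) z
  fixed-inverse (z , σz≈z) (t , zt≈1) = (t , inverse-unique (Algebra.ring A)
    (A.trans (A.*-congʳ (A.sym σz≈z)) (hom-inverse σ.hom zt≈1)) zt≈1) , zt≈1

module _ (D : IntegralDomain a ℓ) where
  open Fractions D
  open RingLemmas (IntegralDomain.commutativeRing D)

  fraction-char : ∀ z → z *ᶠ embed (den z) ≈ᶠ embed (num z)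
  fraction-char z = cross (solve 2 (λ n d → (n :* d) :* con 1 := n :* (d :* con 1)) (IntegralDomain.refl D) (num z) (den z))

module _ {D : IntegralDomain a ℓ} (S : CommutativeRing b ℓ₁) where
  open Fractions D
  private
    module S = CommutativeRing S

  fraction-hom-unique : (φ χ : Hom fractionRing S) →
    (∀ d → Hom.⟦_⟧ φ (embed d) S.≈ Hom.⟦_⟧ χ (embed d)) → ∀ z → Hom.⟦_⟧ φ z S.≈ Hom.⟦_⟧ χ z
  fraction-hom-unique φ χ φ≈χ z = unit-cancel S χd-invertible φ.⟦ z ⟧ χ.⟦ z ⟧ (begin
    φ.⟦ z ⟧ S.* χ.⟦ embed (den z) ⟧     ≈⟨ S.*-congˡ (φ≈χ (den z)) ⟨
    φ.⟦ z ⟧ S.* φ.⟦ embed (den z) ⟧     ≈⟨ φ.*-homo z (embed (den z)) ⟨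
    φ.⟦ z *ᶠ embed (den z) ⟧            ≈⟨ φ.⟦⟧-cong (fraction-char D z) ⟩
    φ.⟦ embed (num z) ⟧                 ≈⟨ φ≈χ (num z) ⟩
    χ.⟦ embed (num z) ⟧                 ≈⟨ χ.⟦⟧-cong (fraction-char D z) ⟨
    χ.⟦ z *ᶠ embed (den z) ⟧            ≈⟨ χ.*-homo z (embed (den z)) ⟩
    χ.⟦ z ⟧ S.* χ.⟦ embed (den z) ⟧     ∎)
    where
    open SetoidReasoning S.setoid
    module φ = Hom φ
    module χ = Hom χ
    module F = Field fractionField
    χd-invertible : Invertible S χ.⟦ embed (den z) ⟧
    χd-invertible with F.inverse (embed (den z)) (λ e → den≉0 z (embed-injective (den z) e))
    ... | t , dt≈1 = χ.⟦ t ⟧ , hom-inverse χ {embed (den z)} {t} dt≈1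

-- From an invariant r y to the equation of the quotient.

module _ (k : Field a ℓ) where
  open Curves k
  private
    module k = Field k
    module K = k⟨x⟩

  poly-hom-unique : (S : CommutativeRing b ℓ₁) → let module S = CommutativeRing S in (φ χ : Hom polyRing S) →
    (∀ r → Hom.⟦_⟧ φ (const r) S.≈ Hom.⟦_⟧ χ (const r)) → Hom.⟦_⟧ φ X S.≈ Hom.⟦_⟧ χ X →
    ∀ p → Hom.⟦_⟧ φ p S.≈ Hom.⟦_⟧ χ p
  poly-hom-unique S φ χ φc≈χc φX≈χX []      = S.trans (Hom.0#-homo φ) (S.sym (Hom.0#-homo χ))
    where module S = CommutativeRing S
  poly-hom-unique S φ χ φc≈χc φX≈χX (r ∷ p) = begin
    φ.⟦ r ∷ p ⟧                               ≈⟨ φ.⟦⟧-cong (∷-as-sum r p) ⟩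
    φ.⟦ const r +ₚ X *ₚ p ⟧                   ≈⟨ S.trans (φ.+-homo (const r) (X *ₚ p)) (S.+-congˡ (φ.*-homo X p)) ⟩
    φ.⟦ const r ⟧ S.+ φ.⟦ X ⟧ S.* φ.⟦ p ⟧     ≈⟨ S.+-cong (φc≈χc r) (S.*-cong φX≈χX (poly-hom-unique S φ χ φc≈χc φX≈χX p)) ⟩
    χ.⟦ const r ⟧ S.+ χ.⟦ X ⟧ S.* χ.⟦ p ⟧     ≈⟨ S.trans (χ.+-homo (const r) (X *ₚ p)) (S.+-congˡ (χ.*-homo X p)) ⟨
    χ.⟦ const r +ₚ X *ₚ p ⟧                   ≈⟨ χ.⟦⟧-cong (∷-as-sum r p) ⟨
    χ.⟦ r ∷ p ⟧                               ∎
    where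
    module S = CommutativeRing S
    module φ = Hom φ
    module χ = Hom χ
    open SetoidReasoning S.setoid

  w-dominant : ∀ p → ¬ p ≈ₚ [] → Invertible F.fractionRing (eval F.fractionRing (κ k) (w k) p)
  w-dominant p p≉0 = K.inverse _ λ e → p≉0 (w-transcendental k p e)

  private
    module E = Extend (polyDomain k) F.fractionRing (evalHom F.fractionRing (κ k) (w k)) w-dominant

  -- x ↦ x + 1/x

  trace : Hom F.fractionRing F.fractionRing
  trace = E.extendHom

  module _ (A : Algebra k.commutativeRing b ℓ₁) (σ : AlgebraHom A A) {h : Poly}
           (P : GenericPoint (Algebra.ring A) (Algebra.structure A) h) where
    private
      module A = CommutativeRing (Algebra.ring A)
      module P = GenericPoint P
      module σ = AlgebraHom σ

    -- Substituting this point, instead of P, gives a homomorphism whose target is the invariant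
    -- ring itself.
    fixedPoint : σ.⟦ P.x-coord ⟧ A.≈ P.x-coord → σ.⟦ P.y-coord ⟧ A.≈ P.y-coord →
                 GenericPoint (fixedRing σ) (Algebra.structure (fixedAlgebra σ)) h
    fixedPoint σx≈x σy≈y = record
      { x-coord  = P.x-coord , σx≈x
      ; y-coord  = P.y-coord , σy≈y
      ; on-curve = A.trans P.on-curve (A.sym (eval-fixed h))
      ; dominant = λ p p≉0 → fixed-inverse σ (eval (fixedRing σ) (Algebra.structure (fixedAlgebra σ)) (P.x-coord , σx≈x) p) (proj₁ (P.dominant p p≉0) ,
          A.trans (A.*-congʳ (eval-fixed p)) (proj₂ (P.dominant p p≉0)))
      }
      where
      eval-fixed : ∀ p → proj₁ (eval (fixedRing σ) (Algebra.structure (fixedAlgebra σ)) (P.x-coord , σx≈x) p)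
                   A.≈ eval (Algebra.ring A) (Algebra.structure A) P.x-coord p
      eval-fixed = eval-natural (fixedRing σ) (Algebra.ring A) (Algebra.structure (fixedAlgebra σ))
        (Algebra.structure A) (fixedInclusion σ) (λ _ → A.refl) (P.x-coord , σx≈x)

  -- Otherwise X² = 1 in k[x], against the coefficient in degree 2.
  X≉1/X : ¬ x̃ k K.≈ 1/X
  X≉1/X e = k.1≉0 (k.trans (k.sym (k.*-identityˡ k.1#)) (coeff-≈ X²≈1 2))
    where
    x²≈1 : F.embed (X *ₚ X) K.≈ F.embed (const k.1#)
    x²≈1 = K.trans (Hom.*-homo F.embedHom X X) (K.trans (K.*-congˡ {x̃ k} e) (proj₂ X-invertible))
    X²≈1 : X *ₚ X ≈ₚ const k.1#
    X²≈1 = k[x].trans (k[x].sym (k[x].*-identityʳ (X *ₚ X))) (k[x].trans (F.cross-≈ x²≈1) (k[x].*-identityʳ (const k.1#)))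

  module _ {f : Poly} (s : RationalMap f f) where
    open FunctionField f
    private
      module σ = AlgebraHom (pullback s)

    module _ (sx≈1/x : GenericPoint.x-coord s ≈ x̂⁻¹) where

      pullback-x̂ : σ.⟦ x̂ ⟧ ≈ x̂⁻¹
      pullback-x̂ = trans (substitute-x̂ algebra s) sx≈1/x

      pullback-x̂⁻¹ : σ.⟦ x̂⁻¹ ⟧ ≈ x̂
      pullback-x̂⁻¹ = inverse-unique ring {x̂⁻¹} (trans (*-congʳ (sym pullback-x̂)) (hom-inverse σ.hom x̂x̂⁻¹≈1))
        (trans (*-comm _ _) x̂x̂⁻¹≈1)
        where
        x̂x̂⁻¹≈1 : x̂ * x̂⁻¹ ≈ 1#
        x̂x̂⁻¹≈1 = hom-inverse rational {F.embed X} {1/X} (proj₂ X-invertible)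

  module _ {f h : Poly} (s : RationalMap f f) (r : K.Carrier) where
    open FunctionField f
    private
      module σ = AlgebraHom (pullback s)
      module M = FunctionField h
      w′ V : Function
      w′ = Hom.⟦_⟧ rational (w k)
      V  = Hom.⟦_⟧ rational r * ŷ

    -- The pair (w , r y) is a σ-invariant generic point of y² = h(x). Its substitution map is the
    -- required isomorphism, both halves of bijectivity coming from `Descent`.
    quotient-criterion : GenericPoint.x-coord s ≈ x̂⁻¹ → ¬ r K.≈ K.0# →
      r K.* r K.* F.embed f K.≈ eval F.fractionRing (κ k) (w k) h → σ.⟦ V ⟧ ≈ V → QuotientGivenBy s h
    quotient-criterion sx≈1/x r≉0 r²f≈h σV≈V = record
      { algebraHom = Φ
      ; isRingIsomorphism = record
        { isRingMonomorphism = record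
          { isRingHomomorphism = AlgebraHom.isRingHomomorphism Φ
          ; injective = Δ.ψ-injective xu≈1 trace-X ψj≈iρ ψη≈ry r≉0 independent M.decompose
          }
        ; surjective = λ (z , σz≈z) → let m , e = ψ-surjective z σz≈z in
            m , λ {m′} m′≈m → trans (AlgebraHom.⟦⟧-cong Φ m′≈m) e
        }
      }
      where
      xu≈1 = proj₂ X-invertible

      point : GenericPoint ring constant h
      point = record
        { x-coord  = w′
        ; y-coord  = V
        ; on-curve = begin
            V * V
              ≈⟨ solve 2 (λ r y → (r :* y) :* (r :* y) := (r :* r) :* (y :* y)) refl (Hom.⟦_⟧ rational r) ŷ ⟩
            (Hom.⟦_⟧ rational r * Hom.⟦_⟧ rational r) * (ŷ * ŷ)
              ≈⟨ *-cong (Hom.*-homo rational r r) (sym root²) ⟨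
            Hom.⟦_⟧ rational (r K.* r) * Hom.⟦_⟧ rational (F.embed f)
              ≈⟨ Hom.*-homo rational (r K.* r) (F.embed f) ⟨
            Hom.⟦_⟧ rational (r K.* r K.* F.embed f)
              ≈⟨ Hom.⟦⟧-cong rational r²f≈h ⟩
            Hom.⟦_⟧ rational (eval F.fractionRing (κ k) (w k) h)
              ≈⟨ eval-natural F.fractionRing ring (κ k) constant rational (λ _ → refl) (w k) h ⟩
            eval ring constant w′ h ∎
        ; dominant = eval-invertible k⟨x⟩ ring (κ k) constant rational (λ _ → refl) (w k) (w-transcendental k)
        }
        where
        open RingLemmas ring
        open SetoidReasoning setoid

      σx≈u = pullback-x̂ s sx≈1/x
      σu≈x = pullback-x̂⁻¹ s sx≈1/x

      w′≈ : w′ ≈ x̂ + x̂⁻¹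
      w′≈ = Hom.+-homo rational (x̃ k) 1/X

      σw≈w : σ.⟦ w′ ⟧ ≈ w′
      σw≈w = begin
        σ.⟦ w′ ⟧                 ≈⟨ σ.⟦⟧-cong w′≈ ⟩
        σ.⟦ x̂ + x̂⁻¹ ⟧            ≈⟨ σ.+-homo x̂ x̂⁻¹ ⟩
        σ.⟦ x̂ ⟧ + σ.⟦ x̂⁻¹ ⟧      ≈⟨ +-cong σx≈u σu≈x ⟩
        x̂⁻¹ + x̂                  ≈⟨ +-comm _ _ ⟩
        x̂ + x̂⁻¹                  ≈⟨ w′≈ ⟨
        w′                       ∎
        where
        open SetoidReasoning setoid

      fixed = fixedPoint algebra (pullback s) point σw≈w σV≈V
      Φ = substitute (fixedAlgebra (pullback s)) fixed
      ψ : Hom M.ring ring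
      ψ = fixedInclusion (pullback s) ∘ʰ AlgebraHom.hom Φ

      trace-const : ∀ c → Hom.⟦_⟧ trace (F.embed (const c)) K.≈ F.embed (const c)
      trace-const c = K.trans (E.extend-embed (const c)) (eval-const F.fractionRing (κ k) (w k) c)

      trace-X : Hom.⟦_⟧ trace (F.embed X) K.≈ x̃ k K.+ 1/X
      trace-X = K.trans (E.extend-embed X) (eval-X F.fractionRing (κ k) (w k))

      ψj≈iρ : ∀ z → Hom.⟦_⟧ ψ (Hom.⟦_⟧ M.rational z) ≈ Hom.⟦_⟧ rational (Hom.⟦_⟧ trace z)
      -- Both sides are homomorphisms from k(x), so it suffices to compare them on constants and on
      -- x.
      ψj≈iρ = fraction-hom-unique ring (ψ ∘ʰ M.rational) (rational ∘ʰ trace)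
        (poly-hom-unique ring (ψ ∘ʰ M.polynomial) (rational ∘ʰ trace ∘ʰ F.embedHom)
          (λ r → trans (AlgebraHom.commutes Φ r) (Hom.⟦⟧-cong rational (K.sym (trace-const r))))
          (trans (substitute-x̂ (fixedAlgebra (pullback s)) fixed) (Hom.⟦⟧-cong rational (K.sym trace-X))))

      ψη≈ry : Hom.⟦_⟧ ψ M.ŷ ≈ V
      ψη≈ry = substitute-ŷ (fixedAlgebra (pullback s)) fixed

      -- k(x) appears twice: as K, and as the function field of the new x-line, embedded in K by
      -- `trace` with image k(w).
      module Δ = Descent {K₁ = k⟨x⟩} {K = k⟨x⟩} trace M.rational rational ψ σ.hom M.ŷ ŷ (F.embed X) (x̃ k) 1/X r

      linear-poly : ∀ p → Δ.IsLinear (F.embed p)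
      linear-poly []      = Δ.IsLinear-resp {Hom.⟦_⟧ trace K.0#} (Hom.0#-homo trace) (Δ.IsLinear-base K.0#)
      linear-poly (c ∷ p) = Δ.IsLinear-resp {Hom.⟦_⟧ trace (F.embed (const c)) K.+ x̃ k K.* F.embed p} (begin
        Hom.⟦_⟧ trace (F.embed (const c)) K.+ x̃ k K.* F.embed p
          ≈⟨ K.+-congʳ {x̃ k K.* F.embed p} (trace-const c) ⟩
        F.embed (const c) K.+ x̃ k K.* F.embed p
          ≈⟨ K.+-congˡ {F.embed (const c)} (Hom.*-homo F.embedHom X p) ⟨
        F.embed (const c) K.+ F.embed (X *ₚ p)
          ≈⟨ Hom.+-homo F.embedHom (const c) (X *ₚ p) ⟨
        F.embed (const c +ₚ X *ₚ p)
          ≈⟨ Hom.⟦⟧-cong F.embedHom (∷-as-sum c p) ⟨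
        F.embed (c ∷ p) ∎)
        (Δ.IsLinear-+ (Δ.IsLinear-base (F.embed (const c))) (Δ.IsLinear-* xu≈1 trace-X Δ.IsLinear-x (linear-poly p)))
        where
        open SetoidReasoning K.setoid

      linear : ∀ z → Δ.IsLinear z
      linear z = Δ.IsLinear-/ xu≈1 trace-X ψj≈iρ ψη≈ry r≉0 independent M.decompose
        -- Invariance of the image of ψ is the second component of the values of Φ.
        (λ m → proj₂ (AlgebraHom.⟦_⟧ Φ m)) σx≈u
        (λ e → F.den≉0 z (F.embed-injective (F.den z) e))
        (fraction-char (polyDomain k) z) (linear-poly (F.num z)) (linear-poly (F.den z))

      ψ-surjective : ∀ z → σ.⟦ z ⟧ ≈ z → ∃[ m ] Hom.⟦_⟧ ψ m ≈ z
      ψ-surjective = Δ.ψ-surjective xu≈1 trace-X ψj≈iρ ψη≈ry r≉0 independent M.decompose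
        (λ m → proj₂ (AlgebraHom.⟦_⟧ Φ m)) σx≈u X≉1/X decompose linear

-- Identities between x and t = 1/x.

module _ (R : CommutativeRing a ℓ) where
  open CommutativeRing R
  open RingLemmas R
  open Exp semiring
  open Multiples semiring using () renaming (_×_ to _·_)
  open SetoidReasoning setoid

  -- Moving the subtrahend to the other side brings identities with differences within reach of the
  -- semiring solver.
  z+c≈y⇒z≈y-c : ∀ z c y → z + c ≈ y → z ≈ y + - c
  z+c≈y⇒z≈y-c z c y e = begin
    z               ≈⟨ +-identityʳ z ⟨
    z + 0#          ≈⟨ +-congˡ (-‿inverseʳ c) ⟨
    z + (c + - c)   ≈⟨ +-assoc z c (- c) ⟨
    z + c + - c     ≈⟨ +-congʳ e ⟩
    y + - c         ∎

  square-product : ∀ u q x d → u * q * (u * q) * (x * d) ≈ u * u * x * (q * q) * d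
  square-product = solve 4 (λ u q x d → u :* q :* (u :* q) :* (x :* d) := u :* u :* x :* (q :* q) :* d) refl

  module _ {x t : Carrier} (xt≈1 : x * t ≈ 1#) where

    module _ (n : ℕ) {N : ℕ} (n+n≡N : n ℕ.+ n ≡ N) where

      split-power : ∀ y → y ^ N ≈ y ^ n * y ^ n
      split-power y = trans (^-congʳ y (≡.sym n+n≡N)) (^-homo-* y n n)

      -- In the image of x⁻ⁿ y, the power xⁿ comes from x⁻ⁿ and t ^ N from the image of y.
      half-power : x ^ n * t ^ N ≈ t ^ n
      half-power = begin
        x ^ n * t ^ N                ≈⟨ *-congˡ (split-power t) ⟩
        x ^ n * (t ^ n * t ^ n)      ≈⟨ *-assoc _ _ _ ⟨
        x ^ n * t ^ n * t ^ n        ≈⟨ *-congʳ (inverse-^ R xt≈1 n) ⟩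
        1# * t ^ n                   ≈⟨ *-identityˡ _ ⟩
        t ^ n                        ∎

      half-powers : t ^ n * t ^ n * x ^ N ≈ 1#
      half-powers = begin
        t ^ n * t ^ n * x ^ N  ≈⟨ *-congʳ (split-power t) ⟨
        t ^ N * x ^ N          ≈⟨ *-comm _ _ ⟩
        x ^ N * t ^ N          ≈⟨ inverse-^ R xt≈1 N ⟩
        1#                     ∎

    module _ (n : ℕ) {N : ℕ} (n+n≡1+N : n ℕ.+ n ≡ suc N) where

      -- Here 2 n exceeds N by one, so a factor x survives; q has to compensate for it.
      half-power-suc : x ^ n * t ^ N ≈ x * t ^ n
      half-power-suc = begin
        x ^ n * t ^ N                ≈⟨ *-identityʳ _ ⟨
        x ^ n * t ^ N * 1#           ≈⟨ *-congˡ xt≈1 ⟨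
        x ^ n * t ^ N * (x * t)      ≈⟨ solve 4 (λ x t p q → p :* q :* (x :* t) := x :* (p :* (t :* q))) refl x t (x ^ n) (t ^ N) ⟩
        x * (x ^ n * t ^ suc N)      ≈⟨ *-congˡ (half-power n n+n≡1+N) ⟩
        x * t ^ n                    ∎

      half-powers-suc : t ^ n * t ^ n * x ^ N ≈ t
      half-powers-suc = begin
        t ^ n * t ^ n * x ^ N            ≈⟨ *-identityʳ _ ⟨
        t ^ n * t ^ n * x ^ N * 1#       ≈⟨ *-congˡ xt≈1 ⟨
        t ^ n * t ^ n * x ^ N * (x * t)  ≈⟨ solve 4 (λ x t p q → p :* q :* (x :* t) := (p :* (x :* q)) :* t) refl x t (t ^ n * t ^ n) (x ^ N) ⟩
        t ^ n * t ^ n * x ^ suc N * t    ≈⟨ *-congʳ (half-powers n n+n≡1+N) ⟩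
        1# * t                           ≈⟨ *-identityˡ t ⟩
        t                                ∎

    -- Writing x = xᵍ⁺¹ x⁻ᵍ makes xᵍ⁺¹ a common factor.
    curve-factorisation : ∀ g c → x ^ (2 ℕ.* g ℕ.+ 1) + c * x ^ (g ℕ.+ 1) + x ≈ x ^ (g ℕ.+ 1) * ((x ^ g + t ^ g) + c)
    curve-factorisation g c = begin
      x ^ (2 ℕ.* g ℕ.+ 1) + c * x ^ (g ℕ.+ 1) + x
        ≈⟨ +-cong (+-congʳ (trans (^-congʳ x exponent) (^-homo-* x (g ℕ.+ 1) g))) (trans (sym (*-identityʳ x)) (*-congˡ (sym (inverse-^ R xt≈1 g)))) ⟩
      x ^ (g ℕ.+ 1) * x ^ g + c * x ^ (g ℕ.+ 1) + x * (x ^ g * t ^ g)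
        ≈⟨ +-congʳ (+-cong (*-congʳ xᵍ⁺¹) (*-congˡ xᵍ⁺¹)) ⟩
      x * x ^ g * x ^ g + c * (x * x ^ g) + x * (x ^ g * t ^ g)
        ≈⟨ solve 4 (λ x p q c → x :* p :* p :+ c :* (x :* p) :+ x :* (p :* q) := (x :* p) :* ((p :+ q) :+ c)) refl x (x ^ g) (t ^ g) c ⟩
      x * x ^ g * ((x ^ g + t ^ g) + c)
        ≈⟨ *-congʳ xᵍ⁺¹ ⟨
      x ^ (g ℕ.+ 1) * ((x ^ g + t ^ g) + c) ∎
      where
      xᵍ⁺¹ : x ^ (g ℕ.+ 1) ≈ x ^ suc g
      xᵍ⁺¹ = ^-congʳ x (ℕ.+-comm g 1)
      exponent : 2 ℕ.* g ℕ.+ 1 ≡ g ℕ.+ 1 ℕ.+ g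
      exponent = S.solve 1 (λ g → S.con 2 S.:* g S.:+ S.con 1 S.:= g S.:+ S.con 1 S.:+ g) ≡.refl g
        where
        module S = +-*-Solver

    -- For even g, the factor 1/x left in x⁻²ⁿ xᵍ⁺¹ turns the square of q = x + 1 into a polynomial
    -- in w.
    [x+1]²/x : t * ((x + 1#) * (x + 1#)) ≈ (x + t) + 2 · 1#
    [x+1]²/x = begin
      t * ((x + 1#) * (x + 1#))              ≈⟨ solve 2 (λ x t → t :* ((x :+ con 1) :* (x :+ con 1)) := (x :* t) :* x :+ t :+ (x :* t :+ x :* t)) refl x t ⟩
      x * t * x + t + (x * t + x * t)        ≈⟨ +-cong (+-congʳ (*-congʳ xt≈1)) (+-cong xt≈1 xt≈1) ⟩
      1# * x + t + (1# + 1#)                 ≈⟨ +-cong (+-congʳ (*-identityˡ x)) (+-congˡ (sym (+-identityʳ 1#))) ⟩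
      (x + t) + (1# + (1# + 0#))             ∎

    [x-1]²/x : t * ((x + - 1#) * (x + - 1#)) ≈ (x + t) + - (2 · 1#)
    [x-1]²/x = z+c≈y⇒z≈y-c _ (2 · 1#) (x + t) (begin
      t * ((x + e) * (x + e)) + (1# + (1# + 0#))
        ≈⟨ solve 3 (λ x t e → t :* ((x :+ e) :* (x :+ e)) :+ (con 1 :+ (con 1 :+ con 0)) :=
             (x :* t) :* x :+ (e :* e) :* t :+ ((x :* t :* e :+ con 1) :+ (x :* t :* e :+ con 1))) refl x t e ⟩
      x * t * x + e * e * t + ((x * t * e + 1#) + (x * t * e + 1#))
        ≈⟨ +-cong (+-cong (trans (*-congʳ xt≈1) (*-identityˡ x)) (trans (*-congʳ ee≈1) (*-identityˡ t))) (+-cong xte+1≈0 xte+1≈0) ⟩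
      x + t + (0# + 0#)
        ≈⟨ trans (+-congˡ (+-identityˡ 0#)) (+-identityʳ _) ⟩
      x + t ∎)
      where
      e = - 1#
      ee≈1 : e * e ≈ 1#
      ee≈1 = trans (-x*-y≈x*y 1# 1#) (*-identityˡ 1#)
      xte+1≈0 : x * t * e + 1# ≈ 0#
      xte+1≈0 = trans (+-congʳ (trans (*-congʳ xt≈1) (*-identityˡ e))) (-‿inverseˡ 1#)

    [x-1/x]² : (x + - t) * (x + - t) ≈ (x + t) * (x + t) + - (4 · 1#)
    [x-1/x]² = z+c≈y⇒z≈y-c _ (4 · 1#) _ (begin
      (x + - t) * (x + - t) + (1# + (1# + (1# + (1# + 0#))))
        ≈⟨ solve 2 (λ x n → (x :+ n) :* (x :+ n) :+ (con 1 :+ (con 1 :+ (con 1 :+ (con 1 :+ con 0)))) :=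
             x :* x :+ n :* n :+ (con 1 :+ con 1) :+ ((x :* n :+ con 1) :+ (x :* n :+ con 1))) refl x (- t) ⟩
      x * x + - t * - t + (1# + 1#) + ((x * - t + 1#) + (x * - t + 1#))
        ≈⟨ +-cong (+-cong (+-congˡ (-x*-y≈x*y t t)) (sym (+-cong xt≈1 xt≈1))) (trans (+-cong xn+1≈0 xn+1≈0) (+-identityˡ 0#)) ⟩
      x * x + t * t + (x * t + x * t) + 0#
        ≈⟨ solve 2 (λ x t → x :* x :+ t :* t :+ (x :* t :+ x :* t) :+ con 0 := (x :+ t) :* (x :+ t)) refl x t ⟩
      (x + t) * (x + t) ∎)
      where
      xn+1≈0 : x * - t + 1# ≈ 0#
      xn+1≈0 = trans (+-congʳ (trans (sym (-‿distribʳ-* x t)) (-‿cong xt≈1))) (-‿inverseˡ 1#)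

    -- This identity and the next two are what invariance demands of q once the powers of x are
    -- removed; the factor 1 or - 1 is the sign of the involution.
    x[1/x+1]≈x+1 : x * (1# * (t + 1#)) ≈ x + 1#
    x[1/x+1]≈x+1 = begin
      x * (1# * (t + 1#))  ≈⟨ solve 2 (λ x t → x :* (con 1 :* (t :+ con 1)) := x :* t :+ x) refl x t ⟩
      x * t + x            ≈⟨ +-congʳ xt≈1 ⟩
      1# + x               ≈⟨ +-comm 1# x ⟩
      x + 1#               ∎

    -x[1/x-1]≈x-1 : x * (- 1# * (t + - 1#)) ≈ x + - 1#
    -x[1/x-1]≈x-1 = begin
      x * (- 1# * (t + - 1#))          ≈⟨ solve 3 (λ x t e → x :* (e :* (t :+ e)) := (e :* e) :* x :+ (x :* t) :* e) refl x t (- 1#) ⟩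
      - 1# * - 1# * x + x * t * - 1#   ≈⟨ +-cong (trans (*-congʳ (trans (-x*-y≈x*y 1# 1#) (*-identityˡ 1#))) (*-identityˡ x))
                                                 (trans (*-congʳ xt≈1) (*-identityˡ (- 1#))) ⟩
      x + - 1#                         ∎

    -[1/x-x]≈x-1/x : - 1# * (t + - x) ≈ x + - t
    -[1/x-x]≈x-1/x = begin
      - 1# * (t + - x)         ≈⟨ distribˡ (- 1#) t (- x) ⟩
      - 1# * t + - 1# * - x    ≈⟨ +-cong (trans (sym (-‿distribˡ-* 1# t)) (-‿cong (*-identityˡ t)))
                                         (trans (-x*-y≈x*y 1# x) (*-identityˡ x)) ⟩
      - t + x                  ≈⟨ +-comm (- t) x ⟩
      x + - t                  ∎

-- The four invariants and their equations.

module _ (k : Field a ℓ) where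
  open Curves k
  private
    module K = k⟨x⟩
    W = evalHom F.fractionRing (κ k) (w k)
    module W = Hom W
    xt≈1 = proj₂ X-invertible
  open Exp K.semiring using () renaming (_^_ to _^ₖ_)
  open Multiples K.semiring using () renaming (_×_ to _·ₖ_)

  -- D_g(w) + c in terms of x: the cofactor of xᵍ⁺¹ in the curve equation and a common factor of the
  -- four quotient equations.
  dicksonValue : ℕ → Field.Carrier k → K.Carrier
  dicksonValue g c = (x̃ k ^ₖ g K.+ 1/X ^ₖ g) K.+ F.embed (const c)

  W-X : W.⟦ X ⟧ K.≈ w k
  W-X = eval-X F.fractionRing (κ k) (w k)

  W-dickson : ∀ {g} → 0 ℕ.< g → ∀ c → W.⟦ D g +ₚ const c ⟧ K.≈ dicksonValue g c
  W-dickson {g} 0<g c = K.trans (W.+-homo (D g) (const c)) (K.+-cong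
    {W.⟦ D g ⟧} {x̃ k ^ₖ g K.+ 1/X ^ₖ g} {W.⟦ const c ⟧} {F.embed (const c)}
    (dickson-functional k F.fractionRing W {x̃ k} {1/X} xt≈1 W-X 0<g)
    (eval-const F.fractionRing (κ k) (w k) c))

  W-numeral : ∀ n → W.⟦ numeral n ⟧ K.≈ n ·ₖ K.1#
  W-numeral = hom-numeral k F.fractionRing W

  W-X+2 : W.⟦ X +ₚ numeral 2 ⟧ K.≈ w k K.+ 2 ·ₖ K.1#
  W-X+2 = K.trans (W.+-homo X (numeral 2)) (K.+-cong {W.⟦ X ⟧} {w k} {W.⟦ numeral 2 ⟧} {2 ·ₖ K.1#} W-X (W-numeral 2))

  W-minus-numeral : ∀ p n {z} → W.⟦ p ⟧ K.≈ z → W.⟦ p -ₚ numeral n ⟧ K.≈ z K.+ K.- (n ·ₖ K.1#)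
  W-minus-numeral p n {z} p≈z = K.trans (W.+-homo p (-ₚ numeral n)) (K.+-cong
    {W.⟦ p ⟧} {z} {W.⟦ -ₚ numeral n ⟧} {K.- (n ·ₖ K.1#)} p≈z
    (K.trans (W.-‿homo (numeral n)) (K.-‿cong {W.⟦ numeral n ⟧} {n ·ₖ K.1#} (W-numeral n))))

  W-X² : W.⟦ X *ₚ X ⟧ K.≈ w k K.* w k
  W-X² = K.trans (W.*-homo X X) (K.*-cong {W.⟦ X ⟧} {w k} {W.⟦ X ⟧} {w k} W-X W-X)

  W-product : ∀ {g} → 0 ℕ.< g → ∀ c l {H} → W.⟦ l ⟧ K.≈ H → W.⟦ l *ₚ (D g +ₚ const c) ⟧ K.≈ H K.* dicksonValue g c
  W-product {g} 0<g c l {H} l≈H = K.trans (W.*-homo l (D g +ₚ const c))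
    (K.*-cong {W.⟦ l ⟧} {H} {W.⟦ D g +ₚ const c ⟧} {dicksonValue g c} l≈H (W-dickson 0<g c))

  embed-C′ : ∀ g c → F.embed (C′ g c) K.≈ x̃ k ^ₖ (g ℕ.+ 1) K.* dicksonValue g c
  embed-C′ g c = K.trans (hom-C′ F.fractionRing F.embedHom g c)
    (curve-factorisation F.fractionRing {x̃ k} {1/X} xt≈1 g (F.embed (const c)))

  x+c≉0 : ∀ c → ¬ x̃ k K.+ F.embed (const c) K.≈ K.0#
  x+c≉0 c e = Field.1≉0 k (coeff-≈ (F.embed-injective (X +ₚ const c) (K.trans (Hom.+-homo F.embedHom X (const c)) e)) 1)

  module _ {f h : Poly} (s : RationalMap f f) (N : ℕ) (δ : K.Carrier) (f≈ : F.embed f K.≈ x̃ k ^ₖ N K.* δ) where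
    open FunctionField f
    private
      module rational = Hom rational
      module σ = AlgebraHom (pullback s)

      x̂x̂⁻¹≈1 : x̂ * x̂⁻¹ ≈ 1#
      x̂x̂⁻¹≈1 = hom-inverse rational {F.embed X} {1/X} xt≈1

    module _ (ε : Function) (sx≈1/x : GenericPoint.x-coord s ≈ x̂⁻¹)
             (sy≈εy : GenericPoint.y-coord s ≈ ε * (ŷ * x̂⁻¹ ^ N)) where

      -- The invariant function is V = q y / xⁿ.

      quotient-by-invariant : ∀ n (q H : K.Carrier) (Q Q′ : Function) → ¬ q K.≈ K.0# →
        W.⟦ h ⟧ K.≈ H K.* δ →
        1/X ^ₖ n K.* 1/X ^ₖ n K.* x̃ k ^ₖ N K.* (q K.* q) K.≈ H →
        rational.⟦ q ⟧ ≈ Q → σ.⟦ Q ⟧ ≈ Q′ →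
        x̂ ^ n * x̂⁻¹ ^ N * (ε * Q′) ≈ x̂⁻¹ ^ n * Q →
        QuotientGivenBy s h
      quotient-by-invariant n q H Q Q′ q≉0 h≈ H≈ q≈Q σQ≈Q′ invariant =
        quotient-criterion k s r sx≈1/x r≉0 r²f≈h σV≈V
        where
        u = 1/X ^ₖ n
        r = u K.* q
        r≉0 : ¬ r K.≈ K.0#
        r≉0 e with noZeroDivisors-field k⟨x⟩ u q e
        ... | inj₂ q≈0 = q≉0 q≈0
        ... | inj₁ u≈0 = K.1≉0 (K.trans (K.sym (inverse-^ F.fractionRing {x̃ k} {1/X} xt≈1 n))
                           (K.trans (K.*-congˡ {x̃ k ^ₖ n} u≈0) (K.zeroʳ (x̃ k ^ₖ n))))
        r²f≈h : r K.* r K.* F.embed f K.≈ W.⟦ h ⟧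
        r²f≈h = begin
          r K.* r K.* F.embed f                              ≈⟨ K.*-congˡ {r K.* r} f≈ ⟩
          r K.* r K.* (x̃ k ^ₖ N K.* δ)                       ≈⟨ square-product F.fractionRing u q (x̃ k ^ₖ N) δ ⟩
          u K.* u K.* x̃ k ^ₖ N K.* (q K.* q) K.* δ           ≈⟨ K.*-congʳ {δ} H≈ ⟩
          H K.* δ                                            ≈⟨ h≈ ⟨
          W.⟦ h ⟧                                            ∎
          where
          open SetoidReasoning K.setoid
        r≈ : rational.⟦ r ⟧ ≈ x̂⁻¹ ^ n * Q
        r≈ = trans (rational.*-homo u q) (*-cong (hom-^ rational 1/X n) q≈Q)
        -- σ takes x⁻ⁿ q y to xⁿ σ(q) ε y x⁻ᴺ, so the hypothesis on Q′ is invariance with y removed.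
        σV≈V : σ.⟦ rational.⟦ r ⟧ * ŷ ⟧ ≈ rational.⟦ r ⟧ * ŷ
        σV≈V = begin
          σ.⟦ rational.⟦ r ⟧ * ŷ ⟧
            ≈⟨ σ.*-homo _ _ ⟩
          σ.⟦ rational.⟦ r ⟧ ⟧ * σ.⟦ ŷ ⟧
            ≈⟨ *-cong (trans (σ.⟦⟧-cong r≈) (σ.*-homo _ _)) (trans (substitute-ŷ algebra s) sy≈εy) ⟩
          σ.⟦ x̂⁻¹ ^ n ⟧ * σ.⟦ Q ⟧ * (ε * (ŷ * x̂⁻¹ ^ N))
            ≈⟨ *-congʳ (*-cong (trans (hom-^ σ.hom x̂⁻¹ n) (^-congˡ n (pullback-x̂⁻¹ k s sx≈1/x))) σQ≈Q′) ⟩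
          x̂ ^ n * Q′ * (ε * (ŷ * x̂⁻¹ ^ N))
            ≈⟨ solve 5 (λ x q e y u → x :* q :* (e :* (y :* u)) := x :* u :* (e :* q) :* y) refl (x̂ ^ n) Q′ ε ŷ (x̂⁻¹ ^ N) ⟩
          x̂ ^ n * x̂⁻¹ ^ N * (ε * Q′) * ŷ
            ≈⟨ *-congʳ (trans invariant (sym r≈)) ⟩
          rational.⟦ r ⟧ * ŷ ∎
          where
          open SetoidReasoning setoid
          open Exp semiring using (^-congˡ)
          open RingLemmas ring

    module _ (sx≈1/x : GenericPoint.x-coord s ≈ x̂⁻¹) (n : ℕ) where
      private
        σx≈u = pullback-x̂ k s sx≈1/x
        σu≈x = pullback-x̂⁻¹ k s sx≈1/x
        t² = 1/X ^ₖ n K.* 1/X ^ₖ n K.* x̃ k ^ₖ N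

        1*y : ∀ {y z} → y ≈ z → y ≈ 1# * z
        1*y e = trans e (sym (*-identityˡ _))

        -1*y : ∀ {y z} → y ≈ - z → y ≈ - 1# * z
        -1*y e = trans e (trans (-‿cong (sym (*-identityˡ _))) (RingLemmas.-‿distribˡ-* ring 1# _))

      module _ (n+n≡N : n ℕ.+ n ≡ N) where
        private
          H≈ : ∀ v {H} → v K.≈ H → t² K.* v K.≈ H
          H≈ v v≈H = K.trans (K.*-congʳ {v} (half-powers F.fractionRing {x̃ k} {1/X} xt≈1 n n+n≡N))
            (K.trans (K.*-identityˡ v) v≈H)

          invariant : ∀ {E Q} → E ≈ Q → x̂ ^ n * x̂⁻¹ ^ N * E ≈ x̂⁻¹ ^ n * Q
          invariant = *-cong (half-power ring x̂x̂⁻¹≈1 n n+n≡N)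

        quotient-s-odd : GenericPoint.y-coord s ≈ ŷ * x̂⁻¹ ^ N → W.⟦ h ⟧ K.≈ δ → QuotientGivenBy s h
        quotient-s-odd sy≈y h≈ = quotient-by-invariant 1# sx≈1/x (1*y sy≈y) n K.1# K.1# 1# 1# K.1≉0
          (K.trans h≈ (K.sym (K.*-identityˡ δ))) (H≈ (K.1# K.* K.1#) {K.1#} (K.*-identityˡ K.1#)) rational.1#-homo σ.1#-homo
          (invariant (*-identityˡ 1#))

        -- x⁻ⁿ y changes sign here, so q must be anti-invariant: q = x - 1/x, with square w² - 4.
        quotient-sω-odd : GenericPoint.y-coord s ≈ - (ŷ * x̂⁻¹ ^ N) →
          W.⟦ h ⟧ K.≈ (w k K.* w k K.+ K.- (4 ·ₖ K.1#)) K.* δ → QuotientGivenBy s h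
        quotient-sω-odd sy≈-y h≈ = quotient-by-invariant (- 1#) sx≈1/x (-1*y sy≈-y) n
          q (w k K.* w k K.+ K.- (4 ·ₖ K.1#)) (x̂ + - x̂⁻¹) (x̂⁻¹ + - x̂)
          (λ e → X≉1/X k (RingLemmas.x-y≈0⇒x≈y F.fractionRing (x̃ k) 1/X e)) h≈
          (H≈ (q K.* q) {w k K.* w k K.+ K.- (4 ·ₖ K.1#)} ([x-1/x]² F.fractionRing {x̃ k} {1/X} xt≈1))
          (trans (rational.+-homo (x̃ k) (K.- 1/X)) (+-congˡ (rational.-‿homo 1/X)))
          (trans (σ.+-homo x̂ (- x̂⁻¹)) (+-cong σx≈u (trans (σ.-‿homo x̂⁻¹) (-‿cong σu≈x))))
          (invariant (-[1/x-x]≈x-1/x ring x̂x̂⁻¹≈1))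
          where
          q = x̃ k K.+ K.- 1/X

      module _ (n+n≡1+N : n ℕ.+ n ≡ suc N) where
        private
          H≈ : ∀ v {H} → 1/X K.* v K.≈ H → t² K.* v K.≈ H
          H≈ v = K.trans (K.*-congʳ {v} (half-powers-suc F.fractionRing {x̃ k} {1/X} xt≈1 n n+n≡1+N))

          invariant : ∀ {E Q} → x̂ * E ≈ Q → x̂ ^ n * x̂⁻¹ ^ N * E ≈ x̂⁻¹ ^ n * Q
          invariant {E} {Q} xE≈Q = begin
            x̂ ^ n * x̂⁻¹ ^ N * E           ≈⟨ *-congʳ (half-power-suc ring x̂x̂⁻¹≈1 n n+n≡1+N) ⟩
            x̂ * x̂⁻¹ ^ n * E               ≈⟨ *-congʳ (*-comm x̂ _) ⟩
            x̂⁻¹ ^ n * x̂ * E               ≈⟨ *-assoc _ x̂ E ⟩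
            x̂⁻¹ ^ n * (x̂ * E)             ≈⟨ *-congˡ xE≈Q ⟩
            x̂⁻¹ ^ n * Q                   ∎
            where
            open SetoidReasoning setoid

        -- x⁻ⁿ y is multiplied by x, so q has to satisfy x q(1/x) = q(x): the choice is x + 1.
        quotient-s-even : GenericPoint.y-coord s ≈ ŷ * x̂⁻¹ ^ N →
          W.⟦ h ⟧ K.≈ (w k K.+ 2 ·ₖ K.1#) K.* δ → QuotientGivenBy s h
        quotient-s-even sy≈y h≈ = quotient-by-invariant 1# sx≈1/x (1*y sy≈y) n
          q (w k K.+ 2 ·ₖ K.1#) (x̂ + 1#) (x̂⁻¹ + 1#) (x+c≉0 (Field.1# k)) h≈
          (H≈ (q K.* q) {w k K.+ 2 ·ₖ K.1#} ([x+1]²/x F.fractionRing {x̃ k} {1/X} xt≈1))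
          (trans (rational.+-homo (x̃ k) K.1#) (+-congˡ rational.1#-homo))
          (trans (σ.+-homo x̂ 1#) (+-cong σx≈u σ.1#-homo))
          (invariant (x[1/x+1]≈x+1 ring x̂x̂⁻¹≈1))
          where
          q = x̃ k K.+ K.1#

        -- With the additional sign the condition becomes - x q(1/x) = q(x), met by x - 1.
        quotient-sω-even : GenericPoint.y-coord s ≈ - (ŷ * x̂⁻¹ ^ N) →
          W.⟦ h ⟧ K.≈ (w k K.+ K.- (2 ·ₖ K.1#)) K.* δ → QuotientGivenBy s h
        quotient-sω-even sy≈-y h≈ = quotient-by-invariant (- 1#) sx≈1/x (-1*y sy≈-y) n
          q (w k K.+ K.- (2 ·ₖ K.1#)) (x̂ + - 1#) (x̂⁻¹ + - 1#) (x+c≉0 (Field.-_ k (Field.1# k))) h≈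
          (H≈ (q K.* q) {w k K.+ K.- (2 ·ₖ K.1#)} ([x-1]²/x F.fractionRing {x̃ k} {1/X} xt≈1))
          (trans (rational.+-homo (x̃ k) (K.- K.1#)) (+-congˡ (trans (rational.-‿homo K.1#) (-‿cong rational.1#-homo))))
          (trans (σ.+-homo x̂ (- 1#)) (+-cong σx≈u (trans (σ.-‿homo 1#) (-‿cong σ.1#-homo))))
          (invariant (-x[1/x-1]≈x-1 ring x̂x̂⁻¹≈1))
          where
          q = x̃ k K.+ K.- K.1#

-- Parity of g and the choice of the exponent n.

parity : ∀ g → 2 ∣ g × (∃[ n ] n ℕ.+ n ≡ suc (g ℕ.+ 1)) ⊎ ¬ 2 ∣ g × (∃[ n ] n ℕ.+ n ≡ g ℕ.+ 1)
parity zero          = inj₁ (divides 0 ≡.refl , 1 , ≡.refl)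
parity (suc zero)    = inj₂ ((λ 2∣1 → ℕ.<⇒≱ (ℕ.n<1+n 1) (∣⇒≤ 2∣1)) , 1 , ≡.refl)
parity (suc (suc g)) with parity g
... | inj₁ (2∣g , n , e) = inj₁ (∣m∣n⇒∣m+n ∣-refl 2∣g , suc n , ≡.cong suc (≡.trans (ℕ.+-suc n n) (≡.cong suc e)))
... | inj₂ (2∤g , n , e) = inj₂ ((λ 2∣2+g → 2∤g (∣m+n∣m⇒∣n 2∣2+g ∣-refl)) , suc n , ≡.cong suc (≡.trans (ℕ.+-suc n n) (≡.cong suc e)))

odd⇒g+1-even : ∀ g → ¬ 2 ∣ g → ∃[ n ] n ℕ.+ n ≡ g ℕ.+ 1
odd⇒g+1-even g 2∤g with parity g
... | inj₁ (2∣g , _) = ⊥-elim (2∤g 2∣g)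
... | inj₂ (_ , n≡)  = n≡

even⇒g+2-even : ∀ g → 2 ∣ g → ∃[ n ] n ℕ.+ n ≡ suc (g ℕ.+ 1)
even⇒g+2-even g 2∣g with parity g
... | inj₁ (_ , n≡)  = n≡
... | inj₂ (2∤g , _) = ⊥-elim (2∤g 2∣g)

-- The qualified names matter: up to their aliases obtained by opening Curves, types are
-- compared by unfolding C′ and s, down to the proofs inside them.

module _ (k : Field a ℓ) (g : ℕ) (c : Field.Carrier k) (0<g : 0 ℕ.< g) where
  open Curves k using (X; D; const; numeral; _+ₚ_; _-ₚ_; _*ₚ_)
  open CommutativeRing (Curves.FunctionField.ring k (Curves.C′ k g c)) using (refl)
  private
    N = g ℕ.+ 1
    δ = dicksonValue k g c

  C′/s-odd : ¬ 2 ∣ g → Curves.QuotientGivenBy k (Curves.Involutions.s k g c) (D g +ₚ const c)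
  C′/s-odd 2∤g = quotient-s-odd k (Curves.Involutions.s k g c) N δ (embed-C′ k g c) refl
    (proj₁ (odd⇒g+1-even g 2∤g)) (proj₂ (odd⇒g+1-even g 2∤g)) refl
    (W-dickson k 0<g c)

  C′/sω-odd : ¬ 2 ∣ g →
    Curves.QuotientGivenBy k (Curves.Involutions.sω k g c) ((X *ₚ X -ₚ numeral 4) *ₚ (D g +ₚ const c))
  C′/sω-odd 2∤g = quotient-sω-odd k (Curves.Involutions.sω k g c) N δ (embed-C′ k g c) refl
    (proj₁ (odd⇒g+1-even g 2∤g)) (proj₂ (odd⇒g+1-even g 2∤g)) refl
    (W-product k 0<g c (X *ₚ X -ₚ numeral 4) (W-minus-numeral k (X *ₚ X) 4 (W-X² k)))

  C′/s-even : 2 ∣ g →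
    Curves.QuotientGivenBy k (Curves.Involutions.s k g c) ((X +ₚ numeral 2) *ₚ (D g +ₚ const c))
  C′/s-even 2∣g = quotient-s-even k (Curves.Involutions.s k g c) N δ (embed-C′ k g c) refl
    (proj₁ (even⇒g+2-even g 2∣g)) (proj₂ (even⇒g+2-even g 2∣g)) refl
    (W-product k 0<g c (X +ₚ numeral 2) (W-X+2 k))

  C′/sω-even : 2 ∣ g →
    Curves.QuotientGivenBy k (Curves.Involutions.sω k g c) ((X -ₚ numeral 2) *ₚ (D g +ₚ const c))
  C′/sω-even 2∣g = quotient-sω-even k (Curves.Involutions.sω k g c) N δ (embed-C′ k g c) refl
    (proj₁ (even⇒g+2-even g 2∣g)) (proj₂ (even⇒g+2-even g 2∣g)) refl
    (W-product k 0<g c (X -ₚ numeral 2) (W-minus-numeral k X 2 (W-X k)))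

open import Data.Nat using (_^_; _≤_; _<_)

theorem1 :
    ∀ {a ℓ} (k : Field a ℓ) (p n g : ℕ) (c : Field.Carrier k) →
    Prime p → 2 < p → HasCardinality k (p ^ n) →
    2 ≤ g → gcd g p ≡ 1 →
    let open Curves k
        open Involutions g c
    in
    IsHyperelliptic g (C′ g c) →
    ((¬ 2 ∣ g → QuotientGivenBy s (D g +ₚ const c)) ×
     (2 ∣ g → QuotientGivenBy s ((X +ₚ numeral 2) *ₚ (D g +ₚ const c)))) ×
    ((¬ 2 ∣ g → QuotientGivenBy sω ((X *ₚ X -ₚ numeral 4) *ₚ (D g +ₚ const c))) ×
     (2 ∣ g → QuotientGivenBy sω ((X -ₚ numeral 2) *ₚ (D g +ₚ const c))))
theorem1 k p n g c _ _ _ 2≤g _ _ =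
  -- `2 ≤ g` is `1 < g`, which weakens to `1 ≤ g`, that is, `0 < g`.
  (C′/s-odd k g c (ℕ.<⇒≤ 2≤g) , C′/s-even k g c (ℕ.<⇒≤ 2≤g)) ,
  (C′/sω-odd k g c (ℕ.<⇒≤ 2≤g) , C′/sω-even k g c (ℕ.<⇒≤ 2≤g))
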